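{- Let $d>1$ and $n$ be positive integers with $d\mid n$. The collection $\{\Sigma_\alpha:\alpha\in A_n^d\}$, ordered by $rr$-lex, is a dual $EL$-ced of $\Pi_n^d$ with respect to the labeling $\lambda$.
   Context: $\Pi_n^d$ is the set of partitions of $[n]$ (other than the one-block partition) whose blocks all have size divisible by $d$, ordered by refinement, with top $\hat1=\{[n]\}$ and bottom $\hat0$ adjoined; it has rank $k=n/d$. Labeling $\lambda$ of cover relations: if $y\gtrdot z$, $z\ne\hat0$, $y$ is obtained by merging blocks $B_1,B_2$ of $z$ with $\max B_1<\max B_2$; $\lambda(y\gtrdot z)=-\max B_1$ if $\max B_1<\min B_2$, else $\max B_1$; and $\lambda(y\gtrdot\hat0)=0$. Write $\alpha\in S_n$ as the word $\alpha(1)\cdots\alpha(n)$; $\operatorname{des}\alpha=\{i:\alpha(i)>\alpha(i+1)\}$. $A_n^d=\{\alpha\in S_n:\alpha(n)=n,\ \operatorname{des}\alpha=\{d,2d,\dots,n-d\}\}$. For $\alpha\in S_n$, choose a subset $I\subseteq\{1,\dots,n/d-1\}$ and for each $i\in I$ choose either to "split" or to "switch-and-split" at position $di$: first transpose the letters in positions $di,di+1$ for each switch-and-split position, then cut the resulting word at the positions $di$, $i\in I$; the sets of letters of the resulting segments form a $d$-divisible partition. $\Sigma_\alpha$ is the subposet of $\Pi_n^d$ consisting of $\hat0$ and all partitions so obtained. $rr$-lex order on $A_n^d$: compare the reversed words $\alpha(n)\alpha(n-1)\cdots\alpha(1)$ lexicographically, where letters are ordered $n\lhd n-1\lhd\dots\lhd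 1$. A dual $EL$-ced is an $EL$-ced of the dual poset $Q$ (the order reversed, so chains are read from $\hat1=[n]$ downwards), with $\lambda$ viewed as an edge labeling of $Q$; here, for a bounded poset $Q$ of rank $k$ with edge labeling $\mu$ that is an $EL$-labeling (every interval has a unique maximal chain with weakly increasing labels read from its bottom, which is lexicographically first), and an ordered collection $\Sigma_1,\dots,\Sigma_m$ of rank-$k$ subposets, let $\Delta_s$ be the simplicial complex generated by maximal chains lying in $\Sigma_s$ but in no $\Sigma_t$ with $t<s$; a chain is descending if each label is strictly greater than (i.e. not $\le$) the next. The collection is an $EL$-ced if: (polytope) each $\Sigma_s$ is isomorphic to the face lattice of a convex polytope; (desc) for every $s$ and interval $[x,y]$ of $Q$ at most one descending maximal chain of $[x,y]$ is a face of $\Delta_s$; (bdry) any chain of length $<k$ extendable to maximal chains in both $\Delta_s$ and $\Delta_t$ ($t<s$) extends to a maximal chain of $\Sigma_s$ that is not a maximal chain of $\Delta_s$; (union) every chain of $Q$ lies in some $\Sigma_s$. -}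

module Defs where

open import Data.Nat as ℕ using (ℕ; zero; suc; _∸_; _<ᵇ_; _≡ᵇ_)
open import Data.Nat.Divisibility using (_∣_)
open import Data.Bool using (Bool; true; false; not; _∧_; _∨_; if_then_else_)
open import Data.Fin as Fin using (Fin; toℕ)
open import Data.Vec using (Vec; []; _∷_; lookup; tabulate; replicate; zipWith; foldr)
open import Data.List using (List; []; _∷_; length)
open import Data.List.Membership.Propositional using (_∈_)
open import Data.List.Relation.Unary.All using (All)
open import Data.List.Relation.Unary.Linked using (Linked)
open import Data.Integer as ℤ using (ℤ; +_; -[1+_])
open import Data.Rational as ℚ using (ℚ)
open import Data.Product using (Σ; ∃; _×_; _,_)
open import Data.Sum using (_⊎_)
open import Data.Unit using (⊤)
open import Data.Empty using (⊥)
open import Relation.Nullary using (¬_)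
open import Relation.Binary.PropositionalEquality using (_≡_; _≢_)
open import Function.Bundles using (_⇔_)

-- Elements of Π_n^d (with ˆ0 adjoined).  A partition of [n] is encoded
-- by its n×n Boolean "same block" matrix; the element i : Fin n stands
-- for the integer (toℕ i + 1) ∈ [n].

data Pt (n : ℕ) : Set where
  bot : Pt n
  prt : Vec (Vec Bool n) n → Pt n

module _ {n : ℕ} where

  entry : Vec (Vec Bool n) n → Fin n → Fin n → Bool
  entry R i j = lookup (lookup R i) j

  Rel : Vec (Vec Bool n) n → Fin n → Fin n → Set
  Rel R i j = entry R i j ≡ true

  IsPartition : Vec (Vec Bool n) n → Set
  IsPartition R = (∀ i → Rel R i i)
                × (∀ i j → Rel R i j → Rel R j i)
                × (∀ i j l → Rel R i j → Rel R j l → Rel R i l)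

  top : Pt n
  top = prt (replicate n (replicate n true))

  _≼_ : Pt n → Pt n → Set
  bot ≼ _ = ⊤
  prt R ≼ bot = ⊥
  prt R ≼ prt S = ∀ i j → Rel R i j → Rel S i j

  _≺_ : Pt n → Pt n → Set
  x ≺ y = x ≼ y × x ≢ y

  merge : Vec (Vec Bool n) n → Fin n → Fin n → Vec (Vec Bool n) n
  merge Z a b = tabulate λ i → tabulate λ j →
    entry Z i j ∨ (entry Z i a ∧ entry Z j b) ∨ (entry Z i b ∧ entry Z j a)

  IsMax : Vec (Vec Bool n) n → Fin n → Set
  IsMax Z a = ∀ j → Rel Z a j → toℕ j ℕ.≤ toℕ a

  Lab : Pt n → Pt n → ℤ → Set
  Lab _ bot ℓ = ℓ ≡ + 0
  Lab bot (prt _) ℓ = ⊥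
  Lab (prt Y) (prt Z) ℓ =
    Σ (Fin n) λ a → Σ (Fin n) λ b →
      IsMax Z a × IsMax Z b × toℕ a ℕ.< toℕ b × Y ≡ merge Z a b ×
      (  ((∀ j → Rel Z b j → toℕ a ℕ.< toℕ j) × ℓ ≡ -[1+ toℕ a ])
       ⊎ (¬ (∀ j → Rel Z b j → toℕ a ℕ.< toℕ j) × ℓ ≡ + suc (toℕ a)))

trues : {m : ℕ} → Vec Bool m → ℕ
trues [] = 0
trues (true ∷ v) = suc (trues v)
trues (false ∷ v) = trues v

module PiNd (n d k : ℕ) where

  Valid : Pt n → Set
  Valid bot = ⊤
  Valid (prt R) = IsPartition R × (∀ i → d ∣ trues (lookup R i))

  record Covers (y z : Pt n) : Set where
    field
      validʸ : Valid y
      validᶻ : Valid z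
      lt     : z ≺ y
      none   : ∀ w → Valid w → z ≺ w → w ≺ y → ⊥

  -- MC x y c : c = (x = c₀ ⋗ c₁ ⋗ ⋯ ⋗ cₘ = y) is a maximal chain of the
  -- interval [x,y] of the dual poset Q, listed from x (the bottom in Q).
  data MC : Pt n → Pt n → List (Pt n) → Set where
    single : ∀ {x} → Valid x → MC x x (x ∷ [])
    step   : ∀ {x y z c} → Covers x y → MC y z c → MC x z (x ∷ c)

  data Labels : List (Pt n) → List ℤ → Set where
    nil  : Labels [] []
    one  : ∀ {x} → Labels (x ∷ []) []
    cons : ∀ {x y c ℓ ls} → Lab x y ℓ → Labels (y ∷ c) ls → Labels (x ∷ y ∷ c) (ℓ ∷ ls)

  WeakInc : List ℤ → Set
  WeakInc = Linked ℤ._≤_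

  Descending : List ℤ → Set
  Descending = Linked (λ a b → ¬ (a ℤ.≤ b))

  data LexLeq : List ℤ → List ℤ → Set where
    nil  : ∀ {ys} → LexLeq [] ys
    lt   : ∀ {x y xs ys} → x ℤ.< y → LexLeq (x ∷ xs) (y ∷ ys)
    eq   : ∀ {x xs ys} → LexLeq xs ys → LexLeq (x ∷ xs) (x ∷ ys)

  IsDualEL : Set
  IsDualEL = ∀ x y → Valid x → Valid y → y ≼ x →
    Σ (List (Pt n)) λ c → Σ (List ℤ) λ ls →
      MC x y c × Labels c ls × WeakInc ls
      × (∀ c' ls' → MC x y c' → Labels c' ls' → WeakInc ls' → c' ≡ c)
      × (∀ c' ls' → MC x y c' → Labels c' ls' → LexLeq ls ls')

  Chain : List (Pt n) → Set
  Chain c = All Valid c × Linked (λ x y → y ≺ x) c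

  _⊆_ : List (Pt n) → List (Pt n) → Set
  c ⊆ M = ∀ {x} → x ∈ c → x ∈ M

  dot : {m : ℕ} → Vec ℚ m → Vec ℚ m → ℚ
  dot a v = foldr _ ℚ._+_ ℚ.0ℚ (zipWith ℚ._*_ a v)

  -- FaceOf a b V S : every vertex satisfies a·v ≤ b, and S flags exactly
  -- the vertices with a·v = b (the vertex set of the face cut out).
  FaceOf : {m : ℕ} → Vec ℚ m → ℚ → List (Vec ℚ m) → List Bool → Set
  FaceOf a b [] [] = ⊤
  FaceOf a b [] (_ ∷ _) = ⊥
  FaceOf a b (_ ∷ _) [] = ⊥
  FaceOf a b (v ∷ V) (s ∷ S) = (dot a v ℚ.≤ b) × (s ≡ true ⇔ dot a v ≡ b) × FaceOf a b V S

  IsFace : {m : ℕ} → List (Vec ℚ m) → List Bool → Set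
  IsFace {m} V S = Σ (Vec ℚ m) λ a → Σ ℚ λ b → FaceOf a b V S

  SubFlags : List Bool → List Bool → Set
  SubFlags [] [] = ⊤
  SubFlags [] (_ ∷ _) = ⊥
  SubFlags (_ ∷ _) [] = ⊥
  SubFlags (s ∷ S) (t ∷ T) = (s ≡ true → t ≡ true) × SubFlags S T

  -- the subposet P (of Π_n^d, induced order) is isomorphic to the face
  -- lattice of the convex polytope conv(V) (faces ↔ their vertex sets)
  IsPolytopeLattice : (Pt n → Set) → Set
  IsPolytopeLattice P =
    Σ ℕ λ m → Σ (List (Vec ℚ m)) λ V → Σ (Pt n → List Bool) λ f →
        (∀ x → P x → IsFace V (f x))
      × (∀ S → IsFace V S → Σ (Pt n) λ x → P x × f x ≡ S)
      × (∀ x y → P x → P y → (x ≼ y ⇔ SubFlags (f x) (f y)))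

  module _ (Idx : Set) (_<ᵢ_ : Idx → Idx → Set) (InΣ : Idx → Pt n → Set) where

    MaxChain : List (Pt n) → Set
    MaxChain = MC top bot

    Gen : Idx → List (Pt n) → Set
    Gen s M = MaxChain M × All (InΣ s) M × (∀ t → t <ᵢ s → ¬ All (InΣ t) M)

    FaceΔ : Idx → List (Pt n) → Set
    FaceΔ s c = Σ (List (Pt n)) λ M → Gen s M × c ⊆ M

    record DualELced : Set where
      field
        isEL     : IsDualEL
        polytope : ∀ s → IsPolytopeLattice (InΣ s)
        desc     : ∀ s x y → Valid x → Valid y → y ≼ x →
                   ∀ c c' ls ls' →
                   MC x y c → Labels c ls → Descending ls → FaceΔ s c →
                   MC x y c' → Labels c' ls' → Descending ls' → FaceΔ s c' →
                   c ≡ c'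
        bdry     : ∀ s t → t <ᵢ s → ∀ c → Chain c → length c ℕ.≤ k →
                   FaceΔ s c → FaceΔ t c →
                   Σ (List (Pt n)) λ M → MaxChain M × All (InΣ s) M × c ⊆ M
                     × Σ Idx λ t' → t' <ᵢ s × All (InΣ t') M
        union    : ∀ c → Chain c → Σ Idx λ s → All (InΣ s) c

-- The permutations A_n^d, the rr-lex order and the subposets Σ_α.
-- Words α(1)⋯α(n) are Vec (Fin n) n (index i ↦ position i+1, letter
-- a ↦ a+1).

InA : (n d : ℕ) → Vec (Fin n) n → Set
InA n d α =
    (∀ i j → lookup α i ≡ lookup α j → i ≡ j)
  × (∀ i → toℕ i ≡ n ∸ 1 → toℕ (lookup α i) ≡ n ∸ 1)
  × (∀ i j → toℕ j ≡ suc (toℕ i) →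
       (toℕ (lookup α j) ℕ.< toℕ (lookup α i) ⇔ d ∣ suc (toℕ i)))

RRLess : {n : ℕ} → Vec (Fin n) n → Vec (Fin n) n → Set
RRLess {n} α β = Σ (Fin n) λ j →
  (∀ i → toℕ j ℕ.< toℕ i → lookup α i ≡ lookup β i)
  × toℕ (lookup β j) ℕ.< toℕ (lookup α j)

-- choice at each position di (i = 1, …, k-1)
data Act : Set where
  none split swsplit : Act

-- effect of the switches on a 0-based index p (cut i at 1-based d*i
-- swaps 0-based indices d*i-1 and d*i); j is the current i
swAux : ℕ → ℕ → {m : ℕ} → Vec Act m → ℕ → ℕ
swAux d j [] p = p
swAux d j (none ∷ as) p = swAux d (suc j) as p
swAux d j (split ∷ as) p = swAux d (suc j) as p
swAux d j (swsplit ∷ as) p =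
  if p ≡ᵇ (d ℕ.* j ∸ 1) then d ℕ.* j
  else if p ≡ᵇ (d ℕ.* j) then d ℕ.* j ∸ 1
  else swAux d (suc j) as p

-- are 0-based indices p, q separated by one of the cuts?
sepAux : ℕ → ℕ → {m : ℕ} → Vec Act m → ℕ → ℕ → Bool
sepAux d j [] p q = false
sepAux d j (none ∷ as) p q = sepAux d (suc j) as p q
sepAux d j (split ∷ as) p q =
  ((p <ᵇ d ℕ.* j) ∧ not (q <ᵇ d ℕ.* j)) ∨ ((q <ᵇ d ℕ.* j) ∧ not (p <ᵇ d ℕ.* j))
  ∨ sepAux d (suc j) as p q
sepAux d j (swsplit ∷ as) p q =
  ((p <ᵇ d ℕ.* j) ∧ not (q <ᵇ d ℕ.* j)) ∨ ((q <ᵇ d ℕ.* j) ∧ not (p <ᵇ d ℕ.* j))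
  ∨ sepAux d (suc j) as p q

SigmaElt : (n d k : ℕ) → Vec (Fin n) n → Pt n → Set
SigmaElt n d k α x =
  x ≡ bot ⊎
  Σ (Vec Act (k ∸ 1)) λ c → Σ (Vec (Vec Bool n) n) λ R →
    x ≡ prt R ×
    (∀ p q → entry R (lookup α p) (lookup α q)
             ≡ not (sepAux d 1 c (swAux d 1 c (toℕ p)) (swAux d 1 c (toℕ q))))

IdxA : (n d : ℕ) → Set
IdxA n d = Σ (Vec (Fin n) n) (InA n d)

SigmaCollectionIsDualELced : (n d k : ℕ) → Set
SigmaCollectionIsDualELced n d k =
  PiNd.DualELced n d k (IdxA n d)
    (λ s t → RRLess (Data.Product.proj₁ s) (Data.Product.proj₁ t))
    (λ s x → SigmaElt n d k (Data.Product.proj₁ s) x)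

{-# OPTIONS --safe #-}

-- Given a chain c of partitions, sort the letters lexicographically by the tuple of maxima of
-- their blocks in the members of c, coarsest first, ties being broken by value.  In the
-- resulting word W the blocks of the members of c are intervals, and putting the larger letter
-- first at each pair of positions di, di+1 gives a word α_c of A_n^d with c ⊆ Σ_{α_c}.  This
-- word is rr-least: let c ⊆ Σ_β and let W' be β after the switches made by c.  At the last
-- position where W and W' differ, W has the larger letter; otherwise W' would contain a letter
-- strictly between two letters of a block to which it does not belong.  This yields (union),
-- and a maximal chain M can generate Δ_s only if s, switched along M, is sorted by the keys of M.
--
-- (bdry) Refine c inside Σ_s by making the missing cuts of each gap from right to left, and by
-- switching at every cut not made by c.  If the result M were sorted by the keys of M, then it
-- would be sorted by those of c, so s would be rr-least for c, contrary to c ⊆ Σ_t with t < s.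
-- (desc) In a generator of Δ_s every step splits a block into a left part and a right part
-- with larger maximum, so a step is determined by the maximum it creates, up to the sign of its
-- label.  If the signs at some maximum differed in two descending chains, then they would also
-- differ at a maximum further right.
-- (EL) The least label available below x is −a, for the largest a such that the letters ≤ a
-- can be split off from the block of a, and otherwise the least new block maximum.
-- (polytope) A choice of none, split or switch-and-split at each cut is a face of the 0/1-cube.
module Submission where

open import Defs
open import Data.Nat as ℕ using (ℕ; zero; suc; _+_; _*_; _∸_; _≤_; _<_; z≤n; s≤s)
open import Data.Nat.Properties
open import Data.Nat.Divisibility
open import Data.Bool as 𝔹 using (Bool; true; false; not; _∧_; _∨_; if_then_else_)
import Data.Bool.Properties as 𝔹ₚ
open import Data.Fin as F using (Fin; toℕ; fromℕ<)
import Data.Fin.Properties as Fₚ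
open import Data.Vec using (Vec; []; _∷_; lookup; tabulate)
import Data.Vec.Properties as Vₚ
open import Data.List as L using (List; []; _∷_; _++_)
open import Data.List.Membership.Propositional using (_∈_)
open import Data.List.Relation.Unary.Any using (here; there)
open import Data.List.Relation.Unary.All as All using (All; []; _∷_)
open import Data.List.Relation.Unary.Linked as Linked using (Linked; []; [-]; _∷_)
open import Data.Integer as ℤ using (ℤ; +_; -[1+_])
import Data.Integer.Properties as ℤₚ
open import Data.Product using (Σ; ∃; _×_; _,_; proj₁; proj₂)
open import Data.Sum using (_⊎_; inj₁; inj₂; [_,_]′)
open import Data.Unit using (⊤; tt)
open import Data.Empty using (⊥; ⊥-elim)
open import Relation.Nullary using (¬_; Dec; yes; no; does; contradiction; ¬?; _×-dec_; _⊎-dec_; _→-dec_)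
open import Relation.Nullary.Decidable using (dec-true; dec-false; map′; decidable-stable)
open import Relation.Binary.PropositionalEquality
open import Relation.Binary.Definitions using (tri<; tri≈; tri>)
open import Function using (_∘_; id)
open import Function.Bundles using (_⇔_; mk⇔; Equivalence)
open import Data.Rational as ℚ using (ℚ)
import Data.Rational.Properties as ℚₚ
open import Data.List.Properties using (map-cong)
open import Data.List.Membership.Propositional.Properties using (∈-++⁺ˡ; ∈-++⁺ʳ; ∈-map⁺)

-- A word of A_n^d enters through the position function `pos` of its letters and through `ρ f`,
-- which is `pos` followed by the switches of a choice `f` made at all cuts. Since d > 1, the pairs
-- of positions at different cuts are disjoint, so the switches do not interact, and every partition
-- whose choices are part of `f` divides the single word `ρ f` into intervals. Conversely, the
-- original word has a descent at each cut, so it is recovered from `ρ f` alone. This is why words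
-- can be compared after switching; the delicate case is a difference at a cut pair, which undoing
-- the switches may move. In (desc) the lower end `bot` needs an argument of its own, because two
-- chains down to `bot` might pass through different atoms. Their last label is 0, so all earlier
-- labels are positive, and this forces every cut made below the upper end to be unswitched. Hence
-- the atom is determined, and what remains is an interval between two partitions.

-- Subsets and relations as Boolean functions and matrices.

Mat : ℕ → Set
Mat n = Vec (Vec Bool n) n

Sub : ℕ → Set
Sub n = Fin n → Bool

-- Wrappers around the Boolean equations: unlike these, they determine their
-- arguments by unification.
record _∊_ {n : ℕ} (i : Fin n) (S : Sub n) : Set where
  constructor mem
  field unmem : S i ≡ true
open _∊_ public

record _∋_~_ {n : ℕ} (R : Mat n) (i j : Fin n) : Set where
  constructor rel
  field unrel : Rel R i j
open _∋_~_ public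

record Max {n : ℕ} (R : Mat n) (a : Fin n) : Set where
  constructor maximal
  field above : ∀ {j} → R ∋ a ~ j → toℕ j ≤ toℕ a
open Max public

isMax⇒Max : ∀ {n} {R : Mat n} {a} → IsMax R a → Max R a
isMax⇒Max h = maximal λ { (rel e) → h _ e }

Max⇒isMax : ∀ {n} {R : Mat n} {a} → Max R a → IsMax R a
Max⇒isMax h j e = above h (rel e)

⟦_⟧ : ∀ {a p} {A : Set a} {P : A → Set p} → (∀ x → Dec (P x)) → A → Bool
⟦ P? ⟧ x = does (P? x)

does⇒ : ∀ {p} {P : Set p} (P? : Dec P) → does P? ≡ true → P
does⇒ (yes p) _ = p

module _ {n : ℕ} where

  ⟦⟧⁺ : ∀ {p} {P : Fin n → Set p} (P? : ∀ x → Dec (P x)) {i} → P i → i ∊ ⟦ P? ⟧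
  ⟦⟧⁺ P? {i} p = mem (dec-true (P? i) p)

  ⟦⟧⁻ : ∀ {p} {P : Fin n → Set p} (P? : ∀ x → Dec (P x)) {i} → i ∊ ⟦ P? ⟧ → P i
  ⟦⟧⁻ P? {i} (mem e) = does⇒ (P? i) e

  _∊?_ : ∀ (i : Fin n) S → Dec (i ∊ S)
  i ∊? S = map′ mem unmem (S i 𝔹.≟ true)

  _∋_~?_ : ∀ (R : Mat n) i j → Dec (R ∋ i ~ j)
  R ∋ i ~? j = map′ rel unrel (entry R i j 𝔹.≟ true)

  mat : {P : Fin n → Fin n → Set} → (∀ i j → Dec (P i j)) → Mat n
  mat P? = tabulate λ i → tabulate λ j → does (P? i j)

  entry-mat : {P : Fin n → Fin n → Set} (P? : ∀ i j → Dec (P i j)) →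
              ∀ i j → entry (mat P?) i j ≡ does (P? i j)
  entry-mat P? i j = trans (cong (λ v → lookup v j) (Vₚ.lookup∘tabulate _ i))
                           (Vₚ.lookup∘tabulate _ j)

  mat⁺ : {P : Fin n → Fin n → Set} (P? : ∀ i j → Dec (P i j)) →
         ∀ {i j} → P i j → mat P? ∋ i ~ j
  mat⁺ P? {i} {j} p = rel (trans (entry-mat P? i j) (dec-true (P? i j) p))

  mat⁻ : {P : Fin n → Fin n → Set} (P? : ∀ i j → Dec (P i j)) →
         ∀ {i j} → mat P? ∋ i ~ j → P i j
  mat⁻ P? {i} {j} (rel e) = does⇒ (P? i j) (trans (sym (entry-mat P? i j)) e)

  _⊑ᵐ_ : Mat n → Mat n → Set
  R ⊑ᵐ S = ∀ {i j} → R ∋ i ~ j → S ∋ i ~ j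

  mat-ext : {R S : Mat n} → (∀ i j → entry R i j ≡ entry S i j) → R ≡ S
  mat-ext {R} {S} h = begin
    R                                             ≡⟨ η R ⟨
    (tabulate λ i → tabulate λ j → entry R i j)   ≡⟨ Vₚ.tabulate-cong (λ i → Vₚ.tabulate-cong (h i)) ⟩
    (tabulate λ i → tabulate λ j → entry S i j)   ≡⟨ η S ⟩
    S                                             ∎
    where
    open ≡-Reasoning
    η : ∀ T → (tabulate λ i → tabulate λ j → entry T i j) ≡ T
    η T = trans (Vₚ.tabulate-cong (λ i → Vₚ.tabulate∘lookup (lookup T i))) (Vₚ.tabulate∘lookup T)

  ⊑ᵐ-antisym : {R S : Mat n} → R ⊑ᵐ S → S ⊑ᵐ R → R ≡ S
  ⊑ᵐ-antisym {R} {S} f g = mat-ext λ i j → eq i j (entry R i j) (entry S i j) refl refl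
    where
    eq : ∀ i j b c → entry R i j ≡ b → entry S i j ≡ c → b ≡ c
    eq i j true  true  p q = refl
    eq i j false false p q = refl
    eq i j true  false p q = trans (sym (unrel (f (rel p)))) q
    eq i j false true  p q = trans (sym p) (unrel (g (rel q)))

bool-⇔ : ∀ {a b} → (a ≡ true → b ≡ true) → (b ≡ true → a ≡ true) → a ≡ b
bool-⇔ {true}  {true}  f g = refl
bool-⇔ {true}  {false} f g = sym (f refl)
bool-⇔ {false} {true}  f g = g refl
bool-⇔ {false} {false} f g = refl

∨-true : ∀ {a b} → a ∨ b ≡ true → (a ≡ true) ⊎ (b ≡ true)
∨-true {true}  _ = inj₁ refl
∨-true {false} e = inj₂ e

∧-true : ∀ {a b} → a ∧ b ≡ true → a ≡ true × b ≡ true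
∧-true {true} {true} _ = refl , refl

-- Counting

opaque
  cnt : ∀ {n} → Sub n → ℕ
  cnt S = trues (tabulate S)

opaque
  unfolding cnt

  trues-cnt : ∀ {n} (v : Vec Bool n) → trues v ≡ cnt (lookup v)
  trues-cnt v = cong trues (sym (Vₚ.tabulate∘lookup v))

  cnt-cong : ∀ {n} {S T : Sub n} → (∀ i → S i ≡ T i) → cnt S ≡ cnt T
  cnt-cong h = cong trues (Vₚ.tabulate-cong h)

  cnt-⊎ : ∀ {n} (S T U : Sub n) → (∀ i → S i ≡ T i ∨ U i) →
          (∀ i → T i ≡ true → U i ≡ true → ⊥) → cnt S ≡ cnt T + cnt U
  cnt-⊎ {zero}  S T U h dis = refl
  cnt-⊎ {suc n} S T U h dis
    with S F.zero | T F.zero | U F.zero | h F.zero | dis F.zero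
       | cnt-⊎ (S ∘ F.suc) (T ∘ F.suc) (U ∘ F.suc) (h ∘ F.suc) (dis ∘ F.suc)
  ... | true  | true  | true  | e | ds | ih = ⊥-elim (ds refl refl)
  ... | true  | true  | false | e | ds | ih = cong suc ih
  ... | true  | false | true  | e | ds | ih = trans (cong suc ih) (sym (+-suc _ _))
  ... | false | false | false | e | ds | ih = ih

  cnt-none : ∀ {n} (S : Sub n) → (∀ i → S i ≡ false) → cnt S ≡ 0
  cnt-none {zero} S h = refl
  cnt-none {suc n} S h with S F.zero | h F.zero
  ... | false | _ = cnt-none (S ∘ F.suc) (h ∘ F.suc)

  cnt-all : ∀ {n} (S : Sub n) → (∀ i → S i ≡ true) → cnt S ≡ n
  cnt-all {zero} S h = refl
  cnt-all {suc n} S h with S F.zero | h F.zero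
  ... | true | _ = cong suc (cnt-all (S ∘ F.suc) (h ∘ F.suc))

  cnt-pos : ∀ {n} {S : Sub n} {i} → i ∊ S → 0 < cnt S
  cnt-pos {suc n} {S} {F.zero} (mem e) with S F.zero
  ... | true = s≤s z≤n
  cnt-pos {suc n} {S} {F.suc i} (mem e) with S F.zero
  ... | true = s≤s z≤n
  ... | false = cnt-pos {S = S ∘ F.suc} (mem e)

  cnt-single : ∀ {n} (j : Fin n) → cnt (λ i → does (i Fₚ.≟ j)) ≡ 1
  cnt-single {suc n} F.zero = cong suc (cnt-none {n} (λ _ → false) (λ _ → refl))
  cnt-single {suc n} (F.suc j) = cnt-single {n} j

module _ {n : ℕ} where

  cnt-≡ : {S T : Sub n} → (∀ {i} → i ∊ S → i ∊ T) → (∀ {i} → i ∊ T → i ∊ S) → cnt S ≡ cnt T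
  cnt-≡ f g = cnt-cong λ i → bool-⇔ (λ e → unmem (f {i} (mem e))) (λ e → unmem (g {i} (mem e)))

  cnt-+ : (S T U : Sub n) → (∀ {i} → i ∊ S → (i ∊ T) ⊎ (i ∊ U)) →
          (∀ {i} → i ∊ T → i ∊ S) → (∀ {i} → i ∊ U → i ∊ S) →
          (∀ {i} → i ∊ T → i ∊ U → ⊥) → cnt S ≡ cnt T + cnt U
  cnt-+ S T U f g h dis = cnt-⊎ S T U (λ i → bool-⇔ (to i) (fro i)) (λ i a b → dis (mem a) (mem b))
    where
    to : ∀ i → S i ≡ true → T i ∨ U i ≡ true
    to i e with f {i} (mem e)
    ... | inj₁ (mem t) rewrite t = refl
    ... | inj₂ (mem u) with T i
    ...   | true = refl
    ...   | false = u
    fro : ∀ i → T i ∨ U i ≡ true → S i ≡ true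
    fro i e = [ unmem ∘ g ∘ mem , unmem ∘ h ∘ mem ]′ (∨-true e)

  infixl 6 _∖_
  _∖_ : Sub n → Sub n → Sub n
  (S ∖ T) i = S i ∧ not (T i)

  ∖⁺ : ∀ {S T : Sub n} {i} → i ∊ S → ¬ (i ∊ T) → i ∊ (S ∖ T)
  ∖⁺ {S} {T} {i} (mem s) ¬t = mem (help (S i) (T i) s λ t → ¬t (mem t))
    where
    help : ∀ a b → a ≡ true → ¬ (b ≡ true) → a ∧ not b ≡ true
    help true true  _ h = ⊥-elim (h refl)
    help true false _ _ = refl

  ∖⁻ : ∀ {S T : Sub n} {i} → i ∊ (S ∖ T) → (i ∊ S) × ¬ (i ∊ T)
  ∖⁻ {S} {T} {i} (mem e) = lemma (S i) (T i) refl refl e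
    where
    lemma : ∀ a b → S i ≡ a → T i ≡ b → a ∧ not b ≡ true → (i ∊ S) × ¬ (i ∊ T)
    lemma true false p q _ = mem p , λ { (mem r) → contradiction (trans (sym q) r) λ () }

  cnt-∖ : (S T : Sub n) → (∀ {i} → i ∊ T → i ∊ S) → cnt S ≡ cnt T + cnt (S ∖ T)
  cnt-∖ S T sub = cnt-+ S T (S ∖ T) f sub (proj₁ ∘ ∖⁻) (λ t u → proj₂ (∖⁻ u) t)
    where
    f : ∀ {i} → i ∊ S → (i ∊ T) ⊎ (i ∊ (S ∖ T))
    f {i} s with i ∊? T
    ... | yes t = inj₁ t
    ... | no ¬t = inj₂ (∖⁺ s ¬t)

  cnt-mono : {S T : Sub n} → (∀ {i} → i ∊ S → i ∊ T) → cnt S ≤ cnt T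
  cnt-mono {S} {T} sub = subst (cnt S ≤_) (sym (cnt-∖ T S sub)) (m≤m+n _ _)

  cnt-< : {S T : Sub n} → (∀ {i} → i ∊ S → i ∊ T) → ∀ {j} → j ∊ T → ¬ (j ∊ S) → cnt S < cnt T
  cnt-< {S} {T} sub t ¬s = subst (cnt S <_) (sym (cnt-∖ T S sub))
                             (m<m+n (cnt S) (cnt-pos (∖⁺ t ¬s)))

  cnt-⊇ : {S T : Sub n} → (∀ {i} → i ∊ S → i ∊ T) → cnt T ≤ cnt S → ∀ {i} → i ∊ T → i ∊ S
  cnt-⊇ {S} sub le {i} t with i ∊? S
  ... | yes s = s
  ... | no ¬s = contradiction (cnt-< sub t ¬s) (≤⇒≯ le)

  cnt≤ : (S : Sub n) → cnt S ≤ n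
  cnt≤ S = subst (cnt S ≤_) (cnt-all (λ _ → true) (λ _ → refl)) (cnt-mono {T = λ _ → true} (λ _ → mem refl))

largest : ∀ {n} {p} {P : Fin n → Set p} → (∀ i → Dec (P i)) → ∃ P →
          ∃ λ i → P i × (∀ j → P j → toℕ j ≤ toℕ i)
largest {suc n} {P = P} P? w with Fₚ.any? (P? ∘ F.suc)
... | yes q = let i , p , h = largest (P? ∘ F.suc) q in
              F.suc i , p , λ { F.zero _ → z≤n ; (F.suc j) pj → s≤s (h j pj) }
... | no ¬q = F.zero , zr w , λ { F.zero _ → z≤n ; (F.suc j) pj → ⊥-elim (¬q (j , pj)) }
  where
  zr : ∃ P → P F.zero
  zr (F.zero , p) = p
  zr (F.suc j , p) = ⊥-elim (¬q (j , p))

smallest : ∀ {n} {p} {P : Fin n → Set p} → (∀ i → Dec (P i)) → ∃ P →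
           ∃ λ i → P i × (∀ j → P j → toℕ i ≤ toℕ j)
smallest {suc n} {P = P} P? w with P? F.zero
... | yes p = F.zero , p , λ _ _ → z≤n
... | no ¬p = let i , p , h = smallest (P? ∘ F.suc) (sc w) in
              F.suc i , p , λ { F.zero p0 → ⊥-elim (¬p p0) ; (F.suc j) pj → s≤s (h j pj) }
  where
  sc : ∃ P → ∃ (P ∘ F.suc)
  sc (F.zero , p) = ⊥-elim (¬p p)
  sc (F.suc j , p) = j , p

-- Partitions and block maxima

record Part {n : ℕ} (R : Mat n) : Set where
  field
    ~refl  : ∀ {i} → R ∋ i ~ i
    ~sym   : ∀ {i j} → R ∋ i ~ j → R ∋ j ~ i
    ~trans : ∀ {i j l} → R ∋ i ~ j → R ∋ j ~ l → R ∋ i ~ l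
open Part public

module _ {n : ℕ} where

  part : {R : Mat n} → IsPartition R → Part R
  part (r , s , t) = record { ~refl = rel (r _) ; ~sym = λ e → rel (s _ _ (unrel e))
                            ; ~trans = λ e f → rel (t _ _ _ (unrel e) (unrel f)) }

  isPartition : {R : Mat n} → Part R → IsPartition R
  isPartition p = (λ i → unrel (~refl p)) , (λ i j e → unrel (~sym p (rel e)))
                , (λ i j l e f → unrel (~trans p (rel e) (rel f)))

  opaque
    row : Mat n → Fin n → Sub n
    row R i j = entry R i j

  opaque
    unfolding row

    row⁺ : ∀ {R : Mat n} {i j} → R ∋ i ~ j → j ∊ row R i
    row⁺ (rel e) = mem e

    row⁻ : ∀ {R : Mat n} {i j} → j ∊ row R i → R ∋ i ~ j
    row⁻ (mem e) = rel e

    cnt-row : (R : Mat n) (i : Fin n) → trues (lookup R i) ≡ cnt (row R i)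
    cnt-row R i = trues-cnt (lookup R i)

  mx : Mat n → Fin n → Fin n
  mx R u with Fₚ.any? (R ∋ u ~?_)
  ... | yes w = proj₁ (largest (R ∋ u ~?_) w)
  ... | no _ = u

  mx-spec : ∀ {R : Mat n} → Part R → ∀ u → R ∋ u ~ mx R u × (∀ w → R ∋ u ~ w → toℕ w ≤ toℕ (mx R u))
  mx-spec {R} p u with Fₚ.any? (R ∋ u ~?_)
  ... | yes w = proj₂ (largest (R ∋ u ~?_) w)
  ... | no ¬w = ⊥-elim (¬w (u , ~refl p))

  ~mx : ∀ {R : Mat n} → Part R → ∀ u → R ∋ u ~ mx R u
  ~mx p u = proj₁ (mx-spec p u)

  ≤mx : ∀ {R : Mat n} → Part R → ∀ {u w} → R ∋ u ~ w → toℕ w ≤ toℕ (mx R u)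
  ≤mx p {u} {w} e = proj₂ (mx-spec p u) w e

  mx-max : ∀ {R : Mat n} → Part R → ∀ u → Max R (mx R u)
  mx-max p u = maximal λ e → ≤mx p (~trans p (~mx p u) e)

  max-unique : ∀ {R : Mat n} → Part R → ∀ {a b} → Max R a → Max R b → R ∋ a ~ b → a ≡ b
  max-unique p ma mb e = Fₚ.toℕ-injective (≤-antisym (above mb (~sym p e)) (above ma e))

  max⇒mx : ∀ {R : Mat n} → Part R → ∀ {a u} → Max R a → R ∋ u ~ a → mx R u ≡ a
  max⇒mx p {a} {u} ma e = max-unique p (mx-max p u) ma (~trans p (~sym p (~mx p u)) e)

  mx-cong : ∀ {R : Mat n} → Part R → ∀ {u v} → R ∋ u ~ v → mx R u ≡ mx R v
  mx-cong p {u} {v} e = max⇒mx p (mx-max p v) (~trans p e (~mx p v))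

  mx-inj : ∀ {R : Mat n} → Part R → ∀ {u v} → mx R u ≡ mx R v → R ∋ u ~ v
  mx-inj {R} p {u} {v} e = ~trans p (~mx p u) (subst (λ w → R ∋ w ~ v) (sym e) (~sym p (~mx p v)))

  mx-mono : ∀ {R S : Mat n} → Part R → Part S → R ⊑ᵐ S → ∀ u → toℕ (mx R u) ≤ toℕ (mx S u)
  mx-mono p q sub u = ≤mx q (sub (~mx p u))

  Max? : (R : Mat n) (a : Fin n) → Dec (Max R a)
  Max? R a = map′ (λ h → maximal λ {j} → h j) (λ h j → above h)
                  (Fₚ.all? λ j → (R ∋ a ~? j) →-dec (toℕ j ℕ.≤? toℕ a))

  max-anti : ∀ {R S : Mat n} → R ⊑ᵐ S → ∀ {a} → Max S a → Max R a
  max-anti sub m = maximal λ e → above m (sub e)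

  -- Repeatedly remove a block.
  closed-div : ∀ {R : Mat n} (d : ℕ) → Part R → (∀ i → d ∣ cnt (row R i)) → (S : Sub n) →
               (∀ {i j} → i ∊ S → R ∋ i ~ j → j ∊ S) → d ∣ cnt S
  closed-div {R} d p div S cl = go (cnt S) S cl ≤-refl
    where
    go : ∀ g (S : Sub n) → (∀ {i j} → i ∊ S → R ∋ i ~ j → j ∊ S) → cnt S ≤ g → d ∣ cnt S
    go g S cl le with Fₚ.any? (_∊? S)
    go g S cl le | no ¬w = subst (d ∣_) (sym (cnt-none S λ i → 𝔹ₚ.¬-not λ e → ¬w (i , mem e))) (d ∣0)
    go zero S cl le | yes (i , s) = contradiction (cnt-pos s) (≤⇒≯ le)
    go (suc g) S cl le | yes (i , s) =
      subst (d ∣_) (sym eq) (∣m∣n⇒∣m+n (div i) (go g (S ∖ row R i) cl' (ℕ.s≤s⁻¹ (≤-trans lt le))))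
      where
      eq = cnt-∖ S (row R i) (λ m → cl s (row⁻ m))
      cl' : ∀ {j l} → j ∊ (S ∖ row R i) → R ∋ j ~ l → l ∊ (S ∖ row R i)
      cl' m e = ∖⁺ (cl (proj₁ (∖⁻ m)) e) λ r → proj₂ (∖⁻ m) (row⁺ (~trans p (row⁻ r) (~sym p e)))
      lt : cnt (S ∖ row R i) < cnt S
      lt = cnt-< (λ m → proj₁ (∖⁻ m)) s (λ m → proj₂ (∖⁻ m) (row⁺ (~refl p)))

-- The poset, its covers, maximal chains and labels.

module Poset (n d k : ℕ) (1<d : 1 < d) (n≡ : n ≡ k * d) where

  open PiNd n d k public hiding (_⊆_)

  0<d : 0 < d
  0<d = <-trans (s≤s z≤n) 1<d

  ≼⇒⊑ : (R S : Mat n) → prt R ≼ prt S → R ⊑ᵐ S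
  ≼⇒⊑ R S h (rel e) = rel (h _ _ e)

  ⊑⇒≼ : {R S : Mat n} → R ⊑ᵐ S → prt R ≼ prt S
  ⊑⇒≼ h i j e = unrel (h (rel e))

  validPart : (R : Mat n) → Valid (prt R) → Part R
  validPart R (p , _) = part p

  validDiv : (R : Mat n) → Valid (prt R) → ∀ i → d ∣ cnt (row R i)
  validDiv R (_ , h) i = subst (d ∣_) (cnt-row R i) (h i)

  mkValid : {R : Mat n} → Part R → (∀ i → d ∣ cnt (row R i)) → Valid (prt R)
  mkValid {R} p h = isPartition p , λ i → subst (d ∣_) (sym (cnt-row R i)) (h i)

  ≼-refl : (x : Pt n) → x ≼ x
  ≼-refl bot = tt
  ≼-refl (prt R) i j e = e

  ≼-trans : (x y z : Pt n) → x ≼ y → y ≼ z → x ≼ z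
  ≼-trans bot y z _ _ = tt
  ≼-trans (prt R) (prt S) (prt T) f g i j e = g i j (f i j e)
  ≼-trans (prt R) (prt S) bot f ()
  ≼-trans (prt R) bot z () g

  prt-antisym : {R S : Mat n} → R ⊑ᵐ S → S ⊑ᵐ R → prt R ≡ prt S
  prt-antisym f g = cong prt (⊑ᵐ-antisym f g)

  ≼-antisym : (x y : Pt n) → x ≼ y → y ≼ x → x ≡ y
  ≼-antisym bot bot _ _ = refl
  ≼-antisym (prt R) (prt S) f g = prt-antisym (≼⇒⊑ R S f) (≼⇒⊑ S R g)
  ≼-antisym bot (prt S) _ ()
  ≼-antisym (prt R) bot () _

  prt-injective : {R S : Mat n} → prt R ≡ prt S → R ≡ S
  prt-injective refl = refl

  d≤cnt : {S : Sub n} {i : Fin n} → d ∣ cnt S → i ∊ S → d ≤ cnt S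
  d≤cnt {S} dv m = ∣⇒≤ {{ℕ.>-nonZero (cnt-pos m)}} dv

  Merged : Mat n → Mat n → Fin n → Fin n → Set
  Merged Y Z a b = ∀ {u v} → Y ∋ u ~ v →
    (Z ∋ u ~ v) ⊎ ((Z ∋ u ~ a) × (Z ∋ v ~ b)) ⊎ ((Z ∋ u ~ b) × (Z ∋ v ~ a))

  -- A partition W between Z and Y either relates `a` and `b`, and then it contains all pairs that Y
  -- adds to Z, or it does not, and then any pair of W outside Z would connect `a` to `b`.
  merged⇒cover : ∀ {Y Z a b} → Valid (prt Y) → Valid (prt Z) → Z ⊑ᵐ Y → Y ∋ a ~ b →
                 ¬ (Z ∋ a ~ b) → Merged Y Z a b → Covers (prt Y) (prt Z)
  merged⇒cover {Y} {Z} {a} {b} vY vZ sub yab ¬zab mg = record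
    { validʸ = vY ; validᶻ = vZ
    ; lt = ⊑⇒≼ sub , λ e → ¬zab (subst (λ R → R ∋ a ~ b) (sym (prt-injective e)) yab)
    ; none = nn }
    where
    pY = validPart Y vY
    nn : ∀ w → Valid w → prt Z ≺ w → w ≺ prt Y → ⊥
    nn bot _ (() , _) _
    nn (prt W) vW (zw , z≢w) (wy , w≢y) with W ∋ a ~? b
    ... | yes wab = w≢y (prt-antisym (≼⇒⊑ W Y wy) yw)
      where
      pW = validPart W vW
      yw : Y ⊑ᵐ W
      yw e with mg e
      ... | inj₁ z = ≼⇒⊑ Z W zw z
      ... | inj₂ (inj₁ (p , q)) = ~trans pW (≼⇒⊑ Z W zw p) (~trans pW wab (~sym pW (≼⇒⊑ Z W zw q)))
      ... | inj₂ (inj₂ (p , q)) = ~trans pW (≼⇒⊑ Z W zw p) (~trans pW (~sym pW wab) (~sym pW (≼⇒⊑ Z W zw q)))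
    ... | no ¬wab = z≢w (prt-antisym (≼⇒⊑ Z W zw) wz)
      where
      pW = validPart W vW
      wz : W ⊑ᵐ Z
      wz e with mg (≼⇒⊑ W Y wy e)
      ... | inj₁ z = z
      ... | inj₂ (inj₁ (p , q)) =
        ⊥-elim (¬wab (~trans pW (~sym pW (≼⇒⊑ Z W zw p)) (~trans pW e (≼⇒⊑ Z W zw q))))
      ... | inj₂ (inj₂ (p , q)) =
        ⊥-elim (¬wab (~trans pW (~sym pW (≼⇒⊑ Z W zw q)) (~trans pW (~sym pW e) (≼⇒⊑ Z W zw p))))

  atom⇒cover : ∀ {Y} → Valid (prt Y) → (∀ i → cnt (row Y i) ≤ d) → Covers (prt Y) bot
  atom⇒cover {Y} vY le = record
    { validʸ = vY ; validᶻ = tt ; lt = tt , (λ ()) ; none = nn }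
    where
    nn : ∀ w → Valid w → bot ≺ w → w ≺ prt Y → ⊥
    nn bot _ (_ , e) _ = e refl
    nn (prt W) vW _ (wy , w≢y) = w≢y (prt-antisym (≼⇒⊑ W Y wy) λ {i} e →
      row⁻ (cnt-⊇ (λ m → row⁺ (≼⇒⊑ W Y wy (row⁻ m)))
                  (≤-trans (le i) (d≤cnt (validDiv W vW i) (row⁺ (~refl (validPart W vW)))))
                  (row⁺ e)))

  mc-validˡ : ∀ {x y c} → MC x y c → Valid x
  mc-validˡ (single v) = v
  mc-validˡ (step cv _) = Covers.validʸ cv

  mc-validʳ : ∀ {x y c} → MC x y c → Valid y
  mc-validʳ (single v) = v
  mc-validʳ (step _ m) = mc-validʳ m

  mc-≼ : ∀ {x y c} → MC x y c → y ≼ x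
  mc-≼ {x} (single _) = ≼-refl x
  mc-≼ {x} {y} (step {y = w} cv m) = ≼-trans y w x (mc-≼ m) (proj₁ (Covers.lt cv))

  mc-head : ∀ {x y c} → MC x y c → ∃ λ c' → c ≡ x ∷ c'
  mc-head (single _) = _ , refl
  mc-head (step _ _) = _ , refl

  mc-x∈ : ∀ {x y c} → MC x y c → x ∈ c
  mc-x∈ (single _) = here refl
  mc-x∈ (step _ _) = here refl

  mc-y∈ : ∀ {x y c} → MC x y c → y ∈ c
  mc-y∈ (single _) = here refl
  mc-y∈ (step _ m) = there (mc-y∈ m)

  mc-≼ˡ : ∀ {x y c w} → MC x y c → w ∈ c → w ≼ x
  mc-≼ˡ {x} (single _) (here refl) = ≼-refl x
  mc-≼ˡ {x} (step _ _) (here refl) = ≼-refl x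
  mc-≼ˡ {x} {w = w} (step {y = z} cv m) (there i) =
    ≼-trans w z x (mc-≼ˡ m i) (proj₁ (Covers.lt cv))

  mc-≼ʳ : ∀ {x y c w} → MC x y c → w ∈ c → y ≼ w
  mc-≼ʳ {x} (single _) (here refl) = ≼-refl x
  mc-≼ʳ {x} m@(step _ _) (here refl) = mc-≼ m
  mc-≼ʳ (step _ m) (there i) = mc-≼ʳ m i

  mc-refl : ∀ {x c} → MC x x c → c ≡ x ∷ []
  mc-refl (single _) = refl
  mc-refl {x} (step {y = w} cv m) =
    ⊥-elim (proj₂ (Covers.lt cv) (≼-antisym w x (proj₁ (Covers.lt cv)) (mc-≼ m)))

  data StepIn : List (Pt n) → List ℤ → Pt n → Pt n → ℤ → Set where
    here  : ∀ {Y Z c ℓ ls} → StepIn (Y ∷ Z ∷ c) (ℓ ∷ ls) Y Z ℓ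
    there : ∀ {X c ℓ ls Y' Z' ℓ'} → StepIn c ls Y' Z' ℓ' → StepIn (X ∷ c) (ℓ ∷ ls) Y' Z' ℓ'

  step-lab : ∀ {c ls Y Z ℓ} → Labels c ls → StepIn c ls Y Z ℓ → Lab Y Z ℓ
  step-lab (cons l _) here = l
  step-lab (cons _ ls) (there s) = step-lab ls s

  step-cover : ∀ {x y c ls Y Z ℓ} → MC x y c → StepIn c ls Y Z ℓ → Covers Y Z
  step-cover (step cv m) here with mc-head m
  ... | _ , refl = cv
  step-cover (step _ m) (there s) = step-cover m s
  step-cover (single _) (there ())

  step-∈ : ∀ {c ls Y Z ℓ} → StepIn c ls Y Z ℓ → (Y ∈ c) × (Z ∈ c)
  step-∈ here = here refl , there (here refl)
  step-∈ (there s) = let p , q = step-∈ s in there p , there q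

  step-label∈ : ∀ {c ls Y Z ℓ} → StepIn c ls Y Z ℓ → ℓ ∈ ls
  step-label∈ here = here refl
  step-label∈ (there s) = there (step-label∈ s)

  -- This locates the step at which a letter becomes a block maximum or two letters are separated.
  crossing : ∀ {x y c ls} {Q : Pt n → Set} → (∀ w → Dec (Q w)) → MC x y c → Labels c ls →
             ¬ Q x → Q y → ∃ λ Y → ∃ λ Z → ∃ λ ℓ → StepIn c ls Y Z ℓ × ¬ Q Y × Q Z
  crossing Q? (single _) _ ¬q q = ⊥-elim (¬q q)
  crossing {x} Q? (step {y = w} cv m) lb ¬q q with mc-head m
  crossing {x} Q? (step {y = w} cv m) (cons l lb) ¬q q | _ , refl with Q? w
  ... | yes qw = x , w , _ , here , ¬q , qw
  ... | no ¬qw = let Y , Z , ℓ , s , a , b = crossing Q? m lb ¬qw q in Y , Z , ℓ , there s , a , b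

  linked-all : ∀ {T : ℤ → ℤ → Set} → (∀ {a b c} → T a b → T b c → T a c) →
               ∀ {ℓ ls} → Linked T (ℓ ∷ ls) → ∀ {ℓ'} → ℓ' ∈ ls → T ℓ ℓ'
  linked-all tr (t ∷ _) (here refl) = t
  linked-all tr (t ∷ l) (there i) = tr t (linked-all tr l i)

  linked-tail : ∀ {T : ℤ → ℤ → Set} {ℓ ls} → Linked T (ℓ ∷ ls) → Linked T ls
  linked-tail [-] = []
  linked-tail (_ ∷ l) = l

  StepOrder : (ℤ → ℤ → Set) → Pt n → Pt n → ℤ → Pt n → Pt n → ℤ → Set
  StepOrder T Y Z ℓ Y' Z' ℓ' = (Y ≡ Y' × Z ≡ Z' × ℓ ≡ ℓ') ⊎ (Y' ≼ Z × T ℓ ℓ') ⊎ (Y ≼ Z' × T ℓ' ℓ)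

  -- In a chain with monotone labels this trades information on the labels of two steps for
  -- information on which step comes first, and conversely.
  step-order : ∀ {T : ℤ → ℤ → Set} → (∀ {a b c} → T a b → T b c → T a c) →
               ∀ {x y c ls Y Z ℓ Y' Z' ℓ'} → MC x y c → Linked T ls →
               StepIn c ls Y Z ℓ → StepIn c ls Y' Z' ℓ' →
               StepOrder T Y Z ℓ Y' Z' ℓ'
  step-order tr m lk here here = inj₁ (refl , refl , refl)
  step-order tr (step cv m) lk here (there s) with mc-head m
  ... | _ , refl = inj₂ (inj₁ (mc-≼ˡ m (proj₁ (step-∈ s)) , linked-all tr lk (step-label∈ s)))
  step-order tr (step cv m) lk (there s) here with mc-head m
  ... | _ , refl = inj₂ (inj₂ (mc-≼ˡ m (proj₁ (step-∈ s)) , linked-all tr lk (step-label∈ s)))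
  step-order tr (step cv m) lk (there s) (there s') = step-order tr m (linked-tail lk) s s'
  step-order tr (single _) lk (there ()) _

  -- In the positive case the negated universal statement of `Lab` is replaced by a witness: a
  -- letter below `a` in the block of `b`.
  Sign : Mat n → Fin n → Fin n → ℤ → Set
  Sign Z a b ℓ = ((∀ {j} → Z ∋ b ~ j → toℕ a < toℕ j) × ℓ ≡ -[1+ toℕ a ])
                 ⊎ ((∃ λ j → (Z ∋ b ~ j) × (toℕ j < toℕ a)) × ℓ ≡ + suc (toℕ a))

  record Merge (Y Z : Mat n) (ℓ : ℤ) : Set where
    field
      a b    : Fin n
      pY     : Part Y
      pZ     : Part Z
      max-a  : Max Z a
      max-b  : Max Z b
      a<b    : toℕ a < toℕ b
      sub    : Z ⊑ᵐ Y
      Yab    : Y ∋ a ~ b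
      merged : Merged Y Z a b
      sign   : Sign Z a b ℓ

    ¬Zab : ¬ (Z ∋ a ~ b)
    ¬Zab e = <⇒≱ a<b (above max-a e)

    ¬max-a : ¬ Max Y a
    ¬max-a m = <⇒≱ a<b (above m Yab)

    separated : ∀ {u v} → Y ∋ u ~ v → ¬ (Z ∋ u ~ v) →
                ((Z ∋ a ~ u) × (Z ∋ b ~ v)) ⊎ ((Z ∋ b ~ u) × (Z ∋ a ~ v))
    separated e ¬z with merged e
    ... | inj₁ z = ⊥-elim (¬z z)
    ... | inj₂ (inj₁ (p , q)) = inj₁ (~sym pZ p , ~sym pZ q)
    ... | inj₂ (inj₂ (p , q)) = inj₂ (~sym pZ p , ~sym pZ q)

    block-a : ∀ {u} → Y ∋ a ~ u → (Z ∋ a ~ u) ⊎ (Z ∋ b ~ u)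
    block-a e with merged e
    ... | inj₁ z = inj₁ z
    ... | inj₂ (inj₁ (_ , q)) = inj₂ (~sym pZ q)
    ... | inj₂ (inj₂ (_ , q)) = inj₁ (~sym pZ q)

    max-b-Y : Max Y b
    max-b-Y = maximal λ e → [ (λ z → ≤-trans (above max-a z) (<⇒≤ a<b)) , above max-b ]′
                              (block-a (~trans pY Yab e))

    -- A merge destroys only the smaller of the two maxima. Read downwards, each step between
    -- partitions creates exactly one block maximum, and its label is that letter up to sign.
    newmax : ∀ {f} → Max Z f → ¬ Max Y f → f ≡ a
    newmax {f} mz ¬my with f Fₚ.≟ a
    ... | yes e = e
    ... | no f≢a = ⊥-elim (¬my (maximal λ {j} e → lemma (merged e)))
      where
      lemma : ∀ {j} → (Z ∋ f ~ j) ⊎ ((Z ∋ f ~ a) × (Z ∋ j ~ b)) ⊎ ((Z ∋ f ~ b) × (Z ∋ j ~ a)) →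
              toℕ j ≤ toℕ f
      lemma (inj₁ z) = above mz z
      lemma (inj₂ (inj₁ (p , _))) = ⊥-elim (f≢a (max-unique pZ mz max-a p))
      lemma (inj₂ (inj₂ (p , q))) =
        ≤-trans (above max-a (~sym pZ q))
          (≤-trans (<⇒≤ a<b) (≤-reflexive (cong toℕ (sym (max-unique pZ mz max-b p)))))

  entry-merge : ∀ (Z : Mat n) a b i j → entry (merge Z a b) i j ≡
                entry Z i j ∨ (entry Z i a ∧ entry Z j b) ∨ (entry Z i b ∧ entry Z j a)
  entry-merge Z a b i j = trans (cong (λ v → lookup v j) (Vₚ.lookup∘tabulate _ i))
                                (Vₚ.lookup∘tabulate _ j)

  merge-merged : (Z : Mat n) (a b : Fin n) → Merged (merge Z a b) Z a b
  merge-merged Z a b {u} {v} (rel e) with ∨-true {entry Z u v} (trans (sym (entry-merge Z a b u v)) e)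
  ... | inj₁ z = inj₁ (rel z)
  ... | inj₂ h with ∨-true {entry Z u a ∧ entry Z v b} h
  ...   | inj₁ g = let p , q = ∧-true g in inj₂ (inj₁ (rel p , rel q))
  ...   | inj₂ g = let p , q = ∧-true g in inj₂ (inj₂ (rel p , rel q))

  merge⁺ : (Z : Mat n) {a b u v : Fin n} → (Z ∋ u ~ v) ⊎ ((Z ∋ u ~ a) × (Z ∋ v ~ b)) ⊎ ((Z ∋ u ~ b) × (Z ∋ v ~ a)) →
           merge Z a b ∋ u ~ v
  merge⁺ Z {a} {b} {u} {v} h = rel (trans (entry-merge Z a b u v) (val h))
    where
    val : (Z ∋ u ~ v) ⊎ ((Z ∋ u ~ a) × (Z ∋ v ~ b)) ⊎ ((Z ∋ u ~ b) × (Z ∋ v ~ a)) →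
          entry Z u v ∨ (entry Z u a ∧ entry Z v b) ∨ (entry Z u b ∧ entry Z v a) ≡ true
    val (inj₁ (rel z)) rewrite z = refl
    val (inj₂ (inj₁ (rel p , rel q))) rewrite p | q = 𝔹ₚ.∨-zeroʳ _
    val (inj₂ (inj₂ (rel p , rel q))) rewrite p | q =
      trans (cong (entry Z u v ∨_) (𝔹ₚ.∨-zeroʳ _)) (𝔹ₚ.∨-zeroʳ _)

  lab⇒merge : ∀ {Y Z ℓ} → Covers (prt Y) (prt Z) → Lab (prt Y) (prt Z) ℓ → Merge Y Z ℓ
  lab⇒merge {Y} {Z} {ℓ} cv (a , b , ma , mb , a<b , refl , sg) = record
    { a = a ; b = b ; pY = validPart Y (Covers.validʸ cv) ; pZ = pZ
    ; max-a = isMax⇒Max ma ; max-b = mb' ; a<b = a<b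
    ; sub = ≼⇒⊑ Z Y (proj₁ (Covers.lt cv))
    ; Yab = merge⁺ Z (inj₂ (inj₁ (~refl pZ , ~refl pZ)))
    ; merged = merge-merged Z a b ; sign = sgn sg }
    where
    pZ = validPart Z (Covers.validᶻ cv)
    mb' = isMax⇒Max mb
    find : ¬ (∀ j → Rel Z b j → toℕ a < toℕ j) → ∃ λ j → (Z ∋ b ~ j) × (toℕ j < toℕ a)
    find h with Fₚ.any? (λ j → (Z ∋ b ~? j) ×-dec (toℕ j ℕ.<? toℕ a))
    ... | yes w = w
    ... | no ¬w = ⊥-elim (h λ j e → ≤∧≢⇒< (≮⇒≥ λ lt → ¬w (j , rel e , lt)) λ eq →
                    <⇒≱ a<b (above (isMax⇒Max ma)
                      (subst (λ v → Z ∋ v ~ b) (sym (Fₚ.toℕ-injective eq)) (~sym pZ (rel e)))))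
    sgn : ((∀ j → Rel Z b j → toℕ a < toℕ j) × ℓ ≡ -[1+ toℕ a ])
          ⊎ (¬ (∀ j → Rel Z b j → toℕ a < toℕ j) × ℓ ≡ + suc (toℕ a)) → Sign Z a b ℓ
    sgn (inj₁ (h , e)) = inj₁ ((λ { (rel r) → h _ r }) , e)
    sgn (inj₂ (h , e)) = inj₂ (find h , e)

-- Splitting blocks; negative labels in increasing chains.

module EL (n d k : ℕ) (1<d : 1 < d) (n≡ : n ≡ k * d) where

  open Poset n d k 1<d n≡

  opaque
    splitBy : Mat n → Sub n → Mat n
    splitBy Y P = mat λ i j → (Y ∋ i ~? j) ×-dec (P i 𝔹.≟ P j)

  opaque
    unfolding splitBy

    split⁺ : ∀ {Y P i j} → Y ∋ i ~ j → P i ≡ P j → splitBy Y P ∋ i ~ j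
    split⁺ {Y} {P} e q = mat⁺ (λ i j → (Y ∋ i ~? j) ×-dec (P i 𝔹.≟ P j)) (e , q)

    split⁻ : ∀ {Y P i j} → splitBy Y P ∋ i ~ j → (Y ∋ i ~ j) × P i ≡ P j
    split⁻ {Y} {P} = mat⁻ (λ i j → (Y ∋ i ~? j) ×-dec (P i 𝔹.≟ P j))

  split-⊑ : ∀ {Y P} → splitBy Y P ⊑ᵐ Y
  split-⊑ e = proj₁ (split⁻ e)

  split-part : ∀ {Y P} → Part Y → Part (splitBy Y P)
  split-part p = record
    { ~refl = split⁺ (~refl p) refl
    ; ~sym = λ e → let r , q = split⁻ e in split⁺ (~sym p r) (sym q)
    ; ~trans = λ e f → let r , q = split⁻ e ; s , t = split⁻ f in split⁺ (~trans p r s) (trans q t) }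

  split-cong : ∀ {Y P Q} → (∀ {i} → i ∊ P → i ∊ Q) → (∀ {i} → i ∊ Q → i ∊ P) → splitBy Y P ≡ splitBy Y Q
  split-cong {Y} {P} {Q} f g = ⊑ᵐ-antisym
    (λ e → let r , q = split⁻ e in split⁺ r (trans (sym (pq _)) (trans q (pq _))))
    (λ e → let r , q = split⁻ e in split⁺ r (trans (pq _) (trans q (sym (pq _)))))
    where
    pq : ∀ i → P i ≡ Q i
    pq i = bool-⇔ (λ e → unmem (f {i} (mem e))) (λ e → unmem (g {i} (mem e)))

  ∊-≡ : {P : Sub n} {i j : Fin n} → i ∊ P → P i ≡ P j → j ∊ P
  ∊-≡ (mem e) q = mem (trans (sym q) e)

  both-∊ : {P : Sub n} {i j : Fin n} → i ∊ P → j ∊ P → P i ≡ P j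
  both-∊ (mem e) (mem f) = trans e (sym f)

  both-∉ : {P : Sub n} {i j : Fin n} → ¬ (i ∊ P) → ¬ (j ∊ P) → P i ≡ P j
  both-∉ {P} {i} {j} h g = bool-⇔ (λ e → ⊥-elim (h (mem e))) (λ e → ⊥-elim (g (mem e)))

  module Split {Y : Mat n} (pY : Part Y) {P : Sub n} {a : Fin n}
               (P⊆ : ∀ {i} → i ∊ P → Y ∋ a ~ i) where

    split-in : ∀ {i j} → i ∊ P → j ∊ P → splitBy Y P ∋ i ~ j
    split-in p q = split⁺ (~trans pY (~sym pY (P⊆ p)) (P⊆ q)) (both-∊ p q)

    split-div : (∀ i → d ∣ cnt (row Y i)) → d ∣ cnt P → ∀ i → d ∣ cnt (row (splitBy Y P) i)
    split-div dv dP i with i ∊? P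
    ... | yes p = subst (d ∣_) (cnt-≡ {S = P} (λ q → row⁺ (split-in p q))
                                              (λ r → ∊-≡ p (proj₂ (split⁻ (row⁻ r))))) dP
    ... | no ¬p with Y ∋ a ~? i
    ...   | yes ai = subst (d ∣_) (cnt-≡ {S = row Y i ∖ P} f g)
              (∣m+n∣m⇒∣n (subst (d ∣_) (cnt-∖ (row Y i) P λ q → row⁺ (~trans pY (~sym pY ai) (P⊆ q))) (dv i)) dP)
      where
      f : ∀ {j} → j ∊ (row Y i ∖ P) → j ∊ row (splitBy Y P) i
      f r = row⁺ (split⁺ (row⁻ (proj₁ (∖⁻ r))) (both-∉ ¬p (proj₂ (∖⁻ r))))
      g : ∀ {j} → j ∊ row (splitBy Y P) i → j ∊ (row Y i ∖ P)
      g r = let e , q = split⁻ (row⁻ r) in ∖⁺ (row⁺ e) λ m → ¬p (∊-≡ m (sym q))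
    ...   | no ¬ai = subst (d ∣_) (cnt-≡ {S = row Y i} f g) (dv i)
      where
      f : ∀ {j} → j ∊ row Y i → j ∊ row (splitBy Y P) i
      f r = row⁺ (split⁺ (row⁻ r) (both-∉ ¬p λ m → ¬ai (~trans pY (P⊆ m) (~sym pY (row⁻ r)))))
      g : ∀ {j} → j ∊ row (splitBy Y P) i → j ∊ row Y i
      g r = row⁺ (split-⊑ (row⁻ r))

    module _ (a∊ : a ∊ P) (≤a : ∀ {i} → i ∊ P → toℕ i ≤ toℕ a) (b∉ : ¬ (mx Y a ∊ P)) where

      split-merged : Merged Y (splitBy Y P) a (mx Y a)
      split-merged {u} {v} e with u ∊? P | v ∊? P
      ... | yes p | yes q = inj₁ (split-in p q)
      ... | no p  | no q  = inj₁ (split⁺ e (both-∉ p q))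
      ... | yes p | no q  = inj₂ (inj₁ (split-in p a∊ ,
                split⁺ (~trans pY (~sym pY e) (~trans pY (~sym pY (P⊆ p)) (~mx pY a))) (both-∉ q b∉)))
      ... | no p  | yes q = inj₂ (inj₂ (
                split⁺ (~trans pY e (~trans pY (~sym pY (P⊆ q)) (~mx pY a))) (both-∉ p b∉) , split-in q a∊))

      split-max-a : Max (splitBy Y P) a
      split-max-a = maximal λ e → ≤a (∊-≡ a∊ (proj₂ (split⁻ e)))

      split-cover : Valid (prt Y) → d ∣ cnt P → Covers (prt Y) (prt (splitBy Y P))
      split-cover vY dP = merged⇒cover vY
        (mkValid (split-part pY) (split-div (validDiv Y vY) dP))
        split-⊑ (~mx pY a) (λ e → b∉ (∊-≡ a∊ (proj₂ (split⁻ e)))) split-merged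

      split-lab : ∀ {ℓ} → ((∀ j → Rel (splitBy Y P) (mx Y a) j → toℕ a < toℕ j) × ℓ ≡ -[1+ toℕ a ]) ⊎
                          (¬ (∀ j → Rel (splitBy Y P) (mx Y a) j → toℕ a < toℕ j) × ℓ ≡ + suc (toℕ a)) →
                  Lab (prt Y) (prt (splitBy Y P)) ℓ
      split-lab sg = a , mx Y a , Max⇒isMax split-max-a
        , Max⇒isMax (max-anti split-⊑ (mx-max pY a))
        , ≤∧≢⇒< (≤mx pY (~refl pY)) (λ e → b∉ (subst (_∊ P) (Fₚ.toℕ-injective e) a∊))
        , ⊑ᵐ-antisym (λ e → merge⁺ _ (split-merged e)) (λ e → back (merge-merged _ _ _ e))
        , sg
        where
        back : ∀ {u v} → (splitBy Y P ∋ u ~ v) ⊎ ((splitBy Y P ∋ u ~ a) × (splitBy Y P ∋ v ~ mx Y a))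
                         ⊎ ((splitBy Y P ∋ u ~ mx Y a) × (splitBy Y P ∋ v ~ a)) → Y ∋ u ~ v
        back (inj₁ z) = split-⊑ z
        back (inj₂ (inj₁ (p , q))) = ~trans pY (split-⊑ p) (~trans pY (~mx pY a) (~sym pY (split-⊑ q)))
        back (inj₂ (inj₂ (p , q))) = ~trans pY (split-⊑ p) (~trans pY (~sym pY (~mx pY a)) (~sym pY (split-⊑ q)))

  -- Adm y S: S may be split off from a block of a partition above y, staying above y.
  Adm : Pt n → Sub n → Set
  Adm bot S = d ∣ cnt S
  Adm (prt R) S = ∀ i j → i ∊ S → R ∋ i ~ j → j ∊ S

  Adm? : ∀ y S → Dec (Adm y S)
  Adm? bot S = d ∣? cnt S
  Adm? (prt R) S = Fₚ.all? λ i → Fₚ.all? λ j → (i ∊? S) →-dec ((R ∋ i ~? j) →-dec (j ∊? S))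

  adm-≐ : ∀ y {S T} → (∀ {i} → i ∊ S → i ∊ T) → (∀ {i} → i ∊ T → i ∊ S) → Adm y S → Adm y T
  adm-≐ bot f g h = subst (d ∣_) (cnt-≡ f g) h
  adm-≐ (prt R) f g h i j m e = f (h i j (g m) e)

  adm-⊎ : ∀ y (S T U : Sub n) → (∀ {i} → i ∊ S → (i ∊ T) ⊎ (i ∊ U)) →
          (∀ {i} → i ∊ T → i ∊ S) → (∀ {i} → i ∊ U → i ∊ S) →
          (∀ {i} → i ∊ T → i ∊ U → ⊥) → Adm y T → Adm y U → Adm y S
  adm-⊎ bot S T U f g h dis p q = subst (d ∣_) (sym (cnt-+ S T U f g h dis)) (∣m∣n⇒∣m+n p q)
  adm-⊎ (prt R) S T U f g h dis p q i j m e = [ (λ t → g (p i j t e)) , (λ u → h (q i j u e)) ]′ (f m)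

  adm-row : ∀ y (R : Mat n) → Valid (prt R) → y ≼ prt R → ∀ i → Adm y (row R i)
  adm-row bot R vR _ i = validDiv R vR i
  adm-row (prt Y) R vR le i u v m e = row⁺ (~trans (validPart R vR) (row⁻ m) (≼⇒⊑ Y R le e))

  adm-div : ∀ y {S} → Valid y → Adm y S → d ∣ cnt S
  adm-div bot _ h = h
  adm-div (prt R) {S} vR h = closed-div d (validPart R vR) (validDiv R vR) S λ {i} {j} → h i j

  split-≽ : ∀ y (x : Mat n) {P} → Valid y → y ≼ prt x → Adm y P → y ≼ prt (splitBy x P)
  split-≽ bot x _ _ _ = tt
  split-≽ (prt Y) x {P} vY le h = ⊑⇒≼ λ {i} {j} e → split⁺ (≼⇒⊑ Y x le e)
    (bool-⇔ (λ p → unmem (h i j (mem p) e)) (λ p → unmem (h j i (mem p) (~sym (validPart Y vY) e))))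

  opaque
    Pre : Mat n → Fin n → Sub n
    Pre x a = ⟦ (λ i → (x ∋ a ~? i) ×-dec (toℕ i ℕ.≤? toℕ a)) ⟧

  opaque
    unfolding Pre

    pre⁺ : ∀ {x a i} → x ∋ a ~ i → toℕ i ≤ toℕ a → i ∊ Pre x a
    pre⁺ {x} {a} e le = ⟦⟧⁺ (λ i → (x ∋ a ~? i) ×-dec (toℕ i ℕ.≤? toℕ a)) (e , le)

    pre⁻ : ∀ {x a i} → i ∊ Pre x a → (x ∋ a ~ i) × toℕ i ≤ toℕ a
    pre⁻ {x} {a} = ⟦⟧⁻ (λ i → (x ∋ a ~? i) ×-dec (toℕ i ℕ.≤? toℕ a))

  -- These are the letters whose negative labels a cover of x inside the interval down to y: such a
  -- cover splits off the letters up to `a` from the block of `a`, and the prefix is proper because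
  -- `a` is not the block maximum.
  Neg : Mat n → Pt n → Fin n → Set
  Neg x y a = ¬ Max x a × Adm y (Pre x a)

  Neg? : ∀ x y a → Dec (Neg x y a)
  Neg? x y a = ¬? (Max? x a) ×-dec Adm? y (Pre x a)

  module _ {Y Z : Mat n} {ℓ : ℤ} (M : Merge Y Z ℓ) where
    open Merge M

    -- A negative label puts the whole part of `b` above `a`, so the part of `a` is a prefix of the
    -- merged block.
    merge-neg : (∀ {j} → Z ∋ b ~ j → toℕ a < toℕ j) →
                (∀ {i} → i ∊ row Z a → i ∊ Pre Y a) × (∀ {i} → i ∊ Pre Y a → i ∊ row Z a)
    merge-neg ng = (λ m → pre⁺ (sub (row⁻ m)) (above max-a (row⁻ m))) , back
      where
      back : ∀ {i} → i ∊ Pre Y a → i ∊ row Z a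
      back m with block-a (proj₁ (pre⁻ m))
      ... | inj₁ z = row⁺ z
      ... | inj₂ z = contradiction (ng z) (≤⇒≯ (proj₂ (pre⁻ m)))

    -- A cover is determined by Y and the part with the smaller maximum, so equality of covers
    -- reduces to equality of these parts.
    merge-split : Z ≡ splitBy Y (row Z a)
    merge-split = ⊑ᵐ-antisym
      (λ {i} {j} e → split⁺ (sub e) (bool-⇔ (λ r → unmem (row⁺ (~trans pZ (row⁻ {i = a} {j = i} (mem r)) e)))
                                     (λ r → unmem (row⁺ (~trans pZ (row⁻ {i = a} {j = j} (mem r)) (~sym pZ e))))))
      λ e → let r , q = split⁻ e in lemma r q
      where
      lemma : ∀ {u v} → Y ∋ u ~ v → row Z a u ≡ row Z a v → Z ∋ u ~ v
      lemma {u} {v} e q with Z ∋ u ~? v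
      ... | yes z = z
      ... | no ¬z with separated e ¬z
      ...   | inj₁ (au , bv) = ⊥-elim (¬Zab (~trans pZ (row⁻ (∊-≡ (row⁺ au) q)) (~sym pZ bv)))
      ...   | inj₂ (bu , av) = ⊥-elim (¬Zab (~trans pZ (row⁻ (∊-≡ (row⁺ av) (sym q))) (~sym pZ bu)))

  lastZero : ∀ {x c ls} → MC (prt x) bot c → Labels c ls → (+ 0) ∈ ls
  lastZero (step {y = bot} cv m) lb with mc-refl m
  lastZero (step {y = bot} cv m) (cons refl _) | refl = here refl
  lastZero (step {y = prt w} cv m) lb with mc-head m
  lastZero (step {y = prt w} cv m) (cons _ lb) | _ , refl = there (lastZero m lb)

  inc-head : ∀ {ℓ ls} → WeakInc (ℓ ∷ ls) → ∀ {ℓ'} → ℓ' ∈ (ℓ ∷ ls) → ℓ ℤ.≤ ℓ'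
  inc-head _ (here refl) = ℤₚ.≤-refl
  inc-head h (there i) = linked-all ℤₚ.≤-trans h i

  MaxPt : Fin n → Pt n → Set
  MaxPt a bot = ⊤
  MaxPt a (prt R) = Max R a

  MaxPt? : ∀ a w → Dec (MaxPt a w)
  MaxPt? a bot = yes tt
  MaxPt? a (prt R) = Max? R a

  labels-head : ∀ {x c' ls z} {y : Pt n} → MC z y c' → Labels (x ∷ c') ls →
                ∃ λ ℓ → ∃ λ ls' → ls ≡ ℓ ∷ ls' × Lab x z ℓ × Labels c' ls'
  labels-head m lb with mc-head m
  labels-head m (cons l lb) | _ , refl = _ , _ , refl , l , lb

  maxAppears : ∀ {x Y c ls} → MC (prt x) (prt Y) c → Labels c ls → ∀ {a} → Max Y a → ¬ Max x a →
               ∃ λ ℓ → ℓ ∈ ls × ((ℓ ≡ -[1+ toℕ a ]) ⊎ (ℓ ≡ + suc (toℕ a)))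
  maxAppears {x} {Y} m lb {a} my ¬mx with crossing (MaxPt? a) m lb ¬mx my
  ... | bot , Z , ℓ , s , ¬q , q = ⊥-elim (¬q tt)
  ... | prt Y' , bot , ℓ , s , ¬q , q = ⊥-elim (mc-≼ʳ m (proj₂ (step-∈ s)))
  ... | prt Y' , prt Z' , ℓ , s , ¬q , q = ℓ , step-label∈ s , sg (Merge.sign mg)
    where
    mg = lab⇒merge (step-cover m s) (step-lab lb s)
    e = Merge.newmax mg q ¬q
    sg : Sign Z' (Merge.a mg) (Merge.b mg) ℓ → (ℓ ≡ -[1+ toℕ a ]) ⊎ (ℓ ≡ + suc (toℕ a))
    sg (inj₁ (_ , f)) = inj₁ (trans f (cong (λ v → -[1+ toℕ v ]) (sym e)))
    sg (inj₂ (_ , f)) = inj₂ (trans f (cong (λ v → + suc (toℕ v)) (sym e)))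

  +≰0 : ∀ {m} → ¬ ((+ suc m) ℤ.≤ (+ 0))
  +≰0 (ℤ.+≤+ ())

  +≰- : ∀ {m o} → ¬ ((+ m) ℤ.≤ -[1+ o ])
  +≰- ()

  -- An increasing chain cannot create `a` with a positive label while the negative one is
  -- available. If y is `bot`, the final label 0 is smaller. Otherwise the witness `j` lies in the
  -- prefix of `a`, and so does its maximum `t` in the partition y; `t` is less than `a` and not yet
  -- a maximum, so a later step is labelled by `t` up to sign, which is too small.
  posContra : ∀ {x W ℓ c ls} (y : Pt n) → Valid y → (mg : Merge x W ℓ) → MC (prt W) y c → Labels c ls →
              (∃ λ j → (W ∋ Merge.b mg ~ j) × (toℕ j < toℕ (Merge.a mg))) →
              ℓ ≡ + suc (toℕ (Merge.a mg)) → WeakInc (ℓ ∷ ls) → Neg x y (Merge.a mg) → ⊥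
  posContra bot vy mg m lb _ ℓ≡ inc _ = +≰0 (subst (ℤ._≤ + 0) ℓ≡ (inc-head inc (there (lastZero m lb))))
  posContra {x} {W} (prt Y) vY mg m lb (j , bj , j<a) ℓ≡ inc (¬mx , ad) =
    bad (maxAppears m lb mY λ mW → <⇒≱ (<-trans m<a a<b) (above mW (~sym pZ bm)))
    where
    open Merge mg
    pY' = validPart Y vY
    t = mx Y j
    Y⊑W = ≼⇒⊑ Y W (mc-≼ m)
    bm : W ∋ b ~ t
    bm = ~trans pZ bj (Y⊑W (~mx pY' j))
    t∊ : t ∊ Pre x a
    t∊ = ad j t (pre⁺ (~trans pY Yab (sub bj)) (<⇒≤ j<a)) (~mx pY' j)
    m<a : toℕ t < toℕ a
    m<a = ≤∧≢⇒< (proj₂ (pre⁻ t∊)) λ e → ¬Zab (~sym pZ (subst (λ v → W ∋ b ~ v) (Fₚ.toℕ-injective e) bm))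
    mY : Max Y t
    mY = mx-max pY' j
    bad : ¬ (∃ λ ℓ → ℓ ∈ _ × ((ℓ ≡ -[1+ toℕ t ]) ⊎ (ℓ ≡ + suc (toℕ t))))
    bad (_ , i , inj₁ refl) = +≰- (subst (ℤ._≤ -[1+ toℕ t ]) ℓ≡ (inc-head inc (there i)))
    bad (_ , i , inj₂ refl) = <⇒≱ m<a (ℕ.s≤s⁻¹ (ℤₚ.drop‿+≤+ (subst (ℤ._≤ + suc (toℕ t)) ℓ≡ (inc-head inc (there i)))))

  -- For a partition y the new prefix of `a` is the old one cut down to a block of W, hence still
  -- closed under y. For `bot` only divisibility is known; there the step is assumed negative, so
  -- the prefix of `a` is unchanged or loses exactly one block of W.
  negPersist : ∀ {x W ℓ} (y : Pt n) → Valid (prt x) → Valid (prt W) → y ≼ prt W → (mg : Merge x W ℓ) →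
               (y ≡ bot → ∀ {j} → W ∋ Merge.b mg ~ j → toℕ (Merge.a mg) < toℕ j) →
               ∀ {a} → a ≢ Merge.a mg → Neg x y a → Neg W y a
  negPersist {x} {W} y vx vW le mg bt {a} a≢ (¬mx , ad) =
    (λ mW → a≢ (newmax mW ¬mx)) , adm y bt le ad
    where
    open Merge mg using (pY; pZ; sub; newmax; ¬Zab) renaming (a to a'; b to b'; Yab to xab; block-a to blk)
    adm : ∀ y → (y ≡ bot → ∀ {j} → W ∋ b' ~ j → toℕ a' < toℕ j) → y ≼ prt W → Adm y (Pre x a) → Adm y (Pre W a)
    adm (prt Y) _ le h i j m e = let p , q = pre⁻ m ; r = h i j (pre⁺ (sub p) q) e in
      pre⁺ (~trans pZ p (≼⇒⊑ Y W le e)) (proj₂ (pre⁻ r))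
    adm bot bt _ h with x ∋ a' ~? a
    ... | no ¬aa = adm-≐ bot {Pre x a} {Pre W a} f g h
      where
      f : ∀ {i} → i ∊ Pre x a → i ∊ Pre W a
      f {i} m with W ∋ a ~? i
      ... | yes w = pre⁺ w (proj₂ (pre⁻ m))
      ... | no ¬w with Merge.separated mg (proj₁ (pre⁻ m)) ¬w
      ...   | inj₁ (p , _) = ⊥-elim (¬aa (sub p))
      ...   | inj₂ (p , _) = ⊥-elim (¬aa (~trans pY xab (sub p)))
      g : ∀ {i} → i ∊ Pre W a → i ∊ Pre x a
      g m = let p , q = pre⁻ m in pre⁺ (sub p) q
    ... | yes aa with blk aa
    ...   | inj₁ wa = adm-≐ bot {Pre x a} {Pre W a} f g h
      where
      f : ∀ {i} → i ∊ Pre x a → i ∊ Pre W a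
      f m with blk (~trans pY aa (proj₁ (pre⁻ m)))
      ... | inj₁ w = pre⁺ (~trans pZ (~sym pZ wa) w) (proj₂ (pre⁻ m))
      ... | inj₂ w = contradiction (bt refl w) (≤⇒≯ (≤-trans (proj₂ (pre⁻ m)) (above (Merge.max-a mg) wa)))
      g : ∀ {i} → i ∊ Pre W a → i ∊ Pre x a
      g m = let p , q = pre⁻ m in pre⁺ (sub p) q
    ...   | inj₂ wb = ∣m+n∣m⇒∣n (subst (d ∣_) (cnt-+ (Pre x a) (row W a') (Pre W a) f g₁ g₂ dis) h) (validDiv W vW a')
      where
      f : ∀ {i} → i ∊ Pre x a → (i ∊ row W a') ⊎ (i ∊ Pre W a)
      f m with blk (~trans pY aa (proj₁ (pre⁻ m)))
      ... | inj₁ w = inj₁ (row⁺ w)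
      ... | inj₂ w = inj₂ (pre⁺ (~trans pZ (~sym pZ wb) w) (proj₂ (pre⁻ m)))
      g₁ : ∀ {i} → i ∊ row W a' → i ∊ Pre x a
      g₁ r = pre⁺ (~trans pY (~sym pY aa) (sub (row⁻ r)))
                  (≤-trans (above (Merge.max-a mg) (row⁻ r)) (<⇒≤ (bt refl wb)))
      g₂ : ∀ {i} → i ∊ Pre W a → i ∊ Pre x a
      g₂ m = let p , q = pre⁻ m in pre⁺ (sub p) q
      dis : ∀ {i} → i ∊ row W a' → i ∊ Pre W a → ⊥
      dis r m = ¬Zab (~trans pZ (row⁻ r) (~trans pZ (~sym pZ (proj₁ (pre⁻ m))) (~sym pZ wb)))

  -- An available negative label stays available until its letter is created, by `negPersist`, and
  -- the letter is not created with the positive label, by `posContra`. At the end of the chain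
  -- nothing is available.
  negAppears : ∀ {x c ls} (y : Pt n) → Valid y → MC (prt x) y c → Labels c ls → WeakInc ls →
               ∀ {a} → Neg x y a → -[1+ toℕ a ] ∈ ls
  negAppears {x} _ vy (single vx) lb inc (¬mx , ad) =
    let px = validPart x vx in
    ⊥-elim (¬mx (maximal λ {j} e → proj₂ (pre⁻ (ad _ j (pre⁺ (~refl px) ≤-refl) e))))
  negAppears y vy (step cv m) lb inc ng with labels-head m lb
  negAppears {x} .bot vy (step {y = bot} cv (single _)) lb inc {a} (¬mx , ad) | ℓ , ls' , refl , l , lb' =
    -- Splitting off the prefix gives a partition strictly between x and `bot`.
    ⊥-elim (Covers.none cv (prt (splitBy x (Pre x a))) (Covers.validᶻ cv') (tt , λ ()) (Covers.lt cv'))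
    where
    vx = Covers.validʸ cv
    px = validPart x vx
    b∉ : ¬ (mx x a ∊ Pre x a)
    b∉ m = ¬mx (maximal λ e → ≤-trans (≤mx px e) (proj₂ (pre⁻ m)))
    cv' = Split.split-cover px (λ m → proj₁ (pre⁻ m)) (pre⁺ (~refl px) ≤-refl) (λ m → proj₂ (pre⁻ m)) b∉ vx ad
  negAppears {x} .(_) vy (step {y = bot} cv (step cv' _)) lb inc ng | ℓ , ls' , refl , l , lb' =
    ⊥-elim (lemma _ (Covers.lt cv'))
    where
    lemma : ∀ w → ¬ (w ≺ bot)
    lemma bot (_ , e) = e refl
    lemma (prt _) (() , _)
  negAppears {x} y vy (step {y = prt W} cv m) lb inc {a} ng | ℓ , ls' , refl , l , lb' =
    go (a Fₚ.≟ Merge.a mg) (Merge.sign mg)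
    where
    mg = lab⇒merge cv l
    go : Dec (a ≡ Merge.a mg) → Sign W (Merge.a mg) (Merge.b mg) ℓ → -[1+ toℕ a ] ∈ (ℓ ∷ ls')
    go (yes refl) (inj₁ (_ , e)) = here (sym e)
    go (yes refl) (inj₂ (w , e)) = ⊥-elim (posContra y vy mg m lb' w e inc ng)
    go (no a≢) (inj₁ (h , e)) =
      there (negAppears y vy m lb' (linked-tail inc)
        (negPersist y (Covers.validʸ cv) (Covers.validᶻ cv) (mc-≼ m) mg (λ _ → h) a≢ ng))
    go (no a≢) (inj₂ (w , e)) =
      there (negAppears y vy m lb' (linked-tail inc)
        (negPersist y (Covers.validʸ cv) (Covers.validᶻ cv) (mc-≼ m) mg
          -- In an increasing chain down to `bot` a positive label cannot precede the final 0, so y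
          -- is not `bot` here.
          (λ { refl → ⊥-elim (+≰0 (subst (ℤ._≤ + 0) e (inc-head inc (there (lastZero m lb'))))) }) a≢ ng))

-- The labeling is an EL-labeling: the greedy chain.

module ELProof (n d k : ℕ) (1<d : 1 < d) (n≡ : n ≡ k * d) where

  open Poset n d k 1<d n≡
  open EL n d k 1<d n≡

  -- Best x y ℓ: ℓ is the least label of a cover relation x ⋗ z with z ≽ y.
  data Best (x : Mat n) : Pt n → ℤ → Set where
    negᵇ  : ∀ {y} a → Neg x y a → (∀ a' → Neg x y a' → toℕ a' ≤ toℕ a) → Best x y -[1+ toℕ a ]
    zeroᵇ : (∀ a → ¬ Neg x bot a) → Best x bot (+ 0)
    posᵇ  : ∀ {Y} a → (∀ a' → ¬ Neg x (prt Y) a') → Max Y a → ¬ Max x a →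
            (∀ a' → Max Y a' → ¬ Max x a' → toℕ a ≤ toℕ a') → Best x (prt Y) (+ suc (toℕ a))

  target : ∀ {x y ℓ} → Best x y ℓ → Pt n
  target {x} (negᵇ a _ _) = prt (splitBy x (Pre x a))
  target (zeroᵇ _) = bot
  target {x} (posᵇ {Y} a _ _ _ _) = prt (splitBy x (row Y a))

  best? : ∀ {x} y → Valid (prt x) → Valid y → y ≼ prt x → (y ≡ prt x) ⊎ (∃ λ ℓ → Best x y ℓ)
  best? {x} y vx vy le with Fₚ.any? (Neg? x y)
  best? {x} y vx vy le | yes w = let a , p , h = largest (Neg? x y) w in inj₂ (_ , negᵇ a p h)
  best? {x} bot vx vy le | no ¬w = inj₂ (_ , zeroᵇ λ a p → ¬w (a , p))
  best? {x} (prt Y) vx vY le | no ¬w with Fₚ.any? (λ a → Max? Y a ×-dec ¬? (Max? x a))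
  ... | yes v = let a , (p , q) , h = smallest (λ a → Max? Y a ×-dec ¬? (Max? x a)) v in
                inj₂ (_ , posᵇ a (λ a' r → ¬w (a' , r)) p q (λ a' r s → h a' (r , s)))
  -- Y refines x without any further block maximum; then `mx` is the same function for both, and it
  -- determines the blocks.
  ... | no ¬v = inj₁ (prt-antisym Y⊑x x⊑Y)
    where
    px = validPart x vx
    pY = validPart Y vY
    Y⊑x = ≼⇒⊑ Y x le
    same : ∀ u → mx x u ≡ mx Y u
    same u with Max? x (mx Y u)
    ... | yes m = max⇒mx px m (Y⊑x (~mx pY u))
    ... | no ¬m = ⊥-elim (¬v (mx Y u , mx-max pY u , ¬m))
    x⊑Y : x ⊑ᵐ Y
    x⊑Y {u} {v} e = mx-inj pY (trans (sym (same u)) (trans (mx-cong px e) (same v)))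

  -- Take the least `a` in the block whose prefix has at least d letters. Were there more than d,
  -- the preceding letter `p` of the block would serve as well. Being smaller than the block, the
  -- prefix does not end at the block maximum.
  big-prefix : ∀ {x} → Part x → ∀ u → d < cnt (row x u) → ∃ λ a → ¬ Max x a × cnt (Pre x a) ≡ d
  big-prefix {x} px u big =
    let a , (ua , le) , least = smallest (λ a → (x ∋ u ~? a) ×-dec (d ℕ.≤? cnt (Pre x a)))
                                  (mx x u , ~mx px u , ≤-trans (<⇒≤ big) (cnt-mono λ r →
                                     pre⁺ (~trans px (~sym px (~mx px u)) (row⁻ r)) (≤mx px (row⁻ r))))
        cnt≡d : cnt (Pre x a) ≡ d
        cnt≡d = ≤-antisym (≮⇒≥ λ gt → too-big a ua gt least) le
    in a , (λ m → <-irrefl (sym cnt≡d) (<-≤-trans big (cnt-mono λ r →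
              pre⁺ (~trans px (~sym px ua) (row⁻ r)) (above m (~trans px (~sym px ua) (row⁻ r)))))) , cnt≡d
    where
    too-big : ∀ a → x ∋ u ~ a → d < cnt (Pre x a) →
              (∀ a' → (x ∋ u ~ a') × d ≤ cnt (Pre x a') → toℕ a ≤ toℕ a') → ⊥
    too-big a ua gt least = <⇒≱ p<a (least p (~trans px ua (proj₁ p-in) ,
                              ℕ.s≤s⁻¹ (≤-trans gt (≤-reflexive cnt-eq))))
      where
      S = Pre x a ∖ (λ i → does (i Fₚ.≟ a))
      is-a : ∀ {i} → i ∊ (λ i → does (i Fₚ.≟ a)) → i ≡ a
      is-a {i} (mem e) = does⇒ (i Fₚ.≟ a) e
      a-is : ∀ {i} → i ≡ a → i ∊ (λ i → does (i Fₚ.≟ a))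
      a-is {i} e = mem (dec-true (i Fₚ.≟ a) e)
      cS : cnt (Pre x a) ≡ 1 + cnt S
      cS = trans (cnt-∖ (Pre x a) _ λ i → subst (_∊ Pre x a) (sym (is-a i)) (pre⁺ (~refl px) ≤-refl))
                 (cong (_+ cnt S) (cnt-single a))
      0<S : ∃ (_∊ S)
      0<S with Fₚ.any? (_∊? S)
      ... | yes w = w
      ... | no ¬w = contradiction (subst (d <_) (trans cS (cong suc (cnt-none S λ i → 𝔹ₚ.¬-not λ e → ¬w (i , mem e)))) gt)
                                  (≤⇒≯ 0<d)
      lg = largest (_∊? S) 0<S
      p = proj₁ lg
      p-in : (x ∋ a ~ p) × toℕ p ≤ toℕ a
      p-in = pre⁻ (proj₁ (∖⁻ (proj₁ (proj₂ lg))))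
      p<a : toℕ p < toℕ a
      p<a = ≤∧≢⇒< (proj₂ p-in) λ e → proj₂ (∖⁻ (proj₁ (proj₂ lg))) (a-is (Fₚ.toℕ-injective e))
      cnt-eq : cnt (Pre x a) ≡ suc (cnt (Pre x p))
      cnt-eq = trans cS (cong suc (cnt-≡ {S = S} {T = Pre x p}
        (λ s → let e , _ = pre⁻ (proj₁ (∖⁻ s)) in pre⁺ (~trans px (~sym px (proj₁ p-in)) e) (proj₂ (proj₂ lg) _ s))
        (λ m → let e , l = pre⁻ m in ∖⁺ (pre⁺ (~trans px (proj₁ p-in) e) (≤-trans l (<⇒≤ p<a)))
                  λ q → <⇒≱ p<a (subst (λ v → toℕ v ≤ toℕ p) (is-a q) l))))

  no-neg⇒atom : ∀ {x} → Part x → (∀ a → ¬ Neg x bot a) → ∀ u → cnt (row x u) ≤ d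
  no-neg⇒atom px h u = ≮⇒≥ λ big → let a , ¬m , e = big-prefix px u big in
    h a (¬m , subst (d ∣_) (sym e) ∣-refl)

  module _ {x : Mat n} (vx : Valid (prt x)) where

    private px = validPart x vx

    mx∉Pre : ∀ {a} → ¬ Max x a → ¬ (mx x a ∊ Pre x a)
    mx∉Pre ¬mx m = ¬mx (maximal λ e → ≤-trans (≤mx px e) (proj₂ (pre⁻ m)))

    best-cover : ∀ {y ℓ} → Valid y → y ≼ prt x → (β : Best x y ℓ) →
                 Covers (prt x) (target β) × Lab (prt x) (target β) ℓ × y ≼ target β
    best-cover {y} vy le (negᵇ a (¬mx , ad) _) =
      split-cover a∊ (λ m → proj₂ (pre⁻ m)) b∉ vx (adm-div y vy ad) ,
      split-lab a∊ (λ m → proj₂ (pre⁻ m)) b∉ (inj₁ ((λ j e → ≰⇒> λ j≤ → b∉ (∊-≡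
        (pre⁺ (~trans px (~mx px a) (split-⊑ (rel e))) j≤) (sym (proj₂ (split⁻ (rel e)))))) , refl)) ,
      split-≽ y x vy le ad
      where
      a∊ = pre⁺ (~refl px) ≤-refl
      b∉ = mx∉Pre ¬mx
      open Split px {Pre x a} {a} (λ m → proj₁ (pre⁻ m))
    best-cover vy le (zeroᵇ h) = atom⇒cover vx (no-neg⇒atom px h) , refl , tt
    best-cover {prt Y} vY le (posᵇ a h mY ¬mx _) =
      split-cover a∊ (λ m → above mY (row⁻ m)) b∉ vx (validDiv Y vY a) ,
      split-lab a∊ (λ m → above mY (row⁻ m)) b∉ (inj₂ (sg , refl)) ,
      split-≽ (prt Y) x vY le (λ i j m e → row⁺ (~trans pY (row⁻ m) e))
      where
      pY = validPart Y vY
      Y⊑x = ≼⇒⊑ Y x le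
      a∊ = row⁺ (~refl pY)
      b∉ : ¬ (mx x a ∊ row Y a)
      b∉ m = ¬mx (maximal λ e → ≤-trans (≤mx px e) (above mY (row⁻ m)))
      open Split px {row Y a} {a} (λ m → Y⊑x (row⁻ m))
      sg : ¬ (∀ j → Rel (splitBy x (row Y a)) (mx x a) j → toℕ a < toℕ j)
      -- If all remaining letters exceeded `a`, the block of `a` in Y would be the prefix up to `a`,
      -- and a negative label would be available.
      sg all = h a (¬mx , λ i j m e → let p , q = pre⁻ m in
                 pre⁺ (~trans px p (Y⊑x e)) (above mY (~trans pY (in-a i p q) e)))
        where
        in-a : ∀ i → x ∋ a ~ i → toℕ i ≤ toℕ a → Y ∋ a ~ i
        in-a i p q with Y ∋ a ~? i
        ... | yes r = r
        ... | no ¬r = contradiction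
                (all i (unrel (split⁺ (~trans px (~sym px (~mx px a)) p) (both-∉ b∉ λ m → ¬r (row⁻ m))))) (≤⇒≯ q)

    neg-from-label : ∀ {y W ℓ} → Valid (prt W) → y ≼ prt W → (mg : Merge x W ℓ) →
                     (∀ {j} → W ∋ Merge.b mg ~ j → toℕ (Merge.a mg) < toℕ j) → Neg x y (Merge.a mg)
    neg-from-label {y} {W} vW le mg h = Merge.¬max-a mg ,
      adm-≐ y (proj₁ (merge-neg mg h)) (proj₂ (merge-neg mg h)) (adm-row y W vW le (Merge.a mg))

    best-first : ∀ {y ℓ} → Valid y → (β : Best x y ℓ) → ∀ w {ℓ'} → Covers (prt x) w → y ≼ w →
                 Lab (prt x) w ℓ' → ℓ ℤ.≤ ℓ' × (ℓ ≡ ℓ' → w ≡ target β)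
    best-first vy (negᵇ a _ _) bot cv le refl = ℤ.-≤+ , λ ()
    best-first vy (zeroᵇ _) bot cv le refl = ℤₚ.≤-refl , λ _ → refl
    best-first vy (posᵇ _ _ _ _ _) bot cv ()
    best-first {y} vy β (prt W) {ℓ'} cv le l = go β (Merge.sign mg)
      where
      mg = lab⇒merge cv l
      vW = Covers.validᶻ cv
      open Merge mg using (sub; pZ; ¬max-a; max-a; Yab; a<b) renaming (a to a'; b to b')
      go : ∀ {ℓ ℓ₁} (β : Best x y ℓ) → Sign W a' b' ℓ₁ → ℓ ℤ.≤ ℓ₁ × (ℓ ≡ ℓ₁ → prt W ≡ target β)
      go (negᵇ a ng h) (inj₁ (s , refl)) =
        ℤ.-≤- (h a' (neg-from-label vW le mg s)) , λ e → cong prt (trans (merge-split mg)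
          (split-cong (λ m → subst (λ v → _ ∊ Pre x v) (sym (a≡ e)) (proj₁ (merge-neg mg s) m))
                      (λ m → proj₂ (merge-neg mg s) (subst (λ v → _ ∊ Pre x v) (a≡ e) m))))
        where
        a≡ : -[1+ toℕ a ] ≡ -[1+ toℕ a' ] → a ≡ a'
        a≡ e = Fₚ.toℕ-injective (ℤₚ.-[1+-injective e)
      go (negᵇ a ng h) (inj₂ (_ , refl)) = ℤ.-≤+ , λ ()
      go (zeroᵇ h) (inj₁ (s , _)) = ⊥-elim (h a' (neg-from-label vW le mg s))
      go (zeroᵇ h) (inj₂ (_ , refl)) = ℤ.+≤+ z≤n , λ ()
      go (posᵇ _ h _ _ _) (inj₁ (s , _)) = ⊥-elim (h a' (neg-from-label vW le mg s))
      go (posᵇ {Y} a h mY ¬mx least) (inj₂ (_ , refl)) =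
        ℤ.+≤+ (s≤s (least a' (max-anti Y⊑W max-a) ¬max-a)) , λ e → cong prt (trans (merge-split mg)
          (split-cong (λ {i} m → row⁺ (sub-row (a≡ e) (row⁻ m)))
                      (λ m → row⁺ (Y⊑W (subst (λ v → Y ∋ v ~ _) (a≡ e) (row⁻ m))))))
        where
        Y⊑W = ≼⇒⊑ Y W le
        pY = validPart Y vy
        a≡ : + suc (toℕ a) ≡ + suc (toℕ a') → a ≡ a'
        a≡ e = Fₚ.toℕ-injective (suc-injective (ℤₚ.+-injective e))
        -- The block of `a'` in W is a union of blocks of Y whose maxima are at most `a'` and new
        -- below x. Since `a` is the least new maximum, each of them is `a`, so there is only one
        -- such block.
        sub-row : a ≡ a' → ∀ {i} → W ∋ a' ~ i → Y ∋ a ~ i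
        sub-row e {i} w = subst (λ v → Y ∋ v ~ i) m≡a (~sym pY (~mx pY i))
          where
          wm : W ∋ a' ~ mx Y i
          wm = ~trans pZ w (Y⊑W (~mx pY i))
          m≤ : toℕ (mx Y i) ≤ toℕ a'
          m≤ = above max-a wm
          ¬m : ¬ Max x (mx Y i)
          ¬m m = <⇒≱ a<b (≤-trans (above m (~trans px (~sym px (sub wm)) Yab)) m≤)
          m≡a : mx Y i ≡ a
          m≡a = Fₚ.toℕ-injective (≤-antisym (subst (λ v → toℕ (mx Y i) ≤ toℕ v) (sym e) m≤)
                                            (least _ (mx-max pY i) ¬m))

    -- The best label, or in the positive case it or its negative, must occur in the chain, and the
    -- first label of an increasing chain is its least one. With `best-first` this makes the
    -- increasing chain unique.
    best-head : ∀ {y ℓ c ℓ' ls} → Valid y → Best x y ℓ → MC (prt x) y c → Labels c (ℓ' ∷ ls) →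
                WeakInc (ℓ' ∷ ls) → ℓ' ℤ.≤ ℓ
    best-head {y} vy (negᵇ a ng _) m lb inc = inc-head inc (negAppears y vy m lb inc ng)
    best-head vy (zeroᵇ _) m lb inc = inc-head inc (lastZero m lb)
    best-head vy (posᵇ a _ mY ¬mx _) m lb inc with maxAppears m lb mY ¬mx
    ... | _ , i , inj₁ refl = ℤₚ.≤-trans (inc-head inc i) ℤ.-≤+
    ... | _ , i , inj₂ refl = inc-head inc i

    -- Greedy choices give increasing labels because a negative label available after the step was
    -- available before it. If `a'` lies in the remainder of the block just split, its old prefix is
    -- the disjoint union of the part split off and its new prefix; elsewhere the prefix does not
    -- change.
    best-mono : ∀ {y ℓ R ℓ'} → Valid y → y ≼ prt x → (β : Best x y ℓ) → y ≼ target β → target β ≡ prt R →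
                Best R y ℓ' → ℓ ℤ.≤ ℓ'
    best-mono vy le (negᵇ a ng h) le' e (zeroᵇ _) = ℤ.-≤+
    best-mono vy le (negᵇ a ng h) le' e (posᵇ _ _ _ _ _) = ℤ.-≤+
    best-mono {y} vy le (negᵇ a (¬mx , ad) h) le' refl (negᵇ a' (¬mz , adz) _) =
      ℤ.-≤- (h a' ((λ m → ¬mz (max-anti split-⊑ m)) , back (a' ∊? Pre x a) (x ∋ a ~? a')))
      where
      back : Dec (a' ∊ Pre x a) → Dec (x ∋ a ~ a') → Adm y (Pre x a')
      back (yes p) _ = adm-≐ y (λ m → let e , l = pre⁻ m in pre⁺ (split-⊑ e) l)
        (λ m → let e , l = pre⁻ m in pre⁺ (split⁺ e (both-∊ p (pre⁺ (~trans px (proj₁ (pre⁻ p)) e)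
                                             (≤-trans l (proj₂ (pre⁻ p)))))) l) adz
      back (no ¬p) (yes aa') = adm-⊎ y (Pre x a') (Pre x a) (Pre (splitBy x (Pre x a)) a')
        f (λ m → let e , l = pre⁻ m in pre⁺ (~trans px (~sym px aa') e) (≤-trans l a≤))
        (λ m → let e , l = pre⁻ m in pre⁺ (split-⊑ e) l)
        (λ p q → ¬p (∊-≡ p (sym (proj₂ (split⁻ (proj₁ (pre⁻ q))))))) ad adz
        where
        a≤ : toℕ a ≤ toℕ a'
        a≤ = ≰⇒≥ λ l → ¬p (pre⁺ aa' l)
        f : ∀ {i} → i ∊ Pre x a' → (i ∊ Pre x a) ⊎ (i ∊ Pre (splitBy x (Pre x a)) a')
        f {i} m with i ∊? Pre x a
        ... | yes q = inj₁ q
        ... | no ¬q = let e , l = pre⁻ m in inj₂ (pre⁺ (split⁺ e (both-∉ ¬p ¬q)) l)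
      back (no ¬p) (no ¬aa') = adm-≐ y (λ m → let e , l = pre⁻ m in pre⁺ (split-⊑ e) l)
        (λ m → let e , l = pre⁻ m in pre⁺ (split⁺ e (both-∉ ¬p λ q →
                  ¬aa' (~trans px (proj₁ (pre⁻ q)) (~sym px e)))) l) adz
    best-mono vy le (posᵇ a h mY ¬mx least) le' refl (posᵇ a' _ mY' ¬mz _) =
      ℤ.+≤+ (s≤s (least a' mY' λ m → ¬mz (max-anti split-⊑ m)))
    best-mono {prt Y} vY le (posᵇ a h mY ¬mx least) le' refl (negᵇ a' (¬mz , adz) _) =
      ⊥-elim (h a' ((λ m → ¬mz (max-anti split-⊑ m)) , back (x ∋ a ~? a')))
      where
      pY = validPart Y vY
      Y⊑x = ≼⇒⊑ Y x le
      z = splitBy x (row Y a)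
      Y⊑z = ≼⇒⊑ Y z le'
      pz : Part z
      pz = split-part px
      max-z-a : Max z a
      max-z-a = maximal λ e → above mY (row⁻ (∊-≡ (row⁺ (~refl pY)) (proj₂ (split⁻ e))))
      -- The new prefix of `a'` is closed under Y, so it contains `t`. As `t` is a new maximum,
      -- minimality of `a` gives a ≤ t ≤ a'.
      t = mx Y a'
      t≤ : toℕ t ≤ toℕ a'
      t≤ = proj₂ (pre⁻ (adz a' t (pre⁺ (~refl pz) ≤-refl) (~mx pY a')))
      ¬mx-t : ¬ Max x t
      ¬mx-t m = ¬mz (maximal λ e → ≤-trans (above m (~trans px (~sym px (Y⊑x (~mx pY a'))) (split-⊑ e))) t≤)
      a≤ : toℕ a ≤ toℕ a'
      a≤ = ≤-trans (least t (mx-max pY a') ¬mx-t) t≤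
      a'∉ : ¬ (a' ∊ row Y a)
      a'∉ m = ¬mz (subst (Max z) (Fₚ.toℕ-injective (≤-antisym a≤ (above mY (row⁻ m)))) max-z-a)
      back : Dec (x ∋ a ~ a') → Adm (prt Y) (Pre x a')
      back (yes aa') = adm-⊎ (prt Y) (Pre x a') (row Y a) (Pre z a') f
        (λ m → pre⁺ (~trans px (~sym px aa') (Y⊑x (row⁻ m))) (≤-trans (above mY (row⁻ m)) a≤))
        (λ m → let e , l = pre⁻ m in pre⁺ (split-⊑ e) l)
        (λ p q → a'∉ (∊-≡ p (sym (proj₂ (split⁻ (proj₁ (pre⁻ q)))))))
        (λ i j m e → row⁺ (~trans pY (row⁻ m) e)) adz
        where
        f : ∀ {i} → i ∊ Pre x a' → (i ∊ row Y a) ⊎ (i ∊ Pre z a')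
        f {i} m with i ∊? row Y a
        ... | yes q = inj₁ q
        ... | no ¬q = let e , l = pre⁻ m in inj₂ (pre⁺ (split⁺ e (both-∉ a'∉ ¬q)) l)
      back (no ¬aa') = adm-≐ (prt Y) (λ m → let e , l = pre⁻ m in pre⁺ (split-⊑ e) l)
        (λ m → let e , l = pre⁻ m in pre⁺ (split⁺ e (both-∉ a'∉ λ q →
                  ¬aa' (~trans px (Y⊑x (row⁻ q)) (~sym px e)))) l) adz

  record ELChain (x y : Pt n) : Set where
    field
      c    : List (Pt n)
      ls   : List ℤ
      mc   : MC x y c
      labs : Labels c ls
      inc  : WeakInc ls
      uniq : ∀ c' ls' → MC x y c' → Labels c' ls' → WeakInc ls' → c' ≡ c
      lex  : ∀ c' ls' → MC x y c' → Labels c' ls' → LexLeq ls ls'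
      best : ∀ ℓ ls' → ls ≡ ℓ ∷ ls' → Σ (Mat n) λ R → x ≡ prt R × Best R y ℓ

  trivial : ∀ x → Valid x → ELChain x x
  trivial x vx = record
    { c = x ∷ [] ; ls = [] ; mc = single vx ; labs = one ; inc = []
    ; uniq = λ c' ls' m _ _ → mc-refl m ; lex = λ _ _ _ _ → nil ; best = λ _ _ () }

  -- The size of this set drops at every step and bounds the recursion in `el`.
  nonmax : Mat n → Sub n
  nonmax x = ⟦ (λ a → ¬? (Max? x a)) ⟧

  cons-chain : ∀ {x y ℓ} → Valid (prt x) → Valid y → y ≼ prt x → (β : Best x y ℓ) → ELChain (target β) y →
               ELChain (prt x) y
  cons-chain {x} {y} {ℓ} vx vy le β E with mc-head (ELChain.mc E) | best-cover vx vy le β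
  ... | c₁ , c≡ | cv , lb , le' = record
    { c = prt x ∷ c ; ls = ℓ ∷ ls
    ; mc = step cv mc
    ; labs = subst (λ c → Labels (prt x ∷ c) (ℓ ∷ ls)) (sym c≡) (cons lb (subst (λ c → Labels c ls) c≡ labs))
    ; inc = incr ls inc best
    ; uniq = unq ; lex = lx
    ; best = λ { _ _ refl → x , refl , β } }
    where
    open ELChain E
    incr : ∀ ls → WeakInc ls → (∀ ℓ ls' → ls ≡ ℓ ∷ ls' → Σ (Mat n) λ R → target β ≡ prt R × Best R y ℓ) → WeakInc (ℓ ∷ ls)
    incr [] _ _ = [-]
    incr (ℓ₁ ∷ ls) i b = let R , e , β' = b _ _ refl in best-mono vx vy le β le' e β' ∷ i
    not-single : y ≢ prt x
    not-single e = proj₂ (Covers.lt cv) (≼-antisym _ _ (proj₁ (Covers.lt cv)) (subst (_≼ target β) e le'))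
    unq : ∀ c' ls' → MC (prt x) y c' → Labels c' ls' → WeakInc ls' → c' ≡ prt x ∷ c
    unq _ ls' (single _) _ _ = ⊥-elim (not-single refl)
    unq _ ls' (step {y = w} {c = c'} cv' m) lb' inc' with labels-head m lb'
    ... | ℓ' , ls'' , refl , l' , lbs with best-first vx vy β w cv' (mc-≼ m) l'
    ...   | ℓ≤ℓ' , same with same (ℤₚ.≤-antisym ℓ≤ℓ' (best-head vx vy β (step cv' m) lb' inc'))
    ...     | refl = cong (prt x ∷_) (uniq c' ls'' m lbs (linked-tail inc'))
    lx : ∀ c' ls' → MC (prt x) y c' → Labels c' ls' → LexLeq (ℓ ∷ ls) ls'
    lx _ ls' (single _) _ = ⊥-elim (not-single refl)
    lx _ ls' (step {y = w} {c = c'} cv' m) lb' with labels-head m lb'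
    ... | ℓ' , ls'' , refl , l' , lbs with best-first vx vy β w cv' (mc-≼ m) l' | ℓ ℤₚ.≟ ℓ'
    ...   | ℓ≤ℓ' , same | no ℓ≢ = lt (ℤₚ.≤∧≢⇒< ℓ≤ℓ' ℓ≢)
    ...   | ℓ≤ℓ' , same | yes refl with same refl
    ...     | refl = eq (lex c' ls'' m lbs)

  nonmax-< : ∀ {x z a} → z ⊑ᵐ x → Max z a → ¬ Max x a → cnt (nonmax z) < cnt (nonmax x)
  nonmax-< {x} {z} z⊑x mz ¬mx = cnt-<
    (λ m → ⟦⟧⁺ (λ a → ¬? (Max? x a)) λ q → ⟦⟧⁻ (λ a → ¬? (Max? z a)) m (max-anti z⊑x q))
    (⟦⟧⁺ (λ a → ¬? (Max? x a)) ¬mx) (λ m → ⟦⟧⁻ (λ a → ¬? (Max? z a)) m mz)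

  el : ∀ g (x : Mat n) y → cnt (nonmax x) < g → Valid (prt x) → Valid y → y ≼ prt x → ELChain (prt x) y
  el (suc g) x y (s≤s bd) vx vy le with best? y vx vy le
  ... | inj₁ refl = trivial _ vx
  ... | inj₂ (ℓ , β) = cons-chain vx vy le β (rest (best-cover vx vy le β))
    where
    rest : Covers (prt x) (target β) × Lab (prt x) (target β) ℓ × y ≼ target β → ELChain (target β) y
    rest (cv , lb , le') = go (target β) cv lb le'
      where
      go : ∀ z → Covers (prt x) z → Lab (prt x) z ℓ → y ≼ z → ELChain z y
      go bot cv lb le' with ≼-antisym bot y tt le'
      ... | refl = trivial bot tt
      go (prt R) cv lb le' = let mg = lab⇒merge cv lb in
        el g R y (<-≤-trans (nonmax-< (Merge.sub mg) (Merge.max-a mg) (Merge.¬max-a mg)) bd)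
           (Covers.validᶻ cv) vy le'

  isDualEL : IsDualEL
  isDualEL x y vx vy le = result (chain x vx le)
    where
    chain : ∀ x → Valid x → y ≼ x → ELChain x y
    chain (prt x) vx le = el (suc (cnt (nonmax x))) x y ≤-refl vx vy le
    chain bot vx le with ≼-antisym bot y tt le
    ... | refl = trivial bot tt
    result : ELChain x y → _
    result E = c , ls , mc , labs , inc , uniq , lex
      where open ELChain E

-- Words as bijections from letters to 0-based positions; cuts and switches.

record Rank {n : ℕ} (ρ : Fin n → ℕ) : Set where
  field
    bounded    : ∀ u → ρ u < n
    injective  : ∀ {u v} → ρ u ≡ ρ v → u ≡ v
    surjective : ∀ {i} → i < n → ∃ λ u → ρ u ≡ i

opaque
  -- Pigeonhole: if the value i were missed, punching it out would inject the letters into a set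
  -- with one element fewer.
  mkRank : ∀ {n} {ρ : Fin n → ℕ} → (∀ u → ρ u < n) → (∀ {u v} → ρ u ≡ ρ v → u ≡ v) → Rank ρ
  mkRank {n} {ρ} bd inj = record { bounded = bd ; injective = inj ; surjective = sur }
    where
    sur : ∀ {i} → i < n → ∃ λ u → ρ u ≡ i
    sur {i} i<n with Fₚ.any? (λ u → ρ u ≟ i)
    ... | yes w = w
    ... | no ¬w = ⊥-elim (clash n refl i<n)
      where
      clash : ∀ n' → n ≡ n' → i < n' → ⊥
      clash (suc n') refl i<n' = 1+n≰n (Fₚ.injective⇒≤ {f = g} g-inj)
        where
        ≢i : ∀ u → fromℕ< i<n' ≢ fromℕ< (bd u)
        ≢i u e = ¬w (u , trans (sym (Fₚ.toℕ-fromℕ< (bd u))) (trans (cong toℕ (sym e)) (Fₚ.toℕ-fromℕ< i<n')))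
        g : Fin (suc n') → Fin n'
        g u = F.punchOut (≢i u)
        g-inj : ∀ {u v} → g u ≡ g v → u ≡ v
        g-inj {u} {v} e = inj (trans (sym (Fₚ.toℕ-fromℕ< (bd u)))
          (trans (cong toℕ (Fₚ.punchOut-injective (≢i u) (≢i v) e)) (Fₚ.toℕ-fromℕ< (bd v))))

below : ∀ {n} → (Fin n → ℕ) → ℕ → Sub n
below ρ b = ⟦ (λ u → ρ u ℕ.<? b) ⟧

cnt-below : ∀ {n} {ρ : Fin n → ℕ} → Rank ρ → ∀ b → b ≤ n → cnt (below ρ b) ≡ b
cnt-below rk zero _ = cnt-none _ λ u → refl
cnt-below {ρ = ρ} rk (suc b) b<n =
  trans (cnt-+ (below ρ (suc b)) (λ i → does (i Fₚ.≟ w)) (below ρ b) f g h dis)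
        (cong₂ _+_ (cnt-single w) (cnt-below rk b (<⇒≤ b<n)))
  where
  w = proj₁ (Rank.surjective rk b<n)
  ρw : ρ w ≡ b
  ρw = proj₂ (Rank.surjective rk b<n)
  in⁺ : ∀ {b u} → ρ u < b → u ∊ below ρ b
  in⁺ {b} = ⟦⟧⁺ (λ u → ρ u ℕ.<? b)
  in⁻ : ∀ {b u} → u ∊ below ρ b → ρ u < b
  in⁻ {b} = ⟦⟧⁻ (λ u → ρ u ℕ.<? b)
  is-w : ∀ {i} → i ∊ (λ i → does (i Fₚ.≟ w)) → i ≡ w
  is-w {i} (mem e) = does⇒ (i Fₚ.≟ w) e
  f : ∀ {i} → i ∊ below ρ (suc b) → (i ∊ (λ i → does (i Fₚ.≟ w))) ⊎ (i ∊ below ρ b)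
  f {i} m with i Fₚ.≟ w
  ... | yes e = inj₁ (mem (dec-true (i Fₚ.≟ w) e))
  ... | no ¬e = inj₂ (in⁺ (≤∧≢⇒< (ℕ.s≤s⁻¹ (in⁻ m)) λ e → ¬e (Rank.injective rk (trans e (sym ρw)))))
  g : ∀ {i} → i ∊ (λ i → does (i Fₚ.≟ w)) → i ∊ below ρ (suc b)
  g m = in⁺ (s≤s (≤-reflexive (trans (cong ρ (is-w m)) ρw)))
  h : ∀ {i} → i ∊ below ρ b → i ∊ below ρ (suc b)
  h m = in⁺ (<-trans (in⁻ m) ≤-refl)
  dis : ∀ {i} → i ∊ (λ i → does (i Fₚ.≟ w)) → i ∊ below ρ b → ⊥
  dis e m = <-irrefl (trans (cong ρ (is-w e)) ρw) (in⁻ m)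

SameSide : ℕ → ℕ → ℕ → Set
SameSide b p q = (p < b → q < b) × (q < b → p < b)

act≟ : (a b : Act) → Dec (a ≡ b)
act≟ none none = yes refl
act≟ none split = no λ ()
act≟ none swsplit = no λ ()
act≟ split none = no λ ()
act≟ split split = yes refl
act≟ split swsplit = no λ ()
act≟ swsplit none = no λ ()
act≟ swsplit split = no λ ()
act≟ swsplit swsplit = yes refl

-- The cut with index t lies before the 0-based position d * (j + t).
module _ (d : ℕ) where

  -- The graph of `swAux` without its recursion over the cuts: a position is fixed, or it is
  -- exchanged with its partner at some switched cut.
  data SwSpec (j : ℕ) {m : ℕ} (as : Vec Act m) (p : ℕ) : ℕ → Set where
    stay : (∀ t → lookup as t ≡ swsplit → p ≢ d * (j + toℕ t) ∸ 1 × p ≢ d * (j + toℕ t)) → SwSpec j as p p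
    up   : ∀ t → lookup as t ≡ swsplit → p ≡ d * (j + toℕ t) ∸ 1 → SwSpec j as p (d * (j + toℕ t))
    down : ∀ t → lookup as t ≡ swsplit → p ≡ d * (j + toℕ t) → SwSpec j as p (d * (j + toℕ t) ∸ 1)

  private
    shift : ∀ j {m} (t : Fin m) → d * (suc j + toℕ t) ≡ d * (j + toℕ (F.suc t))
    shift j t = cong (d *_) (sym (+-suc j (toℕ t)))

    first : ∀ j → d * (j + 0) ≡ d * j
    first j = cong (d *_) (+-identityʳ j)

  sw-later : ∀ {j m a} {as : Vec Act m} {p q} →
             (a ≡ swsplit → p ≢ d * (j + 0) ∸ 1 × p ≢ d * (j + 0)) →
             SwSpec (suc j) as p q → SwSpec j (a ∷ as) p q
  sw-later {j} {p = p} h (stay g) = stay λ { F.zero e → h e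
    ; (F.suc t) e → subst (λ b → p ≢ b ∸ 1 × p ≢ b) (shift j t) (g t e) }
  sw-later {j} {a = a} {as} {p} h (up t e q) = subst (SwSpec j (a ∷ as) p) (sym (shift j t))
    (up (F.suc t) e (trans q (cong (_∸ 1) (shift j t))))
  sw-later {j} {a = a} {as} {p} h (down t e q) = subst (λ b → SwSpec j (a ∷ as) p (b ∸ 1)) (sym (shift j t))
    (down (F.suc t) e (trans q (shift j t)))

  sw-spec : ∀ j {m} (as : Vec Act m) p → SwSpec j as p (swAux d j as p)
  sw-spec j [] p = stay λ ()
  sw-spec j (none ∷ as) p = sw-later (λ ()) (sw-spec (suc j) as p)
  sw-spec j (split ∷ as) p = sw-later (λ ()) (sw-spec (suc j) as p)
  sw-spec j (swsplit ∷ as) p with p ≟ d * j ∸ 1 | p ≟ d * j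
  ... | yes e | _ rewrite dec-true (p ≟ d * j ∸ 1) e =
        subst (SwSpec j (swsplit ∷ as) p) (first j) (up F.zero refl (trans e (cong (_∸ 1) (sym (first j)))))
  ... | no ¬e | yes e' rewrite dec-false (p ≟ d * j ∸ 1) ¬e | dec-true (p ≟ d * j) e' =
        subst (λ b → SwSpec j (swsplit ∷ as) p (b ∸ 1)) (first j) (down F.zero refl (trans e' (sym (first j))))
  ... | no ¬e | no ¬e' rewrite dec-false (p ≟ d * j ∸ 1) ¬e | dec-false (p ≟ d * j) ¬e' =
        sw-later (λ _ → (λ q → ¬e (trans q (cong (_∸ 1) (first j)))) , λ q → ¬e' (trans q (first j)))
                 (sw-spec (suc j) as p)

  private
    crossed⁻ : ∀ b p q x → ((p ℕ.<ᵇ b) ∧ not (q ℕ.<ᵇ b)) ∨ ((q ℕ.<ᵇ b) ∧ not (p ℕ.<ᵇ b)) ∨ x ≡ false →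
               SameSide b p q × x ≡ false
    crossed⁻ b p q x e with p ℕ.<? b | q ℕ.<? b
    ... | yes u | yes v rewrite dec-true (p ℕ.<? b) u | dec-true (q ℕ.<? b) v = ((λ _ → v) , λ _ → u) , e
    ... | no u  | no v rewrite dec-false (p ℕ.<? b) u | dec-false (q ℕ.<? b) v =
          ((λ w → ⊥-elim (u w)) , λ w → ⊥-elim (v w)) , e
    ... | yes u | no v rewrite dec-true (p ℕ.<? b) u | dec-false (q ℕ.<? b) v = contradiction e λ ()
    ... | no u  | yes v rewrite dec-false (p ℕ.<? b) u | dec-true (q ℕ.<? b) v = contradiction e λ ()

    crossed⁺ : ∀ b p q x → SameSide b p q → x ≡ false →
               ((p ℕ.<ᵇ b) ∧ not (q ℕ.<ᵇ b)) ∨ ((q ℕ.<ᵇ b) ∧ not (p ℕ.<ᵇ b)) ∨ x ≡ false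
    crossed⁺ b p q x (f , g) e with p ℕ.<? b | q ℕ.<? b
    ... | yes u | yes v rewrite dec-true (p ℕ.<? b) u | dec-true (q ℕ.<? b) v = e
    ... | no u  | no v rewrite dec-false (p ℕ.<? b) u | dec-false (q ℕ.<? b) v = e
    ... | yes u | no v = ⊥-elim (v (f u))
    ... | no u  | yes v = ⊥-elim (u (g v))

  sep⁻ : ∀ j {m} (as : Vec Act m) p q → sepAux d j as p q ≡ false →
         ∀ t → lookup as t ≢ none → SameSide (d * (j + toℕ t)) p q
  sep⁻ j (none ∷ as) p q e F.zero h = ⊥-elim (h refl)
  sep⁻ j (none ∷ as) p q e (F.suc t) h = subst (λ b → SameSide b p q) (shift j t) (sep⁻ (suc j) as p q e t h)
  sep⁻ j (split ∷ as) p q e F.zero h =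
    subst (λ b → SameSide b p q) (sym (first j)) (proj₁ (crossed⁻ (d * j) p q _ e))
  sep⁻ j (split ∷ as) p q e (F.suc t) h = subst (λ b → SameSide b p q) (shift j t)
    (sep⁻ (suc j) as p q (proj₂ (crossed⁻ (d * j) p q _ e)) t h)
  sep⁻ j (swsplit ∷ as) p q e F.zero h =
    subst (λ b → SameSide b p q) (sym (first j)) (proj₁ (crossed⁻ (d * j) p q _ e))
  sep⁻ j (swsplit ∷ as) p q e (F.suc t) h = subst (λ b → SameSide b p q) (shift j t)
    (sep⁻ (suc j) as p q (proj₂ (crossed⁻ (d * j) p q _ e)) t h)

  sep⁺ : ∀ j {m} (as : Vec Act m) p q →
         (∀ t → lookup as t ≢ none → SameSide (d * (j + toℕ t)) p q) → sepAux d j as p q ≡ false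
  sep⁺ j [] p q h = refl
  sep⁺ j (a ∷ as) p q h = go a (h F.zero) (sep⁺ (suc j) as p q λ t ne →
      subst (λ b → SameSide b p q) (sym (shift j t)) (h (F.suc t) ne))
    where
    go : ∀ a → (a ≢ none → SameSide (d * (j + 0)) p q) → sepAux d (suc j) as p q ≡ false →
         sepAux d j (a ∷ as) p q ≡ false
    go none _ e = e
    go split g e = crossed⁺ (d * j) p q _ (subst (λ b → SameSide b p q) (first j) (g λ ())) e
    go swsplit g e = crossed⁺ (d * j) p q _ (subst (λ b → SameSide b p q) (first j) (g λ ())) e

-- Cut positions, and the partition defined by a choice at the cuts.

module Cuts (n d k : ℕ) (1<d : 1 < d) (n≡ : n ≡ k * d) where

  open Poset n d k 1<d n≡

  Cut : Set
  Cut = Fin (k ∸ 1)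

  Acts : Set
  Acts = Vec Act (k ∸ 1)

  bd : Cut → ℕ
  bd t = d * suc (toℕ t)

  d∣bd : ∀ t → d ∣ bd t
  d∣bd t = m∣m*n (suc (toℕ t))

  d≤bd : ∀ t → d ≤ bd t
  d≤bd t = m≤m*n d (suc (toℕ t))

  1<bd : ∀ t → 1 < bd t
  1<bd t = ≤-trans 1<d (d≤bd t)

  bd+d≤n : ∀ t → bd t + d ≤ n
  bd+d≤n t = begin
    d * suc (toℕ t) + d   ≡⟨ +-comm (d * suc (toℕ t)) d ⟩
    d + d * suc (toℕ t)   ≡⟨ *-suc d (suc (toℕ t)) ⟨
    d * suc (suc (toℕ t)) ≤⟨ *-monoʳ-≤ d (lemma k (Fₚ.toℕ<n t)) ⟩
    d * k                 ≡⟨ *-comm d k ⟩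
    k * d                 ≡⟨ n≡ ⟨
    n                     ∎
    where
    open ≤-Reasoning
    lemma : ∀ k {i} → i < k ∸ 1 → suc (suc i) ≤ k
    lemma (suc k) h = s≤s h

  bd<n : ∀ t → bd t < n
  bd<n t = <-≤-trans (m<m+n (bd t) 0<d) (bd+d≤n t)

  bd-gap : ∀ {t t'} → toℕ t < toℕ t' → bd t + d ≤ bd t'
  bd-gap {t} {t'} h = begin
    d * suc (toℕ t) + d   ≡⟨ +-comm (d * suc (toℕ t)) d ⟩
    d + d * suc (toℕ t)   ≡⟨ *-suc d (suc (toℕ t)) ⟨
    d * suc (suc (toℕ t)) ≤⟨ *-monoʳ-≤ d (s≤s h) ⟩
    d * suc (toℕ t')      ∎
    where open ≤-Reasoning

  bd-find : ∀ {b} → d ∣ b → 0 < b → b < n → ∃ λ t → bd t ≡ b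
  bd-find (divides zero refl) () _
  bd-find (divides (suc q) refl) _ h = fromℕ< q< , trans (cong (λ x → d * suc x) (Fₚ.toℕ-fromℕ< q<)) (*-comm d (suc q))
    where
    lemma : ∀ k → suc q < k → q < k ∸ 1
    lemma (suc k) (s≤s h) = h
    q< : q < k ∸ 1
    q< = lemma k (*-cancelʳ-< d (suc q) k (<-≤-trans h (≤-reflexive n≡)))

  pred< : ∀ {b} → 0 < b → b ∸ 1 < b
  pred< {suc b} _ = ≤-refl

  bd-1<bd : ∀ t → bd t ∸ 1 < bd t
  bd-1<bd t = pred< (<⇒≤ (1<bd t))

  -- Here `p` is a position before switching: the letter there ends up left of the cut at `b`. Under
  -- `swsplit` the letters at `b ∸ 1` and `b` have changed places.
  LeftOf : Act → ℕ → ℕ → Set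
  LeftOf none    b p = ⊥
  LeftOf split   b p = p < b
  LeftOf swsplit b p = (p < b ∸ 1) ⊎ (p ≡ b)

  Near : ℕ → ℕ → Set
  Near b p = (p ≡ b ∸ 1) ⊎ (p ≡ b)

  near-≤ : ∀ {b p} → Near b p → p ≤ b
  near-≤ {b} (inj₁ refl) = m∸n≤m b 1
  near-≤ (inj₂ refl) = ≤-refl

  near-≥ : ∀ {b p} → Near b p → b ≤ suc p
  near-≥ {zero} _ = z≤n
  near-≥ {suc b} (inj₁ refl) = ≤-refl
  near-≥ {suc b} (inj₂ refl) = <⇒≤ ≤-refl

  <pred : ∀ {p b} → suc p < b → p < b ∸ 1
  <pred {b = suc b} (s≤s h) = h

  pred≤ : ∀ {p b} → p < b ∸ 1 → suc p < b
  pred≤ {b = suc b} h = s≤s h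

  -- This is where d > 1 makes switches independent: consecutive cuts are at least two positions
  -- apart, so their pairs are disjoint.
  far : ∀ {t t'} → t ≢ t' → (∀ {p} → Near (bd t') p → p < bd t ∸ 1) ⊎ (∀ {p} → Near (bd t') p → bd t < p)
  far {t} {t'} ne with <-cmp (toℕ t) (toℕ t')
  ... | tri≈ _ e _ = ⊥-elim (ne (Fₚ.toℕ-injective e))
  ... | tri< h _ _ = inj₂ λ np → ℕ.s≤s⁻¹ (≤-trans (subst (_≤ bd t + d) (+-comm (bd t) 2) (+-monoʳ-≤ (bd t) 1<d))
                                  (≤-trans (bd-gap h) (near-≥ np)))
  ... | tri> _ _ h = inj₁ λ np → <pred (≤-trans (s≤s (s≤s (near-≤ np)))
                                  (≤-trans (subst (_≤ bd t' + d) (+-comm (bd t') 2) (+-monoʳ-≤ (bd t') 1<d)) (bd-gap h)))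

  left-far : ∀ {a b p} → a ≢ none → p < b ∸ 1 → LeftOf a b p
  left-far {none} ne _ = ⊥-elim (ne refl)
  left-far {split} {b} _ h = <-≤-trans h (m∸n≤m b 1)
  left-far {swsplit} _ h = inj₁ h

  right-far : ∀ {a b p} → b < p → ¬ LeftOf a b p
  right-far {split} h l = <-asym h l
  right-far {swsplit} {b} h (inj₁ l) = <-asym h (<-≤-trans l (m∸n≤m b 1))
  right-far {swsplit} h (inj₂ e) = <-irrefl (sym e) h

  sw : Acts → ℕ → ℕ
  sw c p = swAux d 1 c p

  Swap : Acts → ℕ → ℕ → Set
  Swap c = SwSpec d 1 c

  -- Switches at other cuts exchange positions on the same side of `t`, so the side on which a
  -- letter lands depends only on its original position and the action at `t`.
  swap-left : ∀ {c p q} → Swap c p q → ∀ t → lookup c t ≢ none →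
              (q < bd t → LeftOf (lookup c t) (bd t) p) × (LeftOf (lookup c t) (bd t) p → q < bd t)
  swap-left {c} {p} (stay h) t ne = go (lookup c t) refl ne
    where
    go : ∀ a → lookup c t ≡ a → a ≢ none → (p < bd t → LeftOf a (bd t) p) × (LeftOf a (bd t) p → p < bd t)
    go none _ ne = ⊥-elim (ne refl)
    go split _ _ = id , id
    go swsplit e _ = let e₁ , e₂ = h t e in
      (λ l → inj₁ (<pred (≤∧≢⇒< l λ q → e₁ (cong (_∸ 1) q)))) ,
      λ { (inj₁ l) → <-≤-trans l (m∸n≤m (bd t) 1) ; (inj₂ q) → ⊥-elim (e₂ q) }
  swap-left {c} (up t' e refl) t ne with t Fₚ.≟ t'
  ... | yes refl rewrite e = (λ l → ⊥-elim (<-irrefl refl l)) ,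
        λ { (inj₁ l) → ⊥-elim (<-irrefl refl l)
          ; (inj₂ q) → ⊥-elim (<-irrefl q (bd-1<bd t)) }
  ... | no t≢ with far t≢
  ...   | inj₁ f = (λ _ → left-far ne (f (inj₁ refl))) , λ _ → <-≤-trans (f (inj₂ refl)) (m∸n≤m (bd t) 1)
  ...   | inj₂ f = (λ l → ⊥-elim (<-asym l (f (inj₂ refl)))) , λ l → ⊥-elim (right-far {lookup c t} (f (inj₁ refl)) l)
  swap-left {c} (down t' e refl) t ne with t Fₚ.≟ t'
  ... | yes refl rewrite e = (λ _ → inj₂ refl) , λ _ → bd-1<bd t
  ... | no t≢ with far t≢
  ...   | inj₁ f = (λ _ → left-far ne (f (inj₂ refl))) , λ _ → <-≤-trans (f (inj₁ refl)) (m∸n≤m (bd t) 1)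
  ...   | inj₂ f = (λ l → ⊥-elim (<-asym l (f (inj₁ refl)))) , λ l → ⊥-elim (right-far {lookup c t} (f (inj₂ refl)) l)

  same-cut : ∀ {t t' p p'} → Near (bd t) p → Near (bd t') p' → p ≡ p' → t ≡ t'
  same-cut {t} {t'} np np' refl with t Fₚ.≟ t'
  ... | yes e = e
  ... | no ne with far ne
  ...   | inj₁ f = contradiction (near-≥ np) (<⇒≱ (pred≤ (f np')))
  ...   | inj₂ f = contradiction (near-≤ np) (<⇒≱ (f np'))

  straddle : ∀ {t t'} → t' ≢ t → SameSide (bd t') (bd t ∸ 1) (bd t)
  straddle {t} {t'} ne with far ne
  ... | inj₁ f = (λ _ → <-≤-trans (f (inj₂ refl)) (m∸n≤m (bd t') 1)) , λ _ → <-≤-trans (f (inj₁ refl)) (m∸n≤m (bd t') 1)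
  ... | inj₂ f = (λ l → ⊥-elim (<-asym l (f (inj₁ refl)))) , λ l → ⊥-elim (<-asym l (f (inj₂ refl)))

  swap-unique : ∀ {c p q q'} → Swap c p q → Swap c p q' → q ≡ q'
  swap-unique (stay h) (stay g) = refl
  swap-unique (stay h) (up t e r) = ⊥-elim (proj₁ (h t e) r)
  swap-unique (stay h) (down t e r) = ⊥-elim (proj₂ (h t e) r)
  swap-unique (up t e r) (stay h) = ⊥-elim (proj₁ (h t e) r)
  swap-unique (down t e r) (stay h) = ⊥-elim (proj₂ (h t e) r)
  swap-unique (up t e r) (up t' e' r') = cong bd (same-cut (inj₁ r) (inj₁ r') refl)
  swap-unique (down t e r) (down t' e' r') = cong (λ t → bd t ∸ 1) (same-cut (inj₂ r) (inj₂ r') refl)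
  swap-unique (up t e r) (down t' e' r') with same-cut {t} {t'} (inj₁ r) (inj₂ r') refl
  ... | refl = ⊥-elim (<-irrefl (trans (sym r) r') (bd-1<bd t))
  swap-unique (down t e r) (up t' e' r') with same-cut {t} {t'} (inj₂ r) (inj₁ r') refl
  ... | refl = ⊥-elim (<-irrefl (trans (sym r') r) (bd-1<bd t))

  swap-sym : ∀ {c p q} → Swap c p q → Swap c q p
  swap-sym (stay h) = stay h
  swap-sym {c} (up t e refl) = down t e refl
  swap-sym {c} (down t e refl) = up t e refl

  sw-invol : ∀ c p → sw c (sw c p) ≡ p
  sw-invol c p = swap-unique (sw-spec d 1 c (sw c p)) (swap-sym (sw-spec d 1 c p))

  swap-bounded : ∀ {c p q} → Swap c p q → p < n → q < n
  swap-bounded (stay _) h = h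
  swap-bounded (up t _ _) _ = bd<n t
  swap-bounded (down t _ _) _ = ≤-<-trans (m∸n≤m (bd t) 1) (bd<n t)

  sw-rank : ∀ {ρ : Fin n → ℕ} → Rank ρ → ∀ c → Rank (sw c ∘ ρ)
  sw-rank {ρ} rk c = mkRank (λ u → swap-bounded (sw-spec d 1 c (ρ u)) (Rank.bounded rk u))
    λ {u} {v} e → Rank.injective rk (trans (sym (sw-invol c (ρ u))) (trans (cong (sw c) e) (sw-invol c (ρ v))))

  Full : Acts → Set
  Full f = ∀ t → lookup f t ≢ none

  _⊑ᵃ_ : Acts → Acts → Set
  c ⊑ᵃ f = ∀ t → lookup c t ≢ none → lookup f t ≡ lookup c t

  -- Thanks to this, the partitions of all choices contained in `f` can be read off from the one
  -- word switched by `f`.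
  sameSide-⊑ : ∀ {c f} → c ⊑ᵃ f → ∀ t → lookup c t ≢ none → ∀ p → (sw c p < bd t → sw f p < bd t) × (sw f p < bd t → sw c p < bd t)
  sameSide-⊑ {c} {f} le t ne p =
    (λ l → proj₂ F' (subst (λ a → LeftOf a (bd t) p) (sym (le t ne)) (proj₁ C l))) ,
    (λ l → proj₂ C (subst (λ a → LeftOf a (bd t) p) (le t ne) (proj₁ F' l)))
    where
    C = swap-left (sw-spec d 1 c p) t ne
    F' = swap-left (sw-spec d 1 f p) t (λ e → ne (trans (sym (le t ne)) e))

  module Word {pos : Fin n → ℕ} (rk : Rank pos) where

    ρ : Acts → Fin n → ℕ
    ρ c u = sw c (pos u)

    ρ-rank : ∀ c → Rank (ρ c)
    ρ-rank = sw-rank rk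

    Together : Acts → (Fin n → ℕ) → Fin n → Fin n → Set
    Together c r u v = ∀ t → lookup c t ≢ none → SameSide (bd t) (r u) (r v)

    opaque
      P : Acts → Mat n
      P c = mat λ u v → sepAux d 1 c (ρ c u) (ρ c v) 𝔹.≟ false

      P-entry : ∀ c u v → entry (P c) u v ≡ not (sepAux d 1 c (ρ c u) (ρ c v))
      P-entry c u v = trans (entry-mat (λ u v → sepAux d 1 c (ρ c u) (ρ c v) 𝔹.≟ false) u v) (lemma _)
        where
        lemma : ∀ b → does (b 𝔹.≟ false) ≡ not b
        lemma true = refl
        lemma false = refl

    P⁺ : ∀ {c f} → c ⊑ᵃ f → ∀ {u v} → Together c (ρ f) u v → P c ∋ u ~ v
    P⁺ {c} {f} le {u} {v} h = rel (trans (P-entry c u v) (cong not (sep⁺ d 1 c (ρ c u) (ρ c v) λ t ne →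
      let a = sameSide-⊑ {c} {f} le t ne ; x , y = h t ne in
      (λ l → proj₂ (a (pos v)) (x (proj₁ (a (pos u)) l))) ,
      (λ l → proj₂ (a (pos u)) (y (proj₁ (a (pos v)) l))))))

    P⁻ : ∀ {c f} → c ⊑ᵃ f → ∀ {u v} → P c ∋ u ~ v → Together c (ρ f) u v
    P⁻ {c} {f} le {u} {v} (rel e) t ne =
      let a = sameSide-⊑ {c} {f} le t ne
          x , y = sep⁻ d 1 c (ρ c u) (ρ c v) (𝔹ₚ.not-injective (trans (sym (P-entry c u v)) e)) t ne in
      (λ l → proj₁ (a (pos v)) (x (proj₂ (a (pos u)) l))) ,
      (λ l → proj₁ (a (pos u)) (y (proj₂ (a (pos v)) l)))

    ⊑ᵃ-refl : ∀ c → c ⊑ᵃ c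
    ⊑ᵃ-refl c t _ = refl

    P-part : ∀ c → Part (P c)
    P-part c = record
      { ~refl = P⁺ {c} {c} (⊑ᵃ-refl c) λ t _ → id , id
      ; ~sym = λ e → P⁺ {c} {c} (⊑ᵃ-refl c) λ t ne → let x , y = P⁻ {c} {c} (⊑ᵃ-refl c) e t ne in y , x
      ; ~trans = λ e f → P⁺ {c} {c} (⊑ᵃ-refl c) λ t ne → let x , y = P⁻ {c} {c} (⊑ᵃ-refl c) e t ne ; z , w = P⁻ {c} {c} (⊑ᵃ-refl c) f t ne in
                           z ∘ x , y ∘ w }

    -- Each block of P c is an interval of positions with ends divisible by d.
    record Interval (c : Acts) (u : Fin n) (j : ℕ) : Set where
      field
        lo hi : ℕ
        d∣lo  : d ∣ lo
        d∣hi  : d ∣ hi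
        lo≤   : lo ≤ ρ c u
        <hi   : ρ c u < hi
        hi≤n  : hi ≤ n
        to    : ∀ {v} → (∀ t → toℕ t < j → lookup c t ≢ none → SameSide (bd t) (ρ c u) (ρ c v)) → lo ≤ ρ c v × ρ c v < hi
        from  : ∀ {v} → lo ≤ ρ c v × ρ c v < hi → ∀ t → toℕ t < j → lookup c t ≢ none → SameSide (bd t) (ρ c u) (ρ c v)

    -- Induction over the cuts with index below `j`: a cut that is made replaces the upper end by a
    -- minimum or the lower end by a maximum, according to the side on which `u` lies.
    interval : ∀ c u j → j ≤ k ∸ 1 → Interval c u j
    interval c u zero _ = record
      { lo = 0 ; hi = n ; d∣lo = d ∣0 ; d∣hi = divides k n≡ ; lo≤ = z≤n ; <hi = Rank.bounded (ρ-rank c) u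
      ; hi≤n = ≤-refl ; to = λ {v} _ → z≤n , Rank.bounded (ρ-rank c) v ; from = λ _ t () }
    interval c u (suc j) j< = go (act≟ (lookup c t) none) (ρ c u ℕ.<? bd t)
      where
      I = interval c u j (<⇒≤ j<)
      open Interval I
      t : Cut
      t = fromℕ< j<
      t≡ : toℕ t ≡ j
      t≡ = Fₚ.toℕ-fromℕ< j<
      last : ∀ t' → toℕ t' < suc j → (toℕ t' < j) ⊎ (t' ≡ t)
      last t' (s≤s h) with m≤n⇒m<n∨m≡n h
      ... | inj₁ l = inj₁ l
      ... | inj₂ e = inj₂ (Fₚ.toℕ-injective (trans e (sym t≡)))
      weaken : ∀ {v} → (∀ t → toℕ t < suc j → lookup c t ≢ none → SameSide (bd t) (ρ c u) (ρ c v)) →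
               (∀ t → toℕ t < j → lookup c t ≢ none → SameSide (bd t) (ρ c u) (ρ c v))
      weaken h t l = h t (<-trans l ≤-refl)
      extend : ∀ {v} → (∀ t → toℕ t < j → lookup c t ≢ none → SameSide (bd t) (ρ c u) (ρ c v)) →
               (lookup c t ≢ none → SameSide (bd t) (ρ c u) (ρ c v)) →
               (∀ t → toℕ t < suc j → lookup c t ≢ none → SameSide (bd t) (ρ c u) (ρ c v))
      extend h g t' l ne with last t' l
      ... | inj₁ l' = h t' l' ne
      ... | inj₂ refl = g ne
      t<' : toℕ t < suc j
      t<' = s≤s (≤-reflexive t≡)
      sel-⊓ : ∀ {x y} → d ∣ x → d ∣ y → d ∣ (x ℕ.⊓ y)
      sel-⊓ {x} {y} p q with ⊓-sel x y
      ... | inj₁ e = subst (d ∣_) (sym e) p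
      ... | inj₂ e = subst (d ∣_) (sym e) q
      sel-⊔ : ∀ {x y} → d ∣ x → d ∣ y → d ∣ (x ℕ.⊔ y)
      sel-⊔ {x} {y} p q with ⊔-sel x y
      ... | inj₁ e = subst (d ∣_) (sym e) p
      ... | inj₂ e = subst (d ∣_) (sym e) q
      go : Dec (lookup c t ≡ none) → Dec (ρ c u < bd t) → Interval c u (suc j)
      go (yes e) _ = record
        { lo = lo ; hi = hi ; d∣lo = d∣lo ; d∣hi = d∣hi ; lo≤ = lo≤ ; <hi = <hi ; hi≤n = hi≤n
        ; to = λ h → to (weaken h) ; from = λ h → extend (from h) λ ne → ⊥-elim (ne e) }
      go (no ne) (yes l) = record
        { lo = lo ; hi = hi ℕ.⊓ bd t ; d∣lo = d∣lo ; d∣hi = sel-⊓ d∣hi (d∣bd t) ; lo≤ = lo≤ ; <hi = ⊓-pres-m< <hi l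
        ; hi≤n = ≤-trans (m⊓n≤m hi (bd t)) hi≤n
        ; to = λ h → let a , b = to (weaken h) in a , ⊓-pres-m< b (proj₁ (h t t<' ne) l)
        ; from = λ { (a , b) → extend (from (a , <-≤-trans b (m⊓n≤m hi (bd t))))
                                 λ _ → (λ _ → <-≤-trans b (m⊓n≤n hi (bd t))) , λ _ → l } }
      go (no ne) (no ¬l) = record
        { lo = lo ℕ.⊔ bd t ; hi = hi ; d∣lo = sel-⊔ d∣lo (d∣bd t) ; d∣hi = d∣hi ; lo≤ = ⊔-lub lo≤ (≮⇒≥ ¬l) ; <hi = <hi
        ; hi≤n = hi≤n
        ; to = λ h → let a , b = to (weaken h) in ⊔-lub a (≮⇒≥ λ l → ¬l (proj₂ (h t t<' ne) l)) , b
        ; from = λ { (a , b) → extend (from (≤-trans (m≤m⊔n lo (bd t)) a , b))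
                                 λ _ → (λ l → ⊥-elim (¬l l)) , λ l → contradiction (≤-trans (m≤n⊔m lo (bd t)) a) (<⇒≱ l) } }

    cnt-interval : ∀ {r : Fin n → ℕ} → Rank r → ∀ lo hi → lo ≤ hi → hi ≤ n →
                   lo + cnt (below r hi ∖ below r lo) ≡ hi
    cnt-interval {r} rk lo hi l h = trans (cong (_+ cnt (below r hi ∖ below r lo)) (sym (cnt-below rk lo (≤-trans l h))))
      (trans (sym (cnt-∖ (below r hi) (below r lo) λ m →
          ⟦⟧⁺ (λ u → r u ℕ.<? hi) (<-≤-trans (⟦⟧⁻ (λ u → r u ℕ.<? lo) m) l)))
        (cnt-below rk hi h))

    interval⁺ : ∀ {r : Fin n → ℕ} {lo hi v} → lo ≤ r v → r v < hi → v ∊ (below r hi ∖ below r lo)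
    interval⁺ {r} {lo} {hi} a b = ∖⁺ (⟦⟧⁺ (λ u → r u ℕ.<? hi) b) λ m → <⇒≱ (⟦⟧⁻ (λ u → r u ℕ.<? lo) m) a

    interval⁻ : ∀ {r : Fin n → ℕ} {lo hi v} → v ∊ (below r hi ∖ below r lo) → lo ≤ r v × r v < hi
    interval⁻ {r} {lo} {hi} m = let a , b = ∖⁻ {S = below r hi} m in
      ≮⇒≥ (λ l → b (⟦⟧⁺ (λ u → r u ℕ.<? lo) l)) , ⟦⟧⁻ (λ u → r u ℕ.<? hi) a

    P-div : ∀ c u → d ∣ cnt (row (P c) u)
    P-div c u = subst (d ∣_) (cnt-≡ {S = below (ρ c) hi ∖ below (ρ c) lo}
        (λ m → let ab = interval⁻ {ρ c} m in row⁺ (P⁺ {c} {c} (⊑ᵃ-refl c) λ t → from ab t (Fₚ.toℕ<n t)))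
        (λ m → let a , b = to (λ t _ → P⁻ {c} {c} (⊑ᵃ-refl c) (row⁻ m) t) in interval⁺ {ρ c} a b))
      (∣m+n∣m⇒∣n (subst (d ∣_) (sym (cnt-interval (ρ-rank c) lo hi (≤-trans lo≤ (<⇒≤ <hi)) hi≤n)) d∣hi) d∣lo)
      where open Interval (interval c u (k ∸ 1) ≤-refl)

    P-valid : ∀ c → Valid (prt (P c))
    P-valid c = mkValid (P-part c) (P-div c)

-- Choices and partitions correspond, with order reversed; covers within one word.

module Cube (n d k : ℕ) (1<d : 1 < d) (n≡ : n ≡ k * d) where

  open Poset n d k 1<d n≡
  open Cuts n d k 1<d n≡

  module WordCube {pos : Fin n → ℕ} (rk : Rank pos) where

    open Word rk

    P-mono : ∀ {c c'} → c' ⊑ᵃ c → P c ⊑ᵐ P c'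
    P-mono {c} {c'} le e = P⁺ {c'} {c} le λ t ne → P⁻ {c} {c} (⊑ᵃ-refl c) e t λ q → ne (trans (sym (le t ne)) q)

    near-same : ∀ c {t t' p q} → t' ≢ t → Near (bd t) p → Near (bd t) q → lookup c t' ≢ none →
                SameSide (bd t') (sw c p) (sw c q)
    near-same c {t} {t'} {p} {q} t'≢ np nq ne = go np nq , go nq np
      where
      go : ∀ {p q} → Near (bd t) p → Near (bd t) q → sw c p < bd t' → sw c q < bd t'
      go {p} {q} np nq l with far t'≢
      ... | inj₁ f = proj₂ (swap-left (sw-spec d 1 c q) t' ne) (left-far ne (f nq))
      ... | inj₂ f = ⊥-elim (right-far {lookup c t'} (f np) (proj₁ (swap-left (sw-spec d 1 c p) t' ne) l))

    2≤bd : ∀ t → bd t ∸ 2 < bd t ∸ 1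
    2≤bd t = go (bd t) (1<bd t)
      where
      go : ∀ b → 1 < b → b ∸ 2 < b ∸ 1
      go (suc (suc b)) _ = ≤-refl
      go (suc zero) (s≤s ())

    -- For d = 2 this position can be the right one of the preceding cut pair, and a switch there
    -- moves it one place to the left; it never moves to the right.
    sw-before : ∀ c t → sw c (bd t ∸ 2) < bd t ∸ 1
    sw-before c t = go (sw-spec d 1 c (bd t ∸ 2))
      where
      go : ∀ {q} → Swap c (bd t ∸ 2) q → q < bd t ∸ 1
      go (stay _) = 2≤bd t
      go (down t' _ e) = ≤-<-trans (m∸n≤m (bd t') 1) (subst (_< bd t ∸ 1) e (2≤bd t))
      go (up t' _ e) with t Fₚ.≟ t'
      ... | yes refl = ⊥-elim (<-irrefl e (2≤bd t))
      ... | no t≢ with far t≢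
      ...   | inj₁ f = f (inj₂ refl)
      ...   | inj₂ f = contradiction (≤-trans (near-≥ (inj₁ e)) (2≤bd t))
                                     (<⇒≱ (≤-<-trans (m∸n≤m (bd t) 1) (f (inj₂ refl))))

    consecutive-same : ∀ t t' → SameSide (bd t') (bd t ∸ 2) (bd t ∸ 1)
    consecutive-same t t' = (λ l → ≤∧≢⇒< (≤-trans (≤-reflexive (sym (pp (bd t) (1<bd t)))) l) ne) , <-trans (2≤bd t)
      where
      pp : ∀ b → 1 < b → suc (b ∸ 2) ≡ b ∸ 1
      pp (suc (suc b)) _ = refl
      pp (suc zero) (s≤s ())
      ne : bd t ∸ 1 ≢ bd t'
      ne e with same-cut {t} {t'} (inj₁ refl) (inj₂ refl) e
      ... | refl = <-irrefl e (bd-1<bd t)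

    -- The choice at `t` is detected by letters near the cut. If `c` makes no cut there, it keeps
    -- the two letters of the cut pair together although `c'` separates them. If both cut but only
    -- one switches, then in the word switched by `c` the last two letters before the cut share a
    -- block of `P c`, while `c'` puts them on different sides.
    P-reflects : ∀ {c c'} → P c ⊑ᵐ P c' → c' ⊑ᵃ c
    P-reflects {c} {c'} h t ne' = go (lookup c t) (lookup c' t) refl refl
      where
      letter : ∀ p → p < n → ∃ λ u → pos u ≡ p
      letter p = Rank.surjective rk
      left : ∀ a {u p} → lookup c' t ≡ a → pos u ≡ p → LeftOf a (bd t) p → ρ c' u < bd t
      left a {u} e refl l = proj₂ (swap-left (sw-spec d 1 c' (pos u)) t ne') (subst (λ a → LeftOf a (bd t) (pos u)) (sym e) l)
      left⁻ : ∀ a {u p} → lookup c' t ≡ a → pos u ≡ p → ρ c' u < bd t → LeftOf a (bd t) p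
      left⁻ a {u} e refl l = subst (λ a → LeftOf a (bd t) (pos u)) e (proj₁ (swap-left (sw-spec d 1 c' (pos u)) t ne') l)
      b-1<n : bd t ∸ 1 < n
      b-1<n = ≤-<-trans (m∸n≤m (bd t) 1) (bd<n t)
      across : ∀ u v → pos u ≡ bd t ∸ 1 → pos v ≡ bd t → lookup c t ≡ none → SameSide (bd t) (ρ c' u) (ρ c' v)
      across u v pu pv e = P⁻ {c'} {c'} (⊑ᵃ-refl c') {u} {v} (h (P⁺ {c} {c} (⊑ᵃ-refl c) λ t' ne →
          near-same c {t} {t'} (λ { refl → ne e }) (inj₁ pu) (inj₂ pv) ne)) t ne'
      within : ∀ u v → ρ c u ≡ bd t ∸ 2 → ρ c v ≡ bd t ∸ 1 → SameSide (bd t) (ρ c' u) (ρ c' v)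
      within u v pu pv = P⁻ {c'} {c'} (⊑ᵃ-refl c') {u} {v} (h (P⁺ {c} {c} (⊑ᵃ-refl c) λ t' ne →
          subst₂ (SameSide (bd t')) (sym pu) (sym pv) (consecutive-same t t'))) t ne'
      before = letter (sw c (bd t ∸ 2)) (<-trans (sw-before c t) b-1<n)
      ρ-before : ρ c (proj₁ before) ≡ bd t ∸ 2
      ρ-before = trans (cong (sw c) (proj₂ before)) (sw-invol c (bd t ∸ 2))
      at₁ = letter (bd t ∸ 1) b-1<n
      at₂ = letter (bd t) (bd<n t)
      go : ∀ a a' → lookup c t ≡ a → lookup c' t ≡ a' → lookup c t ≡ lookup c' t
      go _ none e e' = ⊥-elim (ne' e')
      go split split e e' = trans e (sym e')
      go swsplit swsplit e e' = trans e (sym e')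
      go none split e e' = ⊥-elim (<-irrefl refl (left⁻ split {proj₁ at₂} e' (proj₂ at₂)
        (proj₁ (across _ _ (proj₂ at₁) (proj₂ at₂) e) (left split {proj₁ at₁} e' (proj₂ at₁) (bd-1<bd t)))))
      go none swsplit e e' with left⁻ swsplit {proj₁ at₁} e' (proj₂ at₁)
           (proj₂ (across _ _ (proj₂ at₁) (proj₂ at₂) e) (left swsplit {proj₁ at₂} e' (proj₂ at₂) (inj₂ refl)))
      ... | inj₁ l = ⊥-elim (<-irrefl refl l)
      ... | inj₂ q = ⊥-elim (<-irrefl q (bd-1<bd t))
      go split swsplit e e' with left⁻ swsplit {proj₁ at₁} e' (proj₂ at₁)
           (proj₁ (within (proj₁ before) (proj₁ at₁) ρ-before fixed)
             (left swsplit {proj₁ before} e' (proj₂ before) (inj₁ (sw-before c t))))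
        where
        fixed : ρ c (proj₁ at₁) ≡ bd t ∸ 1
        fixed = trans (cong (sw c) (proj₂ at₁)) (swap-unique (sw-spec d 1 c (bd t ∸ 1)) (stay λ t' e'' →
          (λ q → contra t' e'' (same-cut {t} {t'} (inj₁ refl) (inj₁ refl) q)) ,
          (λ q → contra t' e'' (same-cut {t} {t'} (inj₁ refl) (inj₂ refl) q))))
          where
          contra : ∀ t' → lookup c t' ≡ swsplit → t ≡ t' → ⊥
          contra t' e'' refl = contradiction (trans (sym e) e'') λ ()
      ... | inj₁ l = ⊥-elim (<-irrefl refl l)
      ... | inj₂ q = ⊥-elim (<-irrefl q (bd-1<bd t))
      go swsplit split e e' = ⊥-elim (<-irrefl refl (left⁻ split {proj₁ at₂} e' (proj₂ at₂)
        (proj₁ (within (proj₁ before) (proj₁ at₂) ρ-before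
                  (trans (cong (sw c) (proj₂ at₂)) (swap-unique (sw-spec d 1 c (bd t)) (down t e refl))))
           (left split {proj₁ before} e' (proj₂ before) (<-≤-trans (sw-before c t) (m∸n≤m (bd t) 1))))))

    -- A block with more than d letters would have the cut at `lo + d` strictly inside its interval,
    -- yet a full choice makes every cut.
    full-cover : ∀ {f} → Full f → Covers (prt (P f)) bot
    full-cover {f} fl = atom⇒cover (P-valid f) λ u →
      let open Interval (interval f u (k ∸ 1) ≤-refl) in
      ≤-trans (cnt-mono (λ m → let a , b = to (λ t _ → P⁻ {f} {f} (⊑ᵃ-refl f) (row⁻ m) t) in interval⁺ {ρ f} a b))
        (+-cancelˡ-≤ lo _ d (≤-trans (≤-reflexive (cnt-interval (ρ-rank f) lo hi (≤-trans lo≤ (<⇒≤ <hi)) hi≤n))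
          (≮⇒≥ λ gt → short u gt)))
      where
      short : ∀ u → let open Interval (interval f u (k ∸ 1) ≤-refl) in ¬ (lo + d < hi)
      short u gt = let open Interval (interval f u (k ∸ 1) ≤-refl)
                       t , e = bd-find {lo + d} (∣m∣n⇒∣m+n d∣lo ∣-refl) (≤-trans 0<d (m≤n+m d lo)) (<-≤-trans gt hi≤n)
                       lo<b = m<m+n lo 0<d
                       w , ew = Rank.surjective (ρ-rank f) {lo} (<-trans lo<b (<-≤-trans gt hi≤n))
                       w' , ew' = Rank.surjective (ρ-rank f) {lo + d} (<-≤-trans gt hi≤n)
                       s = from {w} (≤-reflexive (sym ew) , subst (_< hi) (sym ew) (<-trans lo<b gt)) t (Fₚ.toℕ<n t) (fl t)
                       s' = from {w'} (subst (lo ≤_) (sym ew') (m≤m+n lo d) , subst (_< hi) (sym ew') gt) t (Fₚ.toℕ<n t) (fl t)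
                   in <-irrefl (trans ew' (sym e)) (proj₁ s' (proj₂ s (subst₂ _<_ (sym ew) (sym e) lo<b)))

    -- Both partitions are read in the word switched by `f`; the letters on either side of the cut
    -- `t` in that word represent the two parts of the block being split.
    cut-cover : ∀ {c c⁺ f} t → c ⊑ᵃ f → c⁺ ⊑ᵃ f → (∀ t' → t' ≢ t → lookup c⁺ t' ≡ lookup c t') →
                lookup c t ≡ none → lookup c⁺ t ≢ none → Covers (prt (P c)) (prt (P c⁺))
    cut-cover {c} {c⁺} {f} t le le⁺ same e ne = merged⇒cover (P-valid c) (P-valid c⁺) (P-mono c⊑c⁺) yab ¬zab mg
      where
      b = bd t
      r = ρ f
      c⊑c⁺ : c ⊑ᵃ c⁺
      c⊑c⁺ t' ne' = same t' λ { refl → ne' e }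
      ux = Rank.surjective (ρ-rank f) {b ∸ 1} (≤-<-trans (m∸n≤m b 1) (bd<n t))
      vx = Rank.surjective (ρ-rank f) {b} (bd<n t)
      u₀ = proj₁ ux
      v₀ = proj₁ vx
      b-1<b : b ∸ 1 < b
      b-1<b = bd-1<bd t
      yab : P c ∋ u₀ ~ v₀
      yab = P⁺ {c} {f} le λ t' ne' → subst₂ (SameSide (bd t')) (sym (proj₂ ux)) (sym (proj₂ vx)) (straddle λ { refl → ne' e })
      ¬zab : ¬ (P c⁺ ∋ u₀ ~ v₀)
      ¬zab z = <-irrefl (proj₂ vx) (proj₁ (P⁻ {c⁺} {f} le⁺ z t ne) (subst (_< b) (sym (proj₂ ux)) b-1<b))
      side : ∀ {u v} → P c ∋ u ~ v → (∀ t' → t' ≢ t → lookup c⁺ t' ≢ none → SameSide (bd t') (r u) (r v))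
      side z t' t'≢ ne' = P⁻ {c} {f} le z t' λ q → ne' (trans (same t' t'≢) q)
      together : ∀ {u v} → (∀ t' → t' ≢ t → lookup c⁺ t' ≢ none → SameSide (bd t') (r u) (r v)) → SameSide b (r u) (r v) →
                 P c⁺ ∋ u ~ v
      together {u} {v} h s = P⁺ {c⁺} {f} le⁺ go
        where
        go : ∀ t' → lookup c⁺ t' ≢ none → SameSide (bd t') (r u) (r v)
        go t' ne' with t' Fₚ.≟ t
        ... | yes refl = s
        ... | no t'≢ = h t' t'≢ ne'
      toLeft : ∀ {u v} → P c ∋ u ~ v → r u < b → ¬ (r v < b) → P c⁺ ∋ u ~ u₀
      toLeft {u} {v} z l ¬l = together
        (λ t' t'≢ ne' → subst (SameSide (bd t') (r u)) (sym (proj₂ ux))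
          ((λ q → <-≤-trans b-1<b (≤-trans (≮⇒≥ ¬l) (<⇒≤ (proj₁ (side z t' t'≢ ne') q)))) ,
           (λ q → ≤-<-trans (ℕ.s≤s⁻¹ (≤-trans l (≤-reflexive (sym (m+[n∸m]≡n (<⇒≤ (1<bd t))))))) q)))
        (subst (SameSide b (r u)) (sym (proj₂ ux)) ((λ _ → b-1<b) , λ _ → l))
      toRight : ∀ {u v} → P c ∋ u ~ v → r u < b → ¬ (r v < b) → P c⁺ ∋ v ~ v₀
      toRight {u} {v} z l ¬l = together
        (λ t' t'≢ ne' → subst (SameSide (bd t') (r v)) (sym (proj₂ vx))
          ((λ q → ≤-<-trans (≮⇒≥ ¬l) q) ,
           (λ q → proj₁ (side z t' t'≢ ne') (<-trans l q))))
        (subst (SameSide b (r v)) (sym (proj₂ vx)) ((λ q → ⊥-elim (¬l q)) , λ q → ⊥-elim (<-irrefl refl q)))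
      mg : Merged (P c) (P c⁺) u₀ v₀
      mg {u} {v} z with r u ℕ.<? b | r v ℕ.<? b
      ... | yes l | yes l' = inj₁ (together (side z) ((λ _ → l') , λ _ → l))
      ... | no l  | no l'  = inj₁ (together (side z) ((λ q → ⊥-elim (l q)) , λ q → ⊥-elim (l' q)))
      ... | yes l | no l'  = inj₂ (inj₁ (toLeft z l l' , toRight z l l'))
      ... | no l  | yes l' = inj₂ (inj₂ (toRight z' l' l , toLeft z' l' l))
        where z' = ~sym (P-part c) z

  module Index (s : IdxA n d) where

    α : Vec (Fin n) n
    α = proj₁ s

    private
      α-rank : Rank (λ p → toℕ (lookup α p))
      α-rank = mkRank (λ p → Fₚ.toℕ<n _) λ e → proj₁ (proj₂ s) _ _ (Fₚ.toℕ-injective e)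

    inv : Fin n → Fin n
    inv u = proj₁ (Rank.surjective α-rank (Fₚ.toℕ<n u))

    α-inv : ∀ u → lookup α (inv u) ≡ u
    α-inv u = Fₚ.toℕ-injective (proj₂ (Rank.surjective α-rank (Fₚ.toℕ<n u)))

    pos : Fin n → ℕ
    pos u = toℕ (inv u)

    pos-α : ∀ p → pos (lookup α p) ≡ toℕ p
    pos-α p = cong toℕ (proj₁ (proj₂ s) _ _ (α-inv (lookup α p)))

    pos-rank : Rank pos
    pos-rank = mkRank (λ u → Fₚ.toℕ<n _) λ {u} {v} e →
      trans (sym (α-inv u)) (trans (cong (lookup α) (Fₚ.toℕ-injective e)) (α-inv v))

    open Word pos-rank public
    open WordCube pos-rank public

    Σ⁺ : ∀ c → SigmaElt n d k α (prt (P c))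
    Σ⁺ c = inj₂ (c , P c , refl , λ p q → trans (P-entry c _ _)
      (cong₂ (λ i j → not (sepAux d 1 c (sw c i) (sw c j))) (pos-α p) (pos-α q)))

    Σ⁻ : ∀ {R} → SigmaElt n d k α (prt R) → ∃ λ c → R ≡ P c
    Σ⁻ (inj₁ ())
    Σ⁻ {R} (inj₂ (c , .R , refl , h)) = c , mat-ext λ i j → begin
      entry R i j                                         ≡⟨ cong₂ (entry R) (sym (α-inv i)) (sym (α-inv j)) ⟩
      entry R (lookup α (inv i)) (lookup α (inv j))       ≡⟨ h (inv i) (inv j) ⟩
      not (sepAux d 1 c (sw c (pos i)) (sw c (pos j)))    ≡⟨ P-entry c i j ⟨
      entry (P c) i j                                     ∎
      where open ≡-Reasoning

    descent : ∀ {u v} → suc (pos u) ≡ pos v → d ∣ pos v → toℕ v < toℕ u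
    descent {u} {v} e dv = subst₂ (λ x y → toℕ x < toℕ y) (α-inv v) (α-inv u)
      (Equivalence.from (proj₂ (proj₂ (proj₂ s)) (inv u) (inv v) (sym e)) (subst (d ∣_) (sym e) dv))

-- The 0/1-cube and its faces over the rationals.

vertices : ∀ m → List (Vec Bool m)
vertices zero = [] ∷ []
vertices (suc m) = L.map (true ∷_) (vertices m) ++ L.map (false ∷_) (vertices m)

vertices-complete : ∀ {m} (v : Vec Bool m) → v ∈ vertices m
vertices-complete [] = here refl
vertices-complete (true ∷ v) = ∈-++⁺ˡ (∈-map⁺ (true ∷_) (vertices-complete v))
vertices-complete {suc m} (false ∷ v) =
  ∈-++⁺ʳ (L.map (true ∷_) (vertices m)) (∈-map⁺ (false ∷_) (vertices-complete v))

coordinate : Bool → ℚ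
coordinate true = ℚ.1ℚ
coordinate false = ℚ.0ℚ

vertexAct : Bool → Act
vertexAct true = split
vertexAct false = swsplit

-- A functional is maximal on the cube where coordinates with positive coefficient are 1 and those
-- with negative coefficient are 0; a zero coefficient leaves the coordinate, hence the cut, free.
signAct : ℚ → Act
signAct a with ℚₚ.<-cmp a ℚ.0ℚ
... | tri< _ _ _ = swsplit
... | tri≈ _ _ _ = none
... | tri> _ _ _ = split

-- The face of the 0/1-cube on which a linear functional a is maximal.
module Functional (n d k : ℕ) where

  open PiNd n d k using (dot)

  -- The maximum of the functional over the cube: each coordinate contributes the positive part of
  -- its coefficient.
  maxValue : ∀ {m} → Vec ℚ m → ℚ
  maxValue [] = ℚ.0ℚ
  maxValue (a ∷ as) = (a ℚ.⊔ ℚ.0ℚ) ℚ.+ maxValue as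

  OnFace : ∀ {m} → Vec ℚ m → Vec Bool m → Set
  OnFace as v = ∀ t → lookup (Data.Vec.map signAct as) t ≢ none →
                vertexAct (lookup v t) ≡ lookup (Data.Vec.map signAct as) t

  value≤ : ∀ a b → a ℚ.* coordinate b ℚ.≤ a ℚ.⊔ ℚ.0ℚ
  value≤ a true = subst (ℚ._≤ a ℚ.⊔ ℚ.0ℚ) (sym (ℚₚ.*-identityʳ a)) (ℚₚ.p≤p⊔q a ℚ.0ℚ)
  value≤ a false = subst (ℚ._≤ a ℚ.⊔ ℚ.0ℚ) (sym (ℚₚ.*-zeroʳ a)) (ℚₚ.p≤q⊔p a ℚ.0ℚ)

  value≡⁻ : ∀ a b → a ℚ.* coordinate b ≡ a ℚ.⊔ ℚ.0ℚ → signAct a ≢ none → vertexAct b ≡ signAct a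
  value≡⁻ a b e ne with ℚₚ.<-cmp a ℚ.0ℚ
  value≡⁻ a false e ne | tri< _ _ _ = refl
  value≡⁻ a true  e ne | tri< l _ _ =
    ⊥-elim (ℚₚ.<-irrefl (trans (sym (ℚₚ.*-identityʳ a)) (trans e (ℚₚ.p≤q⇒p⊔q≡q (ℚₚ.<⇒≤ l)))) l)
  value≡⁻ a b     e ne | tri≈ _ _ _ = ⊥-elim (ne refl)
  value≡⁻ a true  e ne | tri> _ _ _ = refl
  value≡⁻ a false e ne | tri> _ _ l =
    ⊥-elim (ℚₚ.<-irrefl (trans (sym (ℚₚ.*-zeroʳ a)) (trans e (ℚₚ.p≥q⇒p⊔q≡p (ℚₚ.<⇒≤ l)))) l)

  value≡⁺ : ∀ a b → (signAct a ≢ none → vertexAct b ≡ signAct a) → a ℚ.* coordinate b ≡ a ℚ.⊔ ℚ.0ℚ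
  value≡⁺ a b h with ℚₚ.<-cmp a ℚ.0ℚ
  value≡⁺ a false h | tri< l _ _ = trans (ℚₚ.*-zeroʳ a) (sym (ℚₚ.p≤q⇒p⊔q≡q (ℚₚ.<⇒≤ l)))
  value≡⁺ a true  h | tri< _ _ _ = contradiction (h λ ()) λ ()
  value≡⁺ a true  h | tri≈ _ refl _ = refl
  value≡⁺ a false h | tri≈ _ refl _ = refl
  value≡⁺ a true  h | tri> _ _ l = trans (ℚₚ.*-identityʳ a) (sym (ℚₚ.p≥q⇒p⊔q≡p (ℚₚ.<⇒≤ l)))
  value≡⁺ a false h | tri> _ _ _ = contradiction (h λ ()) λ ()

  dot≤ : ∀ {m} (as : Vec ℚ m) v → dot as (Data.Vec.map coordinate v) ℚ.≤ maxValue as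
  dot≤ [] [] = ℚₚ.≤-refl
  dot≤ (a ∷ as) (b ∷ v) = ℚₚ.+-mono-≤ (value≤ a b) (dot≤ as v)

  dot≡⁺ : ∀ {m} (as : Vec ℚ m) v → OnFace as v → dot as (Data.Vec.map coordinate v) ≡ maxValue as
  dot≡⁺ [] [] h = refl
  dot≡⁺ (a ∷ as) (b ∷ v) h = cong₂ ℚ._+_ (value≡⁺ a b (h F.zero)) (dot≡⁺ as v (h ∘ F.suc))

  ≤∧≢⇒<ℚ : ∀ {p q} → p ℚ.≤ q → p ≢ q → p ℚ.< q
  ≤∧≢⇒<ℚ {p} {q} le ne with ℚₚ.<-cmp p q
  ... | tri< l _ _ = l
  ... | tri≈ _ e _ = ⊥-elim (ne e)
  ... | tri> _ _ g = ⊥-elim (ℚₚ.<-irrefl refl (ℚₚ.<-≤-trans g le))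

  sum-tight : ∀ {p q r s} → p ℚ.≤ r → q ℚ.≤ s → p ℚ.+ q ≡ r ℚ.+ s → p ≡ r × q ≡ s
  sum-tight {p} {q} {r} {s} pr qs e with p ℚₚ.≟ r | q ℚₚ.≟ s
  ... | yes a | yes b = a , b
  ... | no ¬a | _ = ⊥-elim (ℚₚ.<-irrefl e (ℚₚ.+-mono-<-≤ (≤∧≢⇒<ℚ pr ¬a) qs))
  ... | yes _ | no ¬b = ⊥-elim (ℚₚ.<-irrefl e (ℚₚ.+-mono-≤-< pr (≤∧≢⇒<ℚ qs ¬b)))

  dot≡⁻ : ∀ {m} (as : Vec ℚ m) v → dot as (Data.Vec.map coordinate v) ≡ maxValue as → OnFace as v
  dot≡⁻ [] [] e ()
  dot≡⁻ (a ∷ as) (b ∷ v) e F.zero = value≡⁻ a b (proj₁ (sum-tight (value≤ a b) (dot≤ as v) e))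
  dot≡⁻ (a ∷ as) (b ∷ v) e (F.suc t) = dot≡⁻ as v (proj₂ (sum-tight (value≤ a b) (dot≤ as v) e)) t

  best : ∀ {m} → Vec ℚ m → Vec Bool m
  best = Data.Vec.map λ a → does (ℚ.0ℚ ℚₚ.<? a)

  best-OnFace : ∀ {m} (as : Vec ℚ m) → OnFace as (best as)
  best-OnFace (a ∷ as) F.zero ne with ℚₚ.<-cmp a ℚ.0ℚ
  ... | tri< _ _ ¬l rewrite dec-false (ℚ.0ℚ ℚₚ.<? a) ¬l = refl
  ... | tri≈ _ _ _ = ⊥-elim (ne refl)
  ... | tri> _ _ l rewrite dec-true (ℚ.0ℚ ℚₚ.<? a) l = refl
  best-OnFace (a ∷ as) (F.suc t) = best-OnFace as t

  functional : Act → ℚ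
  functional none = ℚ.0ℚ
  functional split = ℚ.1ℚ
  functional swsplit = ℚ.- ℚ.1ℚ

  sign-functional : ∀ {m} (c : Vec Act m) t → lookup (Data.Vec.map signAct (Data.Vec.map functional c)) t ≡ lookup c t
  sign-functional (none ∷ c) F.zero = refl
  sign-functional (split ∷ c) F.zero = refl
  sign-functional (swsplit ∷ c) F.zero = refl
  sign-functional (a ∷ c) (F.suc t) = sign-functional c t

-- Each subposet is the face lattice of a cube.

module Polytope (n d k : ℕ) (1<d : 1 < d) (n≡ : n ≡ k * d) where

  open Poset n d k 1<d n≡
  open Cuts n d k 1<d n≡
  open Cube n d k 1<d n≡
  open Functional n d k

  module _ (s : IdxA n d) where

    open Index s

    private
      Vertex = Vec Bool (k ∸ 1)

      vs : List Vertex
      vs = vertices (k ∸ 1)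

      coords : Vertex → Vec ℚ (k ∸ 1)
      coords = Data.Vec.map coordinate

      full : Vertex → Acts
      full = Data.Vec.map vertexAct

    below? : ∀ R (x : Pt n) → Dec (prt R ≼ x)
    below? R bot = no λ ()
    below? R (prt S) = Fₚ.all? λ i → Fₚ.all? λ j → (entry R i j 𝔹.≟ true) →-dec (entry S i j 𝔹.≟ true)

    flag : Pt n → Vertex → Bool
    flag x v = does (below? (P (full v)) x)

    flags : Pt n → List Bool
    flags x = L.map (flag x) vs

    face⁺ : ∀ {a b} {g : Vertex → Bool} vs → (∀ v → dot a (coords v) ℚ.≤ b × (g v ≡ true ⇔ dot a (coords v) ≡ b)) →
            FaceOf a b (L.map coords vs) (L.map g vs)
    face⁺ [] h = tt
    face⁺ (v ∷ vs) h = proj₁ (h v) , proj₂ (h v) , face⁺ vs h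

    face⁻ : ∀ {a b} vs S → FaceOf a b (L.map coords vs) S →
            S ≡ L.map (λ v → does (dot a (coords v) ℚₚ.≟ b)) vs × (∀ {v} → v ∈ vs → dot a (coords v) ℚ.≤ b)
    face⁻ [] [] _ = refl , λ ()
    face⁻ {a} {b} (v ∷ vs) (s ∷ S) (le , eqv , h) =
      cong₂ _∷_ (bool-⇔ (λ e → dec-true (dot a (coords v) ℚₚ.≟ b) (Equivalence.to eqv e))
                        (λ e → Equivalence.from eqv (does⇒ (dot a (coords v) ℚₚ.≟ b) e)))
            (proj₁ (face⁻ vs S h)) ,
      λ { (here refl) → le ; (there i) → proj₂ (face⁻ vs S h) i }

    subFlags⁺ : ∀ {g h : Vertex → Bool} vs → (∀ v → g v ≡ true → h v ≡ true) → SubFlags (L.map g vs) (L.map h vs)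
    subFlags⁺ [] i = tt
    subFlags⁺ (v ∷ vs) i = i v , subFlags⁺ vs i

    subFlags⁻ : ∀ {g h : Vertex → Bool} vs → SubFlags (L.map g vs) (L.map h vs) → ∀ {v} → v ∈ vs → g v ≡ true → h v ≡ true
    subFlags⁻ (v ∷ vs) (i , _) (here refl) = i
    subFlags⁻ (v ∷ vs) (_ , i) (there m) = subFlags⁻ vs i m

    flag⁻ : ∀ {c v} → flag (prt (P c)) v ≡ true → c ⊑ᵃ full v
    flag⁻ {c} {v} e = P-reflects (≼⇒⊑ (P (full v)) (P c) (does⇒ (below? (P (full v)) (prt (P c))) e))

    flag⁺ : ∀ {c v} → c ⊑ᵃ full v → flag (prt (P c)) v ≡ true
    flag⁺ {c} {v} le = dec-true (below? (P (full v)) (prt (P c))) (⊑⇒≼ (P-mono le))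

    OnFace⇒⊑ : ∀ {as c v} → (∀ t → lookup (Data.Vec.map signAct as) t ≡ lookup c t) → OnFace as v → c ⊑ᵃ full v
    OnFace⇒⊑ {v = v} h o t ne = trans (Vₚ.lookup-map t vertexAct v) (trans (o t λ e → ne (trans (sym (h t)) e)) (h t))

    ⊑⇒OnFace : ∀ {as c v} → (∀ t → lookup (Data.Vec.map signAct as) t ≡ lookup c t) → c ⊑ᵃ full v → OnFace as v
    ⊑⇒OnFace {v = v} h o t ne = trans (sym (Vₚ.lookup-map t vertexAct v)) (trans (o t λ e → ne (trans (h t) e)) (sym (h t)))

    dot-zero : ∀ {m} (v : Vec Bool m) → dot (Data.Vec.replicate m ℚ.0ℚ) (Data.Vec.map coordinate v) ≡ ℚ.0ℚ
    dot-zero [] = refl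
    dot-zero (b ∷ v) = cong₂ ℚ._+_ (ℚₚ.*-zeroˡ (coordinate b)) (dot-zero v)

    isFace : ∀ x → SigmaElt n d k α x → IsFace (L.map coords vs) (flags x)
    -- The zero functional with bound 1 cuts out the empty face.
    isFace bot _ = Data.Vec.replicate _ ℚ.0ℚ , ℚ.1ℚ , face⁺ vs λ v →
      subst (ℚ._≤ ℚ.1ℚ) (sym (dot-zero v)) (ℚₚ.nonNegative⁻¹ ℚ.1ℚ) ,
      mk⇔ (λ ()) (λ e → contradiction (trans (sym (dot-zero v)) e) λ ())
    isFace (prt R) σ with Σ⁻ σ
    ... | c , refl = as , maxValue as , face⁺ vs λ v → dot≤ as v ,
        mk⇔ (λ e → dot≡⁺ as v (⊑⇒OnFace {as} {c} {v} (sign-functional c) (flag⁻ {c} {v} e)))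
            (λ e → flag⁺ {c} {v} (OnFace⇒⊑ {as} {c} {v} (sign-functional c) (dot≡⁻ as v e)))
      where as = Data.Vec.map functional c

    fromFace : ∀ S → IsFace (L.map coords vs) S → Σ (Pt n) λ x → SigmaElt n d k α x × flags x ≡ S
    fromFace S (as , b , h) with face⁻ vs S h | maxValue as ℚₚ.≟ b
    ... | S≡ , le | yes refl = prt (P c) , Σ⁺ c , trans (map-cong (λ v → bool-⇔
            (λ e → dec-true (dot as (coords v) ℚₚ.≟ maxValue as) (dot≡⁺ as v (⊑⇒OnFace {as} {c} {v} (λ _ → refl) (flag⁻ {c} {v} e))))
            (λ e → flag⁺ {c} {v} (OnFace⇒⊑ {as} {c} {v} (λ _ → refl) (dot≡⁻ as v (does⇒ (dot as (coords v) ℚₚ.≟ maxValue as) e))))) vs)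
          (sym S≡)
      where c = Data.Vec.map signAct as
    -- The bound is above the maximum of the functional, so no vertex attains it and the face is
    -- empty.
    ... | S≡ , le | no ne = bot , inj₁ refl , trans (map-cong (λ v → sym (dec-false (dot as (coords v) ℚₚ.≟ b) (ne' v))) vs) (sym S≡)
      where
      max≤ : maxValue as ℚ.≤ b
      max≤ = subst (ℚ._≤ b) (dot≡⁺ as (best as) (best-OnFace as)) (le (vertices-complete (best as)))
      ne' : ∀ v → dot as (coords v) ≢ b
      ne' v e = ne (ℚₚ.≤-antisym max≤ (subst (ℚ._≤ maxValue as) e (dot≤ as v)))

    -- With `true` and `false` this gives two opposite vertices of the face of a choice. At a free
    -- cut they differ, so a larger face containing both is free there too; this recovers the order
    -- from vertex sets.
    fill : Bool → Act → Bool
    fill b none = b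
    fill b split = true
    fill b swsplit = false

    ⊑-fill : ∀ b c → c ⊑ᵃ full (Data.Vec.map (fill b) c)
    ⊑-fill b c t ne = trans (Vₚ.lookup-map t vertexAct (Data.Vec.map (fill b) c))
                            (trans (cong vertexAct (Vₚ.lookup-map t (fill b) c)) (go (lookup c t) ne))
      where
      go : ∀ a → a ≢ none → vertexAct (fill b a) ≡ a
      go none ne = ⊥-elim (ne refl)
      go split _ = refl
      go swsplit _ = refl

    order⁻ : ∀ x y → SigmaElt n d k α x → SigmaElt n d k α y → SubFlags (flags x) (flags y) → x ≼ y
    order⁻ bot y _ _ _ = tt
    order⁻ (prt R) y σ τ sf with Σ⁻ σ
    order⁻ (prt R) bot σ τ sf | c , refl = contradiction
      (subFlags⁻ vs sf (vertices-complete (Data.Vec.map (fill true) c)) (flag⁺ {c} (⊑-fill true c))) λ ()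
    order⁻ (prt R) (prt S) σ τ sf | c , refl with Σ⁻ τ
    ... | c' , refl = ⊑⇒≼ (P-mono λ t ne → go t (lookup c t) refl (under true t ne) (under false t ne))
      where
      under : ∀ b → c' ⊑ᵃ full (Data.Vec.map (fill b) c)
      under b = flag⁻ {c'} {Data.Vec.map (fill b) c}
        (subFlags⁻ vs sf (vertices-complete (Data.Vec.map (fill b) c)) (flag⁺ {c} (⊑-fill b c)))
      val : ∀ b t → lookup (full (Data.Vec.map (fill b) c)) t ≡ vertexAct (fill b (lookup c t))
      val b t = trans (Vₚ.lookup-map t vertexAct (Data.Vec.map (fill b) c)) (cong vertexAct (Vₚ.lookup-map t (fill b) c))
      go : ∀ t a → lookup c t ≡ a → lookup (full (Data.Vec.map (fill true) c)) t ≡ lookup c' t →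
           lookup (full (Data.Vec.map (fill false) c)) t ≡ lookup c' t → lookup c t ≡ lookup c' t
      go t none e p q = contradiction
        (trans (sym (trans (val true t) (cong (vertexAct ∘ fill true) e)))
          (trans p (trans (sym q) (trans (val false t) (cong (vertexAct ∘ fill false) e))))) λ ()
      go t split e p q = trans e (trans (sym (trans (val true t) (cong (vertexAct ∘ fill true) e))) p)
      go t swsplit e p q = trans e (trans (sym (trans (val true t) (cong (vertexAct ∘ fill true) e))) p)

    isPolytope : IsPolytopeLattice (SigmaElt n d k α)
    isPolytope = k ∸ 1 , L.map coords vs , flags , isFace , fromFace , λ x y σ τ → mk⇔
      (λ le → subFlags⁺ vs λ v e → dec-true (below? (P (full v)) y)
                (≼-trans (prt (P (full v))) x y (does⇒ (below? (P (full v)) x) e) le))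
      (order⁻ x y σ τ)

-- Lexicographic comparison of tuples of keys

module _ {m : ℕ} where

  Lt : List (Fin m → ℕ) → Fin m → Fin m → Set
  Lt [] u v = ⊥
  Lt (g ∷ gs) u v = (g u < g v) ⊎ ((g u ≡ g v) × Lt gs u v)

  Lt? : ∀ gs u v → Dec (Lt gs u v)
  Lt? [] u v = no id
  Lt? (g ∷ gs) u v = (g u ℕ.<? g v) ⊎-dec ((g u ≟ g v) ×-dec Lt? gs u v)

  Lt-irrefl : ∀ gs {u} → ¬ Lt gs u u
  Lt-irrefl (g ∷ gs) (inj₁ l) = <-irrefl refl l
  Lt-irrefl (g ∷ gs) (inj₂ (_ , l)) = Lt-irrefl gs l

  Lt-trans : ∀ gs {u v w} → Lt gs u v → Lt gs v w → Lt gs u w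
  Lt-trans (g ∷ gs) (inj₁ l) (inj₁ l') = inj₁ (<-trans l l')
  Lt-trans (g ∷ gs) (inj₁ l) (inj₂ (e , _)) = inj₁ (<-≤-trans l (≤-reflexive e))
  Lt-trans (g ∷ gs) (inj₂ (e , _)) (inj₁ l) = inj₁ (≤-<-trans (≤-reflexive e) l)
  Lt-trans (g ∷ gs) (inj₂ (e , l)) (inj₂ (e' , l')) = inj₂ (trans e e' , Lt-trans gs l l')

  Lt-total : ∀ gs {u v} → (∃ λ g → g ∈ gs × g u ≢ g v) → Lt gs u v ⊎ Lt gs v u
  Lt-total [] (_ , () , _)
  Lt-total (g ∷ gs) {u} {v} (h , i , ne) with <-cmp (g u) (g v)
  ... | tri< l _ _ = inj₁ (inj₁ l)
  ... | tri> _ _ l = inj₂ (inj₁ l)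
  ... | tri≈ _ e _ with i
  ...   | here refl = ⊥-elim (ne e)
  ...   | there i' = [ (λ l → inj₁ (inj₂ (e , l))) , (λ l → inj₂ (inj₂ (sym e , l))) ]′ (Lt-total gs (h , i' , ne))

  Lt-lex : ∀ gs {u v} → (∀ {g} → g ∈ gs → g u ≤ g v) → (∃ λ g → g ∈ gs × g u < g v) → Lt gs u v
  Lt-lex (g ∷ gs) {u} {v} le (h , i , l) with m≤n⇒m<n∨m≡n (le (here refl))
  ... | inj₁ l' = inj₁ l'
  ... | inj₂ e with i
  ...   | here refl = ⊥-elim (<-irrefl e l)
  ...   | there i' = inj₂ (e , Lt-lex gs (le ∘ there) (h , i' , l))

  Lt-witness : ∀ gs {u v} → Lt gs u v → ∃ λ g → g ∈ gs × g u < g v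
  Lt-witness (g ∷ gs) (inj₁ l) = g , here refl , l
  Lt-witness (g ∷ gs) (inj₂ (_ , l)) = let h , i , l' = Lt-witness gs l in h , there i , l'

module OrderRank {m : ℕ} (gs : List (Fin m → ℕ))
                 (separate : ∀ {u v} → u ≢ v → ∃ λ g → g ∈ gs × g u ≢ g v) where

  private
    lower : Fin m → Sub m
    lower u = ⟦ (λ v → Lt? gs v u) ⟧

  rank : Fin m → ℕ
  rank u = cnt (lower u)

  rank-mono : ∀ {u v} → Lt gs u v → rank u < rank v
  rank-mono {u} {v} l = cnt-< {S = lower u} {T = lower v}
    (λ {i} i∊ → ⟦⟧⁺ (λ w → Lt? gs w v) (Lt-trans gs (⟦⟧⁻ (λ w → Lt? gs w u) i∊) l))
    (⟦⟧⁺ (λ w → Lt? gs w v) l) (λ u∊ → Lt-irrefl gs (⟦⟧⁻ (λ w → Lt? gs w u) u∊))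

  rank-reflects : ∀ {u v} → rank u < rank v → Lt gs u v
  rank-reflects {u} {v} l with u Fₚ.≟ v
  ... | yes refl = ⊥-elim (<-irrefl refl l)
  ... | no ne with Lt-total gs (separate ne)
  ...   | inj₁ x = x
  ...   | inj₂ y = ⊥-elim (<-asym l (rank-mono y))

  isRank : Rank rank
  isRank = mkRank
    (λ u → <-≤-trans (cnt-< {S = lower u} {T = λ _ → true} (λ _ → mem refl) {u} (mem refl)
                        (λ u∊ → Lt-irrefl gs (⟦⟧⁻ (λ w → Lt? gs w u) u∊)))
                     (cnt≤ (λ _ → true)))
    inj
    where
    inj : ∀ {u v} → rank u ≡ rank v → u ≡ v
    inj {u} {v} e with u Fₚ.≟ v
    ... | yes eq = eq
    ... | no ne with Lt-total gs (separate ne)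
    ...   | inj₁ l = ⊥-elim (<-irrefl e (rank-mono l))
    ...   | inj₂ l = ⊥-elim (<-irrefl (sym e) (rank-mono l))

-- Keys of letters along a chain, and words sorted by them.

module Keys (n d k : ℕ) (1<d : 1 < d) (n≡ : n ≡ k * d) where

  open Poset n d k 1<d n≡
  open Cuts n d k 1<d n≡
  open Cube n d k 1<d n≡

  data Nested : List (Mat n) → Set where
    []  : Nested []
    _∷_ : ∀ {R Rs} → All (λ S → prt S ≼ prt R) Rs → Nested Rs → Nested (R ∷ Rs)

  nested-comparable : ∀ {Rs R S} → Nested Rs → R ∈ Rs → S ∈ Rs → (prt R ≼ prt S) ⊎ (prt S ≼ prt R)
  nested-comparable {R ∷ _} (a ∷ ns) (here refl) (here refl) = inj₁ (≼-refl (prt R))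
  nested-comparable (a ∷ ns) (here refl) (there j) = inj₂ (All.lookup a j)
  nested-comparable (a ∷ ns) (there i) (here refl) = inj₁ (All.lookup a i)
  nested-comparable (a ∷ ns) (there i) (there j) = nested-comparable ns i j

  lowest : ∀ {R Rs} → Nested (R ∷ Rs) → ∃ λ z → z ∈ (R ∷ Rs) × (∀ {S} → S ∈ (R ∷ Rs) → prt z ≼ prt S)
  lowest {R} (_ ∷ []) = R , here refl , λ { (here refl) → ≼-refl (prt R) }
  lowest (a ∷ ns@(_ ∷ _)) = let z , i , h = lowest ns in
    z , there i , λ { (here refl) → All.lookup a i ; (there j) → h j }

  maxKey : Mat n → Fin n → ℕ
  maxKey R u = toℕ (mx R u)

  -- Stated for arbitrary keys because it is used twice: for letters, with block maxima and the
  -- value as tie-breaker, and for cuts, in the order in which (bdry) makes them.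
  lexKeys : ∀ {m} → (Mat n → Fin m → ℕ) → (Fin m → ℕ) → List (Mat n) → List (Fin m → ℕ)
  lexKeys key tie [] = tie ∷ []
  lexKeys key tie (R ∷ Rs) = key R ∷ lexKeys key tie Rs

  tie∈ : ∀ {m} {key : Mat n → Fin m → ℕ} {tie} Rs → tie ∈ lexKeys key tie Rs
  tie∈ [] = here refl
  tie∈ (_ ∷ Rs) = there (tie∈ Rs)

  -- Lexicographic comparison for a nested list: the coarsest member that distinguishes `u` and `v`
  -- decides, and all others that do so lie below it.
  First : ∀ {m} → (Mat n → Fin m → ℕ) → (Fin m → ℕ) → List (Mat n) → Fin m → Fin m → Set
  First key tie Rs u v =
    (∃ λ R → R ∈ Rs × key R u < key R v × (∀ {S} → S ∈ Rs → key S u ≢ key S v → prt S ≼ prt R))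
    ⊎ ((∀ {S} → S ∈ Rs → key S u ≡ key S v) × tie u < tie v)

  lex-first : ∀ {m} (key : Mat n → Fin m → ℕ) (tie : Fin m → ℕ) {Rs u v} → Nested Rs → Lt (lexKeys key tie Rs) u v →
              First key tie Rs u v
  lex-first key tie {[]} _ (inj₁ l) = inj₂ ((λ ()) , l)
  lex-first key tie {[]} _ (inj₂ ())
  lex-first key tie {R ∷ _} (a ∷ ns) (inj₁ l) =
    inj₁ (R , here refl , l , λ { (here refl) _ → ≼-refl (prt R) ; (there i) _ → All.lookup a i })
  lex-first key tie {R ∷ _} (a ∷ ns) (inj₂ (e , l)) with lex-first key tie ns l
  ... | inj₁ (S , i , l' , h) = inj₁ (S , there i , l' , λ { (here refl) ne → ⊥-elim (ne e) ; (there j) → h j })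
  ... | inj₂ (h , l') = inj₂ ((λ { (here refl) → e ; (there j) → h j }) , l')

  keys : List (Mat n) → List (Fin n → ℕ)
  keys = lexKeys maxKey toℕ

  toℕ∈keys : ∀ Rs → toℕ ∈ keys Rs
  toℕ∈keys = tie∈

  keys⁻ : ∀ Rs {g} → g ∈ keys Rs → (g ≡ toℕ) ⊎ (∃ λ R → R ∈ Rs × g ≡ maxKey R)
  keys⁻ [] (here refl) = inj₁ refl
  keys⁻ (R ∷ Rs) (here refl) = inj₂ (R , here refl , refl)
  keys⁻ (R ∷ Rs) (there i) with keys⁻ Rs i
  ... | inj₁ e = inj₁ e
  ... | inj₂ (S , j , e) = inj₂ (S , there j , e)

  Convex : (Fin n → ℕ) → Mat n → Set
  Convex ρ R = ∀ {u v w} → ρ u < ρ v → ρ v < ρ w → R ∋ u ~ w → R ∋ u ~ v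

  Aligned : (Fin n → ℕ) → Mat n → Set
  Aligned ρ R = ∀ {u v} → ρ v ≡ suc (ρ u) → ¬ (d ∣ ρ v) → R ∋ u ~ v

  -- pos is obtained from ρ by making every cut pair a descent.
  record Frame (ρ pos : Fin n → ℕ) : Set where
    field
      rankᶠ : Rank ρ
      fixed : ∀ {u} → (∀ t → ¬ Near (bd t) (ρ u)) → pos u ≡ ρ u
      swapped : ∀ t {u v} → ρ u ≡ bd t ∸ 1 → ρ v ≡ bd t → toℕ u < toℕ v → pos u ≡ bd t × pos v ≡ bd t ∸ 1
      kept : ∀ t {u v} → ρ u ≡ bd t ∸ 1 → ρ v ≡ bd t → toℕ v < toℕ u → pos u ≡ bd t ∸ 1 × pos v ≡ bd t

  near? : ∀ p → Dec (∃ λ t → Near (bd t) p)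
  near? p = Fₚ.any? λ t → (p ≟ bd t ∸ 1) ⊎-dec (p ≟ bd t)

  bd-1<n : ∀ t → bd t ∸ 1 < n
  bd-1<n t = ≤-<-trans (m∸n≤m (bd t) 1) (bd<n t)

  suc-bd-1 : ∀ t → suc (bd t ∸ 1) ≡ bd t
  suc-bd-1 t = m+[n∸m]≡n (<⇒≤ (1<bd t))

  module _ {ρ : Fin n → ℕ} (rk : Rank ρ) where

    leftLetter : ∀ t → ∃ λ u → ρ u ≡ bd t ∸ 1
    leftLetter t = Rank.surjective rk (bd-1<n t)

    rightLetter : ∀ t → ∃ λ u → ρ u ≡ bd t
    rightLetter t = Rank.surjective rk (bd<n t)

    pair-≢ : ∀ t {u v} → ρ u ≡ bd t ∸ 1 → ρ v ≡ bd t → u ≢ v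
    pair-≢ t e e' refl = <-irrefl (trans (sym e) e') (bd-1<bd t)

  letters-cmp : ∀ {u v : Fin n} → u ≢ v → (toℕ u < toℕ v) ⊎ (toℕ v < toℕ u)
  letters-cmp {u} {v} ne with <-cmp (toℕ u) (toℕ v)
  ... | tri< l _ _ = inj₁ l
  ... | tri≈ _ e _ = ⊥-elim (ne (Fₚ.toℕ-injective e))
  ... | tri> _ _ l = inj₂ l

  module _ (s : IdxA n d) where
    open Index s

    -- The original word has a descent at every cut. Hence a pair that ascends after switching has
    -- been switched, and one that descends has not, so `pos` can be recovered from the switched
    -- word.
    acts-frame : ∀ {f} → Full f → Frame (ρ f) pos
    acts-frame {f} fl = record
      { rankᶠ = ρ-rank f
      ; fixed = λ {u} h → nofix (sw-spec d 1 f (pos u)) h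
      ; swapped = λ t {u} {v} e e' l → go t (lookup f t) refl e e' l
      ; kept = λ t {u} {v} e e' l → go' t (lookup f t) refl e e' l }
      where
      nofix : ∀ {p q} → Swap f p q → (∀ t → ¬ Near (bd t) q) → p ≡ q
      nofix (stay _) _ = refl
      nofix (up t _ _) h = ⊥-elim (h t (inj₂ refl))
      nofix (down t _ _) h = ⊥-elim (h t (inj₁ refl))
      back : ∀ {u q} → ρ f u ≡ q → pos u ≡ sw f q
      back {u} e = trans (sym (sw-invol f (pos u))) (cong (sw f) e)
      swL : ∀ t → lookup f t ≡ swsplit → sw f (bd t ∸ 1) ≡ bd t
      swL t e = swap-unique (sw-spec d 1 f (bd t ∸ 1)) (up t e refl)
      swR : ∀ t → lookup f t ≡ swsplit → sw f (bd t) ≡ bd t ∸ 1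
      swR t e = swap-unique (sw-spec d 1 f (bd t)) (down t e refl)
      stayAt : ∀ t {p} → lookup f t ≡ split → Near (bd t) p → sw f p ≡ p
      stayAt t {p} e np = swap-unique (sw-spec d 1 f p) (stay λ t' e' → (λ q → unswitched t' e' (inj₁ q)) , λ q → unswitched t' e' (inj₂ q))
        where
        unswitched : ∀ t' → lookup f t' ≡ swsplit → ¬ Near (bd t') p
        unswitched t' e' np' with same-cut {t} {t'} np np' refl
        ... | refl = contradiction (trans (sym e) e') λ ()
      go : ∀ t a {u v} → lookup f t ≡ a → ρ f u ≡ bd t ∸ 1 → ρ f v ≡ bd t → toℕ u < toℕ v → pos u ≡ bd t × pos v ≡ bd t ∸ 1
      go t none e _ _ _ = ⊥-elim (fl t e)
      go t swsplit e p q _ = trans (back p) (swL t e) , trans (back q) (swR t e)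
      go t split e p q l = ⊥-elim (<-asym l (descent
        (trans (cong suc (trans (back p) (stayAt t e (inj₁ refl)))) (trans (suc-bd-1 t) (sym vq))) (subst (d ∣_) (sym vq) (d∣bd t))))
        where vq = trans (back q) (stayAt t e (inj₂ refl))
      go' : ∀ t a {u v} → lookup f t ≡ a → ρ f u ≡ bd t ∸ 1 → ρ f v ≡ bd t → toℕ v < toℕ u → pos u ≡ bd t ∸ 1 × pos v ≡ bd t
      go' t none e _ _ _ = ⊥-elim (fl t e)
      go' t split e p q _ = trans (back p) (stayAt t e (inj₁ refl)) , trans (back q) (stayAt t e (inj₂ refl))
      go' t swsplit e p q l = ⊥-elim (<-asym l (descent
        (trans (cong suc (trans (back q) (swR t e))) (trans (suc-bd-1 t) (sym up'))) (subst (d ∣_) (sym up') (d∣bd t))))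
        where up' = trans (back p) (swL t e)

  frame-unique : ∀ {ρ pos pos'} → Frame ρ pos → Frame ρ pos' → ∀ u → pos u ≡ pos' u
  frame-unique {ρ} F G u with near? (ρ u)
  ... | no ¬nr = trans (Frame.fixed F λ t nr → ¬nr (t , nr)) (sym (Frame.fixed G λ t nr → ¬nr (t , nr)))
  ... | yes (t , inj₁ e) = let v , e' = rightLetter (Frame.rankᶠ F) t in
        [ (λ l → trans (proj₁ (Frame.swapped F t e e' l)) (sym (proj₁ (Frame.swapped G t e e' l))))
        , (λ l → trans (proj₁ (Frame.kept F t e e' l)) (sym (proj₁ (Frame.kept G t e e' l)))) ]′
        (letters-cmp (pair-≢ (Frame.rankᶠ F) t e e'))
  ... | yes (t , inj₂ e') = let v , e = leftLetter (Frame.rankᶠ F) t in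
        [ (λ l → trans (proj₂ (Frame.swapped F t e e' l)) (sym (proj₂ (Frame.swapped G t e e' l))))
        , (λ l → trans (proj₂ (Frame.kept F t e e' l)) (sym (proj₂ (Frame.kept G t e e' l)))) ]′
        (letters-cmp (pair-≢ (Frame.rankᶠ F) t e e'))

  module KeyOrder {Rs : List (Mat n)} (nested : Nested Rs) (valid : ∀ {R} → R ∈ Rs → Valid (prt R)) where

    private
      pt : ∀ {R} → R ∈ Rs → Part R
      pt {R} i = validPart R (valid i)

    Sorted : (Fin n → ℕ) → Set
    Sorted ρ = ∀ {u v} → ρ u < ρ v → Lt (keys Rs) u v

    key-lex : ∀ {u v} → (∀ {R} → R ∈ Rs → maxKey R u ≤ maxKey R v) → toℕ u < toℕ v → Lt (keys Rs) u v
    key-lex {u} {v} h l = Lt-lex (keys Rs) le (toℕ , toℕ∈keys Rs , l)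
      where
      le : ∀ {g} → g ∈ keys Rs → g u ≤ g v
      le i with keys⁻ Rs i
      ... | inj₁ refl = <⇒≤ l
      ... | inj₂ (R , j , refl) = h j

    -- In coarser members the two letters share a block, and in finer ones the block maximum of `v`
    -- is at most `mx R v`, so no key prefers the maximum; the value breaks ties in favour of `v`.
    Lt-mx : ∀ {R} → R ∈ Rs → ∀ {v} → v ≢ mx R v → Lt (keys Rs) v (mx R v)
    Lt-mx {R} i {v} ne = key-lex h (≤∧≢⇒< (≤mx (pt i) (~refl (pt i))) (ne ∘ Fₚ.toℕ-injective))
      where
      h : ∀ {S} → S ∈ Rs → maxKey S v ≤ maxKey S (mx R v)
      h {S} j with nested-comparable nested i j
      ... | inj₁ R≼S = ≤-reflexive (cong toℕ (mx-cong (pt j) (≼⇒⊑ R S R≼S (~mx (pt i) v))))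
      ... | inj₂ S≼R = ≤-trans (mx-mono (pt j) (pt i) (≼⇒⊑ S R S≼R) v) (≤mx (pt j) (~refl (pt j)))

    -- Descend from the coarsest member. The end letters have equal keys down to R, so a letter
    -- between them lexicographically has these keys as well, and an equal key for R means the same
    -- block of R.
    sorted-convex : ∀ {ρ} → Sorted ρ → ∀ {R} → R ∈ Rs → Convex ρ R
    sorted-convex {ρ} so i l l' e = go nested (λ j → pt j) i (so l) (so l') e
      where
      go : ∀ {Rs} → Nested Rs → (∀ {R} → R ∈ Rs → Part R) → ∀ {R} → R ∈ Rs → ∀ {u v w} →
           Lt (keys Rs) u v → Lt (keys Rs) v w → R ∋ u ~ w → R ∋ u ~ v
      go {S ∷ _} (a ∷ ns) pt {R} i {u} {v} {w} x y e = descend i x y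
        where
        S-uw : S ∋ u ~ w
        S-uw = coarser i
          where
          coarser : R ∈ (S ∷ _) → S ∋ u ~ w
          coarser (here refl) = e
          coarser (there j) = ≼⇒⊑ R S (All.lookup a j) e
        mw : maxKey S u ≡ maxKey S w
        mw = cong toℕ (mx-cong (pt (here refl)) S-uw)
        fst≤ : ∀ {gs : List (Fin n → ℕ)} {a b} → Lt (maxKey S ∷ gs) a b → maxKey S a ≤ maxKey S b
        fst≤ (inj₁ l) = <⇒≤ l
        fst≤ (inj₂ (q , _)) = ≤-reflexive q
        uv : maxKey S u ≡ maxKey S v
        uv = ≤-antisym (fst≤ x) (≤-trans (fst≤ y) (≤-reflexive (sym mw)))
        tl : ∀ {gs : List (Fin n → ℕ)} {a b} → Lt (maxKey S ∷ gs) a b → maxKey S a ≡ maxKey S b → Lt gs a b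
        tl (inj₁ l) q = ⊥-elim (<-irrefl q l)
        tl (inj₂ (_ , l)) q = l
        descend : R ∈ (S ∷ _) → Lt (keys (S ∷ _)) u v → Lt (keys (S ∷ _)) v w → R ∋ u ~ v
        descend (here refl) _ _ = mx-inj (pt (here refl)) (Fₚ.toℕ-injective uv)
        descend (there j) x y = go ns (pt ∘ there) j (tl x uv) (tl y (trans (sym uv) mw)) e

    -- Letters in a block of the lowest member have equal keys throughout, and only the tie-breaker
    -- remains.
    sorted-within : ∀ {ρ z} → Sorted ρ → z ∈ Rs → (∀ {R} → R ∈ Rs → prt z ≼ prt R) →
                    ∀ {u v} → z ∋ u ~ v → ρ u < ρ v → toℕ u < toℕ v
    sorted-within {z = z} so i low {u} {v} e l with Lt-witness (keys Rs) (so l)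
    ... | g , j , gl with keys⁻ Rs j
    ...   | inj₁ refl = gl
    ...   | inj₂ (R , r , refl) = ⊥-elim (<-irrefl (cong toℕ (mx-cong (pt r) (≼⇒⊑ z R (low r) e))) gl)

    -- If neighbours lie in different blocks, convexity makes the letters up to `u` a union of
    -- blocks, so their number, which is the position of `v`, is divisible by d.
    sorted-aligned : ∀ {ρ} → Rank ρ → Sorted ρ → ∀ {R} → R ∈ Rs → Aligned ρ R
    sorted-aligned {ρ} rk so {R} i {u} {v} e ¬d with R ∋ u ~? v
    ... | yes uv = uv
    ... | no ¬uv = ⊥-elim (¬d (subst (d ∣_) (trans (cnt-below rk (suc (ρ u)) (Rank.bounded rk u)) (sym e))
            (closed-div d (pt i) (validDiv R (valid i)) (below ρ (suc (ρ u))) cl)))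
      where
      in⁻ : ∀ {w} → w ∊ below ρ (suc (ρ u)) → ρ w < suc (ρ u)
      in⁻ = ⟦⟧⁻ (λ w → ρ w ℕ.<? suc (ρ u))
      cv = sorted-convex so i
      toLeft : ∀ {w x} → ρ w ≤ ρ u → ρ u < ρ x → R ∋ w ~ x → R ∋ w ~ u
      toLeft l g r with m≤n⇒m<n∨m≡n l
      ... | inj₁ l' = cv l' g r
      ... | inj₂ q = subst (λ y → R ∋ _ ~ y) (Rank.injective rk q) (~refl (pt i))
      toRight : ∀ {w x} → ρ w < ρ v → ρ v ≤ ρ x → R ∋ w ~ x → R ∋ w ~ v
      toRight l g r with m≤n⇒m<n∨m≡n g
      ... | inj₁ g' = cv l g' r
      ... | inj₂ q = subst (λ y → R ∋ _ ~ y) (sym (Rank.injective rk q)) r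
      cl : ∀ {w x} → w ∊ below ρ (suc (ρ u)) → R ∋ w ~ x → x ∊ below ρ (suc (ρ u))
      cl {w} {x} m r with ρ x ℕ.<? suc (ρ u)
      ... | yes l = ⟦⟧⁺ (λ w → ρ w ℕ.<? suc (ρ u)) l
      ... | no ¬l = let w≤ = ℕ.s≤s⁻¹ (in⁻ m) ; x> = ≮⇒≥ ¬l in
            ⊥-elim (¬uv (~trans (pt i) (~sym (pt i) (toLeft w≤ x> r))
                          (toRight (≤-<-trans w≤ (≤-reflexive (sym e))) (≤-trans (≤-reflexive e) x>) r)))

-- The word of a nested family lies in the collection and is rr-least.

module Minimal (n d k : ℕ) (1<d : 1 < d) (n≡ : n ≡ k * d) where

  open Poset n d k 1<d n≡
  open Cuts n d k 1<d n≡
  open Cube n d k 1<d n≡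
  open Keys n d k 1<d n≡

  posOf : IdxA n d → Fin n → ℕ
  posOf s = Index.pos s

  InΣ : IdxA n d → Pt n → Set
  InΣ s = SigmaElt n d k (proj₁ s)

  Ascending : (Fin n → ℕ) → Mat n → Set
  Ascending ρ z = ∀ t {u v} → ρ u ≡ bd t ∸ 1 → ρ v ≡ bd t → z ∋ u ~ v → toℕ u < toℕ v

  frame-resp : ∀ {ρ ρ' pos} → (∀ u → ρ u ≡ ρ' u) → Frame ρ pos → Frame ρ' pos
  frame-resp {ρ} {ρ'} h F = record
    { rankᶠ = mkRank (λ u → subst (_< n) (h u) (Rank.bounded rankᶠ u))
                     (λ {u} {v} e → Rank.injective rankᶠ (trans (h u) (trans e (sym (h v)))))
    ; fixed = λ {u} g → trans (fixed λ t nr → g t (subst (Near (bd t)) (h u) nr)) (h u)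
    ; swapped = λ t {u} {v} e e' → swapped t (trans (h u) e) (trans (h v) e')
    ; kept = λ t {u} {v} e e' → kept t (trans (h u) e) (trans (h v) e') }
    where open Frame F

  pos-≗⇒≡ : ∀ (s s' : IdxA n d) → (∀ u → posOf s u ≡ posOf s' u) → ∀ p → lookup (proj₁ s) p ≡ lookup (proj₁ s') p
  pos-≗⇒≡ s s' h p = trans (sym (Index.α-inv s' u)) (cong (lookup (proj₁ s'))
      (Fₚ.toℕ-injective (trans (sym (h u)) (Index.pos-α s p))))
    where u = lookup (proj₁ s) p

  rrless : ∀ (s s' : IdxA n d) {x y} → posOf s x ≡ posOf s' y → toℕ y < toℕ x →
           (∀ w → posOf s x < posOf s w → posOf s' w ≡ posOf s w) → RRLess (proj₁ s) (proj₁ s')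
  rrless s s' {x} {y} e l h = Index.inv s x ,
    (λ i lt' → trans (sym (Index.α-inv s' (lookup (proj₁ s) i))) (cong (lookup (proj₁ s'))
       (Fₚ.toℕ-injective (trans (h (lookup (proj₁ s) i) (subst (posOf s x <_) (sym (Index.pos-α s i)) lt')) (Index.pos-α s i))))) ,
    subst₂ (λ a b → toℕ a < toℕ b)
      (trans (sym (Index.α-inv s' y)) (cong (lookup (proj₁ s')) (Fₚ.toℕ-injective (sym e)))) (sym (Index.α-inv s x)) l

  rrless-irrefl : ∀ (α β : Vec (Fin n) n) → (∀ p → lookup α p ≡ lookup β p) → ¬ RRLess α β
  rrless-irrefl α β h (j , _ , l) = <-irrefl (cong toℕ (sym (h j))) l

  rrless-asym : ∀ (α β : Vec (Fin n) n) → RRLess α β → ¬ RRLess β α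
  rrless-asym α β (i , h , l) (j , g , l') with <-cmp (toℕ i) (toℕ j)
  ... | tri< a _ _ = <-irrefl (cong toℕ (h j a)) l'
  ... | tri> _ _ a = <-irrefl (cong toℕ (g i a)) l
  ... | tri≈ _ e _ with Fₚ.toℕ-injective e
  ...   | refl = <-asym l l'

  module _ {Rs : List (Mat n)} (nested : Nested Rs) (valid : ∀ {R} → R ∈ Rs → Valid (prt R))
           {z : Mat n} (z∈ : z ∈ Rs) (z-low : ∀ {R} → R ∈ Rs → prt z ≼ prt R) where

    open KeyOrder nested valid

    private
      pz : Part z
      pz = validPart z (valid z∈)

      separate : ∀ {u v : Fin n} → u ≢ v → ∃ λ g → g ∈ keys Rs × g u ≢ g v
      separate ne = toℕ , toℕ∈keys Rs , ne ∘ Fₚ.toℕ-injective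

    module KeyWord where

      open OrderRank (keys Rs) separate renaming (rank to ρ; isRank to rk)

      sorted : Sorted ρ
      sorted = rank-reflects

      opaque
        uL vR : Cut → Fin n
        uL t = proj₁ (leftLetter rk t)
        vR t = proj₁ (rightLetter rk t)

        ρ-uL : ∀ t → ρ (uL t) ≡ bd t ∸ 1
        ρ-uL t = proj₂ (leftLetter rk t)

        ρ-vR : ∀ t → ρ (vR t) ≡ bd t
        ρ-vR t = proj₂ (rightLetter rk t)

      at-uL : ∀ t {x} → ρ x ≡ bd t ∸ 1 → x ≡ uL t
      at-uL t e = Rank.injective rk (trans e (sym (ρ-uL t)))

      at-vR : ∀ t {x} → ρ x ≡ bd t → x ≡ vR t
      at-vR t e = Rank.injective rk (trans e (sym (ρ-vR t)))

      uL< : ∀ t → Dec (toℕ (uL t) < toℕ (vR t))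
      uL< t = toℕ (uL t) ℕ.<? toℕ (vR t)

      choose : Bool → Act
      choose b = if b then swsplit else split

      opaque
        f : Acts
        f = tabulate λ t → choose (does (uL< t))

        f-val : ∀ t → lookup f t ≡ choose (does (uL< t))
        f-val = Vₚ.lookup∘tabulate _

      choose≢none : ∀ b → choose b ≢ none
      choose≢none true ()
      choose≢none false ()

      full : Full f
      full t e = choose≢none _ (trans (sym (f-val t)) e)

      f-sw : ∀ t → lookup f t ≡ swsplit → toℕ (uL t) < toℕ (vR t)
      f-sw t e with uL< t
      ... | yes l = l
      ... | no ¬l = contradiction (trans (sym e) (trans (f-val t) (cong choose (dec-false (uL< t) ¬l)))) λ ()

      f-nsw : ∀ t → lookup f t ≢ swsplit → toℕ (vR t) < toℕ (uL t)
      f-nsw t ne with uL< t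
      ... | yes l = ⊥-elim (ne (trans (f-val t) (cong choose (dec-true (uL< t) l))))
      ... | no ¬l = ≤∧≢⇒< (≮⇒≥ ¬l) λ e → pair-≢ rk t (ρ-uL t) (ρ-vR t) (Fₚ.toℕ-injective (sym e))

      posα : Fin n → ℕ
      posα u = sw f (ρ u)

      posα-rank : Rank posα
      posα-rank = sw-rank rk f

      ρ-posα : ∀ u → ρ u ≡ sw f (posα u)
      ρ-posα u = sym (sw-invol f (ρ u))

      private
        letterAt : Fin n → Fin n
        letterAt p = proj₁ (Rank.surjective posα-rank (Fₚ.toℕ<n p))

      opaque
        α : Vec (Fin n) n
        α = tabulate letterAt

        posα-α : ∀ p → posα (lookup α p) ≡ toℕ p
        posα-α p = trans (cong posα (Vₚ.lookup∘tabulate letterAt p)) (proj₂ (Rank.surjective posα-rank (Fₚ.toℕ<n p)))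

      pair-desc : ∀ t {x y} → posα x ≡ bd t ∸ 1 → posα y ≡ bd t → toℕ y < toℕ x
      pair-desc t {x} {y} e e' with act≟ (lookup f t) swsplit
      ... | yes s = subst₂ (λ a b → toℕ a < toℕ b)
              (sym (at-uL t (trans (ρ-posα y) (trans (cong (sw f) e') (swap-unique (sw-spec d 1 f (bd t)) (down t s refl))))))
              (sym (at-vR t (trans (ρ-posα x) (trans (cong (sw f) e) (swap-unique (sw-spec d 1 f (bd t ∸ 1)) (up t s refl))))))
              (f-sw t s)
      ... | no ns = subst₂ (λ a b → toℕ a < toℕ b)
              (sym (at-vR t (trans (ρ-posα y) (trans (cong (sw f) e') (unmoved (inj₂ refl))))))
              (sym (at-uL t (trans (ρ-posα x) (trans (cong (sw f) e) (unmoved (inj₁ refl))))))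
              (f-nsw t ns)
        where
        unmoved : ∀ {p} → Near (bd t) p → sw f p ≡ p
        unmoved {p} np = swap-unique (sw-spec d 1 f p) (stay λ t' e' → (λ q → bad t' e' (inj₁ q)) , λ q → bad t' e' (inj₂ q))
          where
          bad : ∀ t' → lookup f t' ≡ swsplit → ¬ Near (bd t') p
          bad t' e' np' with same-cut {t} {t'} np np' refl
          ... | refl = ns e'

      adjacent-asc : ∀ {x y} → ρ y ≡ suc (ρ x) → ¬ (d ∣ ρ y) → toℕ x < toℕ y
      adjacent-asc e ¬d = sorted-within sorted z∈ z-low (sorted-aligned rk sorted z∈ e ¬d) (≤-reflexive (sym e))

      -- Switching puts the smaller letter of a cut pair at the start of the right segment and, for
      -- `last≥`, the larger one at the end of the left segment. So an ascent of the key word inside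
      -- a segment remains an ascent.
      first≤ : ∀ {x x' i} → posα x ≡ i → ρ x' ≡ i → ¬ (d ∣ suc i) → toℕ x ≤ toℕ x'
      first≤ {x} {x'} {i} refl e' ¬d = go (sw-spec d 1 f (posα x)) (ρ-posα x)
        where
        go : ∀ {q} → Swap f (posα x) q → ρ x ≡ q → toℕ x ≤ toℕ x'
        go (stay _) r = ≤-reflexive (cong toℕ (Rank.injective rk (trans r (sym e'))))
        go (up t _ q) r = ⊥-elim (¬d (subst (d ∣_) (trans (sym (suc-bd-1 t)) (cong suc (sym q))) (d∣bd t)))
        go (down t s q) r = <⇒≤ (subst₂ (λ a b → toℕ a < toℕ b) (sym (at-uL t r)) (sym (at-vR t (trans e' q))) (f-sw t s))

      last≥ : ∀ {y y' i} → posα y ≡ i → ρ y' ≡ i → ¬ (d ∣ i) → toℕ y' ≤ toℕ y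
      last≥ {y} {y'} {i} refl e' ¬d = go (sw-spec d 1 f (posα y)) (ρ-posα y)
        where
        go : ∀ {q} → Swap f (posα y) q → ρ y ≡ q → toℕ y' ≤ toℕ y
        go (stay _) r = ≤-reflexive (cong toℕ (Rank.injective rk (trans e' (sym r))))
        go (up t s q) r = <⇒≤ (subst₂ (λ a b → toℕ a < toℕ b) (sym (at-uL t (trans e' q))) (sym (at-vR t r)) (f-sw t s))
        go (down t _ q) r = ⊥-elim (¬d (subst (d ∣_) (sym q) (d∣bd t)))

      inA : InA n d α
      inA = injective , lastLetter , descents
        where
        injective : ∀ i j → lookup α i ≡ lookup α j → i ≡ j
        injective i j e = Fₚ.toℕ-injective (trans (sym (posα-α i)) (trans (cong posα e) (posα-α j)))
        lastLetter : ∀ i → toℕ i ≡ n ∸ 1 → toℕ (lookup α i) ≡ n ∸ 1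
        lastLetter i e = trans (cong toℕ (sym i≡x)) e
          where
          x = lookup α i
          pred-max : ∀ {m j} → j < m → j ≤ m ∸ 1
          pred-max (s≤s l) = l
          ρx : ρ x ≡ n ∸ 1
          -- The last position lies beyond every cut pair, so no switch moves it.
          ρx = trans (ρ-posα x) (trans (cong (sw f) (trans (posα-α i) e)) (swap-unique (sw-spec d 1 f (n ∸ 1)) (stay λ t _ →
                 (λ q → <-irrefl (sym q) (∸-monoˡ-< (bd<n t) (<⇒≤ (1<bd t)))) ,
                 (λ q → <-irrefl (sym q) (<pred (≤-trans (≤-trans (≤-reflexive (+-comm 2 (bd t))) (+-monoʳ-≤ (bd t) 1<d)) (bd+d≤n t)))))))
          ub : ∀ u → toℕ u ≤ toℕ i
          ub u = subst (toℕ u ≤_) (sym e) (pred-max (Fₚ.toℕ<n u))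
          i≡x : i ≡ x
          i≡x with i Fₚ.≟ x
          ... | yes q = q
          -- Read as a letter, `i` is the largest one. It is the maximum of its block in every
          -- member, so no letter has larger keys and it must occupy the last position.
          ... | no ne = ⊥-elim (<⇒≱ (rank-mono (key-lex (λ {R} j → ≤-trans (ub (mx R x)) (≤mx (pj j) (~refl (pj j))))
                                       (≤∧≢⇒< (ub x) λ q → ne (Fₚ.toℕ-injective (sym q)))))
                              (subst (ρ i ≤_) (sym ρx) (pred-max (Rank.bounded rk i))))
            where
            pj : ∀ {R} → R ∈ Rs → Part R
            pj {R} j = validPart R (valid j)
        descents : ∀ i j → toℕ j ≡ suc (toℕ i) → (toℕ (lookup α j) < toℕ (lookup α i)) ⇔ (d ∣ suc (toℕ i))
        descents i j e = mk⇔ to from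
          where
          x = lookup α i
          y = lookup α j
          from : d ∣ suc (toℕ i) → toℕ y < toℕ x
          from dv with bd-find dv (s≤s z≤n) (subst (_< n) e (Fₚ.toℕ<n j))
          ... | t , q = pair-desc t (trans (posα-α i) (cong (_∸ 1) (sym q))) (trans (posα-α j) (trans e (sym q)))
          to : toℕ y < toℕ x → d ∣ suc (toℕ i)
          to l with d ∣? suc (toℕ i)
          ... | yes dv = dv
          ... | no ¬dv = ⊥-elim (<-asym l (≤-<-trans (first≤ (posα-α i) ex' ¬dv)
                  (<-≤-trans (adjacent-asc (trans ey' (trans e (cong suc (sym ex')))) (λ dv → ¬dv (subst (d ∣_) (trans ey' e) dv)))
                             (last≥ (posα-α j) ey' λ dv → ¬dv (subst (d ∣_) e dv)))))
            where
            ex' = proj₂ (Rank.surjective rk (Fₚ.toℕ<n i))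
            ey' = proj₂ (Rank.surjective rk (Fₚ.toℕ<n j))

      index : IdxA n d
      index = α , inA

      pos≡ : ∀ u → posOf index u ≡ posα u
      pos≡ u = trans (sym (posα-α (Index.inv index u))) (cong posα (Index.α-inv index u))

      ρ≡ : ∀ u → Index.ρ index f u ≡ ρ u
      ρ≡ u = trans (cong (sw f) (pos≡ u)) (sw-invol f (ρ u))

      frame : Frame ρ (posOf index)
      frame = frame-resp ρ≡ (acts-frame index {f} full)

      module _ {R : Mat n} (R∈ : R ∈ Rs) where

        private
          pR = validPart R (valid R∈)
          cv = sorted-convex sorted R∈
          joined : ∀ t → Dec (R ∋ uL t ~ vR t)
          joined t = R ∋ uL t ~? vR t

        restrict : Bool → Act → Act
        restrict b a = if b then none else a

        cR : Acts
        cR = tabulate λ t → restrict (does (joined t)) (lookup f t)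

        c-val : ∀ t → lookup cR t ≡ restrict (does (joined t)) (lookup f t)
        c-val = Vₚ.lookup∘tabulate _

        c-none : ∀ t → R ∋ uL t ~ vR t → lookup cR t ≡ none
        c-none t e = trans (c-val t) (cong (λ b → restrict b (lookup f t)) (dec-true (joined t) e))

        c-cut : ∀ t → ¬ (R ∋ uL t ~ vR t) → lookup cR t ≡ lookup f t
        c-cut t ne = trans (c-val t) (cong (λ b → restrict b (lookup f t)) (dec-false (joined t) ne))

        c⊑f : cR ⊑ᵃ f
        c⊑f t ne with joined t
        ... | yes e = ⊥-elim (ne (c-none t e))
        ... | no ¬e = sym (c-cut t ¬e)

        no-straddle : ∀ t {u v} → R ∋ u ~ v → lookup cR t ≢ none → ρ u < bd t → ρ v < bd t
        no-straddle t {u} {v} e ne l with ρ v ℕ.<? bd t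
        ... | yes l' = l'
        ... | no ¬l' = ⊥-elim (ne (c-none t (~trans pR (~sym pR a) b)))
          where
          eL = ρ-uL t
          eR = ρ-vR t
          l∸ : ρ u ≤ bd t ∸ 1
          l∸ = ℕ.s≤s⁻¹ (≤-trans l (≤-reflexive (sym (suc-bd-1 t))))
          a : R ∋ u ~ uL t
          a with m≤n⇒m<n∨m≡n l∸
          ... | inj₂ q = subst (λ x → R ∋ u ~ x) (at-uL t q) (~refl pR)
          ... | inj₁ q = cv (subst (ρ u <_) (sym eL) q)
                            (subst (_< ρ v) (sym eL) (<-≤-trans (bd-1<bd t) (≮⇒≥ ¬l'))) e
          b : R ∋ u ~ vR t
          b with m≤n⇒m<n∨m≡n (≮⇒≥ ¬l')
          ... | inj₂ q = subst (λ x → R ∋ u ~ x) (at-vR t (sym q)) e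
          ... | inj₁ q = cv (subst (ρ u <_) (sym eR) l) (subst (_< ρ v) (sym eR) q) e

        R⊑P : R ⊑ᵐ Index.P index cR
        R⊑P {u} {v} e = Index.P⁺ index {cR} {f} c⊑f λ t ne → subst₂ (SameSide (bd t)) (sym (ρ≡ u)) (sym (ρ≡ v))
          (no-straddle t e ne , no-straddle t (~sym pR e) ne)

        -- Move from `u` to `v` by single positions. Inside a segment alignment keeps R; across a
        -- cut that `cR` does not make, R joins the cut pair by the definition of `cR`.
        walk : ∀ g {u v} → ρ u + g ≡ ρ v → (∀ t → lookup cR t ≢ none → SameSide (bd t) (ρ u) (ρ v)) → R ∋ u ~ v
        walk zero {u} e h = subst (λ x → R ∋ u ~ x) (Rank.injective rk (trans (sym (+-identityʳ (ρ u))) e)) (~refl pR)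
        walk (suc g) {u} {v} e h = ~trans pR hop (walk g (trans (cong (_+ g) ew) (trans (sym (+-suc (ρ u) g)) e)) h')
          where
          u<v : ρ u < ρ v
          u<v = subst (ρ u <_) e (m<m+n (ρ u) (s≤s z≤n))
          sur = Rank.surjective rk (≤-<-trans u<v (Rank.bounded rk v))
          w = proj₁ sur
          ew : ρ w ≡ suc (ρ u)
          ew = proj₂ sur
          h' : ∀ t → lookup cR t ≢ none → SameSide (bd t) (ρ w) (ρ v)
          h' t ne = (λ l → proj₁ (h t ne) (<-trans (≤-reflexive (sym ew)) l)) , λ l → ≤-<-trans (subst (_≤ ρ v) (sym ew) u<v) l
          hop : R ∋ u ~ w
          hop with d ∣? ρ w
          ... | no ¬d = sorted-aligned rk sorted R∈ ew ¬d
          ... | yes dw with bd-find dw (subst (0 <_) (sym ew) (s≤s z≤n)) (Rank.bounded rk w)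
          ...   | t , q with joined t
          ...     | yes j = subst₂ (λ x y → R ∋ x ~ y)
                      (sym (at-uL t (trans (cong (_∸ 1) (sym ew)) (cong (_∸ 1) (sym q))))) (sym (at-vR t (sym q))) j
          ...     | no ¬j = ⊥-elim (<⇒≱ (proj₁ (h t λ r → full t (trans (sym (c-cut t ¬j)) r)) (subst (ρ u <_) (sym q) (≤-reflexive (sym ew))))
                                (subst (_≤ ρ v) (trans (sym ew) (sym q)) u<v))

        P⊑R : Index.P index cR ⊑ᵐ R
        P⊑R {u} {v} e with ≤-total (ρ u) (ρ v)
        ... | inj₁ l = walk (ρ v ∸ ρ u) (m+[n∸m]≡n l) h
          where
          h : ∀ t → lookup cR t ≢ none → SameSide (bd t) (ρ u) (ρ v)
          h t ne = subst₂ (SameSide (bd t)) (ρ≡ u) (ρ≡ v) (Index.P⁻ index {cR} {f} c⊑f e t ne)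
        ... | inj₂ l = ~sym pR (walk (ρ u ∸ ρ v) (m+[n∸m]≡n l) h)
          where
          h : ∀ t → lookup cR t ≢ none → SameSide (bd t) (ρ v) (ρ u)
          h t ne = let a , b = subst₂ (SameSide (bd t)) (ρ≡ u) (ρ≡ v) (Index.P⁻ index {cR} {f} c⊑f e t ne) in b , a

        member : InΣ index (prt R)
        member = subst (InΣ index) (sym (prt-antisym R⊑P P⊑R)) (Index.Σ⁺ index cR)

    -- The first word is sorted by the keys; of the competitor only convexity, alignment and
    -- ascending cut pairs inside the lowest blocks are assumed. The competitor may thus be switched
    -- by any suitable full choice, not just by one built from this family, and (bdry) uses this
    -- freedom.
    module Compare {s s' : IdxA n d} {ρ ρ' : Fin n → ℕ} (F : Frame ρ (posOf s)) (so : Sorted ρ)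
                   (F' : Frame ρ' (posOf s')) (cv' : ∀ {R} → R ∈ Rs → Convex ρ' R)
                   (al' : Aligned ρ' z) (as' : Ascending ρ' z) where

      private
        rk = Frame.rankᶠ F
        rk' = Frame.rankᶠ F'
        α = posOf s
        β = posOf s'

      Agree : ℕ → Set
      Agree m = ∀ u → (m ≤ ρ u → ρ' u ≡ ρ u) × (m ≤ ρ' u → ρ u ≡ ρ' u)

      record Diff : Set where
        field
          r   : ℕ
          v u : Fin n
          ev  : ρ v ≡ r
          eu  : ρ' u ≡ r
          u≢v : u ≢ v
          agr : Agree (suc r)

      -- Scan from the right end, as rr-lex compares reversed words. `Agree m` covers both
      -- directions so that the letters at the first discrepancy lie further left in the other word.
      search : ∀ m → Agree m → (∀ u → ρ u ≡ ρ' u) ⊎ Diff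
      search zero ag = inj₁ λ u → sym (proj₁ (ag u) z≤n)
      search (suc m) ag with m ℕ.<? n
      ... | no m≮n = search m λ u → (λ l → ⊥-elim (m≮n (≤-<-trans l (Rank.bounded rk u)))) ,
                                     (λ l → ⊥-elim (m≮n (≤-<-trans l (Rank.bounded rk' u))))
      ... | yes m<n with Rank.surjective rk m<n | Rank.surjective rk' m<n
      ...   | v , ev | u , eu with u Fₚ.≟ v
      ...     | no u≢v = inj₂ (record { r = m ; v = v ; u = u ; ev = ev ; eu = eu ; u≢v = u≢v ; agr = ag })
      ...     | yes refl = search m λ w →
                (λ l → [ proj₁ (ag w) , (λ q → trans (cong ρ' (Rank.injective rk (trans (sym q) (sym ev))))
                          (trans eu q)) ]′ (m≤n⇒m<n∨m≡n l)) ,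
                (λ l → [ proj₂ (ag w) , (λ q → trans (cong ρ (Rank.injective rk' (trans (sym q) (sym eu))))
                          (trans ev q)) ]′ (m≤n⇒m<n∨m≡n l))

      module _ (D : Diff) where
        open Diff D

        u-before : ρ u < ρ v
        u-before with <-cmp (ρ u) r
        ... | tri< l _ _ = subst (ρ u <_) (sym ev) l
        ... | tri≈ _ e _ = ⊥-elim (u≢v (Rank.injective rk (trans e (sym ev))))
        ... | tri> _ _ l = ⊥-elim (<-irrefl (trans (sym eu) (proj₁ (agr u) l)) l)

        v-before : ρ' v < ρ' u
        v-before with <-cmp (ρ' v) r
        ... | tri< l _ _ = subst (ρ' v <_) (sym eu) l
        ... | tri≈ _ e _ = ⊥-elim (u≢v (Rank.injective rk' (trans eu (sym e))))
        ... | tri> _ _ l = ⊥-elim (<-irrefl (trans (sym ev) (proj₂ (agr v) l)) l)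

        -- If u, v are separated by R and the maximum w of the block of v is not v, then w
        -- lies beyond r in both words, so v, u, w would contradict the convexity of R.
        u<v : toℕ u < toℕ v
        u<v with Lt-witness (keys Rs) (so u-before)
        ... | g , i , l with keys⁻ Rs i
        ...   | inj₁ refl = l
        ...   | inj₂ (R , j , refl) with v Fₚ.≟ mx R v
        ...     | yes e = ≤-<-trans (≤mx pR (~refl pR)) (<-≤-trans l (≤-reflexive (cong toℕ (sym e))))
          where pR = validPart R (valid j)
        ...     | no ne = ⊥-elim (<-irrefl (cong toℕ (sym (mx-cong pR (cv' j v-before u<w (~mx pR v))))) l)
          where
          pR = validPart R (valid j)
          w = mx R v
          beyond : r < ρ w
          beyond with <-cmp (ρ v) (ρ w)
          ... | tri< q _ _ = subst (_< ρ w) ev q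
          ... | tri≈ _ q _ = ⊥-elim (ne (Rank.injective rk q))
          ... | tri> _ _ q = ⊥-elim (Lt-irrefl (keys Rs) (Lt-trans (keys Rs) (Lt-mx j ne) (so q)))
          u<w : ρ' u < ρ' w
          u<w = subst₂ _<_ (sym eu) (sym (proj₁ (agr w) beyond)) beyond

      -- Unless `r` is the left position of a cut pair, no pair straddles the boundary after `r`.
      -- The letters beyond it are then rearranged in the same way when the switches are undone.
      agree-pos : ∀ {r} → Agree (suc r) → (∀ t → r ≢ bd t ∸ 1) → ∀ w → r < α w → β w ≡ α w
      agree-pos {r} ag r≢ w l with near? (α w)
      ... | no far' = trans (Frame.fixed F' λ t nr → far' (t , subst (Near (bd t)) e' nr)) e'
        where
        sur = Rank.surjective rk (Rank.bounded (Index.pos-rank s) w)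
        x = proj₁ sur
        x≡w : x ≡ w
        x≡w = Rank.injective (Index.pos-rank s) (trans (Frame.fixed F λ t nr → far' (t , subst (Near (bd t)) (proj₂ sur) nr)) (proj₂ sur))
        ρw : ρ w ≡ α w
        ρw = trans (cong ρ (sym x≡w)) (proj₂ sur)
        e' : ρ' w ≡ α w
        e' = trans (proj₁ (ag w) (subst (r <_) (sym ρw) l)) ρw
      ... | yes (t , nr) = pick (letters-cmp (pair-≢ rk t ea eb))
        where
        a = proj₁ (leftLetter rk t)
        ea = proj₂ (leftLetter rk t)
        b = proj₁ (rightLetter rk t)
        eb = proj₂ (rightLetter rk t)
        r<bd-1 : r < bd t ∸ 1
        r<bd-1 = ≤∧≢⇒< (ℕ.s≤s⁻¹ (≤-trans (<-≤-trans l (near-≤ nr)) (≤-reflexive (sym (suc-bd-1 t))))) (r≢ t)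
        ea' : ρ' a ≡ bd t ∸ 1
        ea' = trans (proj₁ (ag a) (subst (r <_) (sym ea) r<bd-1)) ea
        eb' : ρ' b ≡ bd t
        eb' = trans (proj₁ (ag b) (subst (r <_) (sym eb) (<-trans r<bd-1 (bd-1<bd t)))) eb
        finish : ∀ {x} → α x ≡ α w → β x ≡ α x → β w ≡ α w
        finish e h with Rank.injective (Index.pos-rank s) e
        ... | refl = h
        pick : (toℕ a < toℕ b) ⊎ (toℕ b < toℕ a) → β w ≡ α w
        pick (inj₁ q) = let p , p' = Frame.swapped F t ea eb q ; p₁ , p₁' = Frame.swapped F' t ea' eb' q in
          [ (λ e → finish (trans p' (sym e)) (trans p₁' (sym p'))) , (λ e → finish (trans p (sym e)) (trans p₁ (sym p))) ]′ nr
        pick (inj₂ q) = let p , p' = Frame.kept F t ea eb q ; p₁ , p₁' = Frame.kept F' t ea' eb' q in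
          [ (λ e → finish (trans p (sym e)) (trans p₁ (sym p))) , (λ e → finish (trans p' (sym e)) (trans p₁' (sym p'))) ]′ nr

      diff⇒less : Diff → RRLess (proj₁ s) (proj₁ s')
      diff⇒less D with near? (Diff.r D)
      ... | no far' = rrless s s' (trans αv (sym βu)) (u<v D) λ w l → agree-pos agr (λ t e → far' (t , inj₁ e)) w (subst (_< α w) αv l)
        where
        open Diff D
        αv : α v ≡ r
        αv = trans (Frame.fixed F λ t nr → far' (t , subst (Near (bd t)) ev nr)) ev
        βu : β u ≡ r
        βu = trans (Frame.fixed F' λ t nr → far' (t , subst (Near (bd t)) eu nr)) eu
      -- The switched words share the letter `q` at the right position. Undoing the switches sorts
      -- the pairs `v`, `q` and `u`, `q` with the larger letter first, so the comparison moves to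
      -- the right position unless `q` is the smaller letter of both pairs.
      ... | yes (t , inj₁ e) = cases (letters-cmp v≢q) (letters-cmp u≢q)
        where
        open Diff D
        q = proj₁ (rightLetter rk t)
        eq' = proj₂ (rightLetter rk t)
        r<bd : r < bd t
        r<bd = subst (_< bd t) (sym e) (bd-1<bd t)
        eqβ : ρ' q ≡ bd t
        eqβ = trans (proj₁ (agr q) (subst (r <_) (sym eq') r<bd)) eq'
        v≢q = pair-≢ rk t (trans ev e) eq'
        u≢q = pair-≢ rk' t (trans eu e) eqβ
        beyond : ∀ {x} → α x ≡ bd t → ∀ w → α x < α w → β w ≡ α w
        beyond αx w l = agree-pos {bd t} (λ y → (λ l → proj₁ (agr y) (<-trans r<bd l)) , λ l → proj₂ (agr y) (<-trans r<bd l))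
          (λ t' e' → <-irrefl (trans (cong (λ t → bd t ∸ 1) (same-cut {t} {t'} (inj₂ refl) (inj₁ refl) e')) (sym e')) (bd-1<bd t))
          w (subst (_< α w) αx l)
        cases : (toℕ v < toℕ q) ⊎ (toℕ q < toℕ v) → (toℕ u < toℕ q) ⊎ (toℕ q < toℕ u) → RRLess (proj₁ s) (proj₁ s')
        cases (inj₁ vq) (inj₁ uq) =
          let αv , αq = Frame.swapped F t (trans ev e) eq' vq ; βu , βq = Frame.swapped F' t (trans eu e) eqβ uq in
          rrless s s' (trans αv (sym βu)) (u<v D) (beyond αv)
        cases (inj₂ qv) (inj₁ uq) =
          let αv , αq = Frame.kept F t (trans ev e) eq' qv ; βu , βq = Frame.swapped F' t (trans eu e) eqβ uq in
          rrless s s' (trans αq (sym βu)) uq (beyond αq)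
        cases (inj₁ vq) (inj₂ qu) = ⊥-elim (<-asym (<-trans (u<v D) vq) qu)
        cases (inj₂ qv) (inj₂ qu) =
          let αv , αq = Frame.kept F t (trans ev e) eq' qv ; βu , βq = Frame.kept F' t (trans eu e) eqβ qu in
          rrless s s' (trans αv (sym βu)) (u<v D) λ w l →
            [ (λ l' → beyond αq w (subst (_< α w) (sym αq) l'))
            , (λ e' → let w≡q = Rank.injective (Index.pos-rank s) (trans (sym e') (sym αq)) in
                      trans (cong β w≡q) (trans βq e')) ]′
              (m≤n⇒m<n∨m≡n (≤-trans (≤-reflexive (trans (sym (suc-bd-1 t)) (cong suc (sym αv)))) l))
      -- At a right position the next letter `q` is common to both words. Since d > 1, its position
      -- is not divisible by d, so alignment puts `u` and `v` into one block of `z` with `q`. That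
      -- block also contains the left letters `p` and `p'`; it ascends at the cut in both words, so
      -- `p` and `p'` land at the right position, and p' < u ≤ p.
      ... | yes (t , inj₂ e) = rrless s s' (trans αp (sym βp')) (<-≤-trans p'<u u≤p)
              λ w l → agree-pos agr r≢ w (subst (_< α w) (trans αp (sym e)) l)
        where
        open Diff D
        bd+1<n : suc (bd t) < n
        bd+1<n = ≤-trans (≤-trans (≤-reflexive (+-comm 2 (bd t))) (+-monoʳ-≤ (bd t) 1<d)) (bd+d≤n t)
        q = proj₁ (Rank.surjective rk bd+1<n)
        ρq : ρ q ≡ suc (bd t)
        ρq = proj₂ (Rank.surjective rk bd+1<n)
        ρ'q : ρ' q ≡ suc (bd t)
        ρ'q = trans (proj₁ (agr q) (≤-reflexive (trans (cong suc e) (sym ρq)))) ρq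
        ¬d : ¬ (d ∣ suc (bd t))
        ¬d dv = <⇒≱ 1<d (∣⇒≤ (∣m+n∣m⇒∣n (subst (d ∣_) (+-comm 1 (bd t)) dv) (d∣bd t)))
        vq : z ∋ v ~ q
        vq = sorted-aligned rk so z∈ (trans ρq (cong suc (sym (trans ev e)))) (λ x → ¬d (subst (d ∣_) ρq x))
        uq : z ∋ u ~ q
        uq = al' (trans ρ'q (cong suc (sym (trans eu e)))) (λ x → ¬d (subst (d ∣_) ρ'q x))
        uv : z ∋ u ~ v
        uv = ~trans pz uq (~sym pz vq)
        p = proj₁ (leftLetter rk t)
        ρp = proj₂ (leftLetter rk t)
        p' = proj₁ (leftLetter rk' t)
        ρ'p' = proj₂ (leftLetter rk' t)
        p-before : ρ p < ρ v
        p-before = subst₂ _<_ (sym ρp) (sym (trans ev e)) (bd-1<bd t)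
        p'-before : ρ' p' < ρ' u
        p'-before = subst₂ _<_ (sym ρ'p') (sym (trans eu e)) (bd-1<bd t)
        within = λ {x y} → sorted-within so z∈ z-low {x} {y}
        ≤pred : ∀ {x} → x < r → x ≤ bd t ∸ 1
        ≤pred l = ℕ.s≤s⁻¹ (≤-trans l (≤-reflexive (trans e (sym (suc-bd-1 t)))))
        u~p : (u ≡ p) ⊎ ((z ∋ u ~ p) × ρ u < ρ p)
        u~p with m≤n⇒m<n∨m≡n (≤pred (subst (ρ u <_) ev (u-before D)))
        ... | inj₂ x = inj₁ (Rank.injective rk (trans x (sym ρp)))
        ... | inj₁ x = let x' = subst (ρ u <_) (sym ρp) x in inj₂ (sorted-convex so z∈ x' p-before uv , x')
        u≤p : toℕ u ≤ toℕ p
        u≤p = [ (λ x → ≤-reflexive (cong toℕ x)) , (λ { (x , l) → <⇒≤ (within x l) }) ]′ u~p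
        p~v : z ∋ p ~ v
        p~v = [ (λ x → subst (λ y → z ∋ y ~ v) x uv) , (λ { (x , _) → ~trans pz (~sym pz x) uv }) ]′ u~p
        αp : α p ≡ bd t
        αp = proj₁ (Frame.swapped F t ρp (trans ev e) (within p~v p-before))
        p'~u : z ∋ p' ~ u
        p'~u with m≤n⇒m<n∨m≡n (≤pred (subst (ρ' v <_) eu (v-before D)))
        ... | inj₂ x = subst (λ y → z ∋ y ~ u) (Rank.injective rk' (trans x (sym ρ'p'))) (~sym pz uv)
        ... | inj₁ x = ~trans pz (~sym pz (cv' z∈ (subst (ρ' v <_) (sym ρ'p') x) p'-before (~sym pz uv))) (~sym pz uv)
        p'<u : toℕ p' < toℕ u
        p'<u = as' t ρ'p' (trans eu e) p'~u
        βp' : β p' ≡ bd t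
        βp' = proj₁ (Frame.swapped F' t ρ'p' (trans eu e) p'<u)
        r≢ : ∀ t' → r ≢ bd t' ∸ 1
        r≢ t' x with same-cut {t} {t'} (inj₂ e) (inj₁ x) refl
        ... | refl = <-irrefl (trans (sym x) e) (bd-1<bd t)

      compare : RRLess (proj₁ s) (proj₁ s') ⊎ (∀ u → ρ u ≡ ρ' u)
      compare with search n (λ u → (λ l → contradiction (Rank.bounded rk u) (≤⇒≯ l)) , λ l → contradiction (Rank.bounded rk' u) (≤⇒≯ l))
      ... | inj₁ e = inj₂ e
      ... | inj₂ D = inj₁ (diff⇒less D)

-- From nested families to chains: (union) and the generators.

module Collection (n d k : ℕ) (1<d : 1 < d) (n≡ : n ≡ k * d) where

  open Poset n d k 1<d n≡
  open Cuts n d k 1<d n≡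
  open Cube n d k 1<d n≡
  open Keys n d k 1<d n≡
  open Minimal n d k 1<d n≡

  _<ʳ_ : IdxA n d → IdxA n d → Set
  s <ʳ t = RRLess (proj₁ s) (proj₁ t)

  topM : Mat n
  topM = Data.Vec.replicate n (Data.Vec.replicate n true)

  topM-all : ∀ {i j : Fin n} → topM ∋ i ~ j
  topM-all {i} {j} = rel (trans (cong (λ v → lookup v j) (Vₚ.lookup-replicate i _)) (Vₚ.lookup-replicate j true))

  ≼top : ∀ R → prt R ≼ prt topM
  ≼top R = ⊑⇒≼ {R} {topM} λ _ → topM-all

  topM-valid : Valid (prt topM)
  topM-valid = mkValid (record { ~refl = topM-all ; ~sym = λ _ → topM-all ; ~trans = λ _ _ → topM-all })
    λ i → subst (d ∣_) (sym (trans (cnt-≡ {S = row topM i} {T = λ _ → true} (λ _ → mem refl) (λ {j} _ → row⁺ (topM-all {i} {j})))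
                                   (cnt-all _ λ _ → refl))) (divides k n≡)

  proper : List (Pt n) → List (Mat n)
  proper [] = []
  proper (bot ∷ c) = proper c
  proper (prt R ∷ c) = R ∷ proper c

  -- Prepending the one-block partition, which lies in every subposet and has a constant key,
  -- ensures that there is a lowest member even for an empty chain or one consisting of `bot`.
  mats : List (Pt n) → List (Mat n)
  mats c = topM ∷ proper c

  proper⁺ : ∀ {R c} → prt R ∈ c → R ∈ proper c
  proper⁺ {c = prt S ∷ c} (here refl) = here refl
  proper⁺ {c = bot ∷ c} (there i) = proper⁺ i
  proper⁺ {c = prt S ∷ c} (there i) = there (proper⁺ i)

  proper⁻ : ∀ {R} c → R ∈ proper c → prt R ∈ c
  proper⁻ (bot ∷ c) i = there (proper⁻ c i)
  proper⁻ (prt S ∷ c) (here refl) = here refl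
  proper⁻ (prt S ∷ c) (there i) = there (proper⁻ c i)

  below-head : ∀ {x : Pt n} {c} → Linked (λ x y → y ≺ x) (x ∷ c) → ∀ {y} → y ∈ c → y ≼ x
  below-head (r ∷ _) (here refl) = proj₁ r
  below-head {x} (_∷_ {y = w} r l) {y} (there i) = ≼-trans y w x (below-head l i) (proj₁ r)

  linked-rest : ∀ {x : Pt n} {c} → Linked (λ x y → y ≺ x) (x ∷ c) → Linked (λ x y → y ≺ x) c
  linked-rest [-] = []
  linked-rest (_ ∷ l) = l

  proper-nested : ∀ c → Linked (λ x y → y ≺ x) c → Nested (proper c)
  proper-nested [] _ = []
  proper-nested (bot ∷ c) l = proper-nested c (linked-rest l)
  proper-nested (prt R ∷ c) l = All.tabulate (λ i → below-head l (proper⁻ c i)) ∷ proper-nested c (linked-rest l)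

  mats-nested : ∀ {c} → Chain c → Nested (mats c)
  mats-nested {c} (_ , l) = All.tabulate (λ {R} _ → ≼top R) ∷ proper-nested c l

  mats-valid : ∀ {c} → Chain c → ∀ {R} → R ∈ mats c → Valid (prt R)
  mats-valid _ (here refl) = topM-valid
  mats-valid {c} (v , _) (there i) = All.lookup v (proper⁻ c i)

  mc-chain : ∀ {x y c} → MC x y c → Chain c
  mc-chain (single v) = v ∷ [] , [-]
  mc-chain (step cv m) with mc-head m | mc-chain m
  ... | _ , refl | vs , l = Covers.validʸ cv ∷ vs , Covers.lt cv ∷ l

  Σ-top : ∀ s → InΣ s (prt topM)
  Σ-top s = subst (InΣ s) (prt-antisym (λ _ → topM-all) λ _ → Index.P⁺ s {no-cuts} {no-cuts} (λ _ _ → refl)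
      (λ t ne → ⊥-elim (ne (Vₚ.lookup-replicate t none)))) (Index.Σ⁺ s no-cuts)
    where no-cuts = Data.Vec.replicate (k ∸ 1) none

  mats-Σ : ∀ s {c} → All (InΣ s) c → ∀ {R} → R ∈ mats c → InΣ s (prt R)
  mats-Σ s a (here refl) = Σ-top s
  mats-Σ s {c} a (there i) = All.lookup a (proper⁻ c i)

  Σ-mats : ∀ s {c} → (∀ {R} → R ∈ mats c → InΣ s (prt R)) → All (InΣ s) c
  Σ-mats s {c} h = All.tabulate λ { {bot} _ → inj₁ refl ; {prt R} i → h (there (proper⁺ i)) }

  module Represented (s : IdxA n d) {f : Acts} (full : Full f) where

    ρ : Fin n → ℕ
    ρ = Index.ρ s f

    Rep : Mat n → Set
    Rep R = ∃ λ c → R ≡ Index.P s c × c ⊑ᵃ f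

    rep-convex : ∀ {R} → Rep R → Convex ρ R
    rep-convex (c , refl , le) l l' e = Index.P⁺ s {c} {f} le λ t ne →
      let a , b = Index.P⁻ s {c} {f} le e t ne in (λ x → <-trans l' (a x)) , λ x → <-trans l x

    rep-aligned : ∀ {R} → Rep R → Aligned ρ R
    rep-aligned (c , refl , le) {u} {v} e ¬d = Index.P⁺ s {c} {f} le λ t ne →
      (λ x → ≤∧≢⇒< (subst (_≤ bd t) (sym e) x) λ q → ¬d (subst (d ∣_) (sym q) (d∣bd t))) ,
      (λ x → <-trans (≤-reflexive (sym e)) x)

    frame : Frame ρ (posOf s)
    frame = acts-frame s {f} full

    rk : Rank ρ
    rk = Frame.rankᶠ frame

  module SigmaFrame (s : IdxA n d) {Rs : List (Mat n)} {z : Mat n} (z∈ : z ∈ Rs)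
                    (z-low : ∀ {R} → R ∈ Rs → prt z ≼ prt R) (inΣ : ∀ {R} → R ∈ Rs → InΣ s (prt R)) where

    cz : Acts
    cz = proj₁ (Index.Σ⁻ s (inΣ z∈))

    z≡ : z ≡ Index.P s cz
    z≡ = proj₂ (Index.Σ⁻ s (inΣ z∈))

    -- A cut pair of the original word is a descent, so switching at the cuts not made by the lowest
    -- member makes its blocks ascend there. This is what `ascending` records and the comparison
    -- with the key word requires.
    switchNone : Act → Act
    switchNone none = swsplit
    switchNone split = split
    switchNone swsplit = swsplit

    opaque
      f : Acts
      f = Data.Vec.map switchNone cz

      f-val : ∀ t → lookup f t ≡ switchNone (lookup cz t)
      f-val t = Vₚ.lookup-map t switchNone cz

    full : Full f
    full t e = go (lookup cz t) (trans (sym (f-val t)) e)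
      where
      go : ∀ a → switchNone a ≢ none
      go none ()
      go split ()
      go swsplit ()

    f-none : ∀ t → lookup cz t ≡ none → lookup f t ≡ swsplit
    f-none t e = trans (f-val t) (cong switchNone e)

    cz⊑f : cz ⊑ᵃ f
    cz⊑f t ne = trans (f-val t) (go (lookup cz t) ne)
      where
      go : ∀ a → a ≢ none → switchNone a ≡ a
      go none ne = ⊥-elim (ne refl)
      go split _ = refl
      go swsplit _ = refl

    open Represented s {f} full public

    rep : ∀ {R} → R ∈ Rs → Rep R
    rep {R} i = c , R≡ , λ t ne → let e = le t ne in trans (cz⊑f t λ q → ne (trans (sym e) q)) e
      where
      c = proj₁ (Index.Σ⁻ s (inΣ i))
      R≡ = proj₂ (Index.Σ⁻ s (inΣ i))
      le : c ⊑ᵃ cz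
      le = Index.P-reflects s {cz} {c} (subst₂ _⊑ᵐ_ z≡ R≡ (≼⇒⊑ z R (z-low i)))

    ascending : Ascending ρ z
    ascending t {u} {v} e e' uv = Index.descent s
        (trans (cong suc (at e' (swap-unique (sw-spec d 1 f (bd t)) (down t switched refl)))) (trans (suc-bd-1 t) (sym pu)))
        (subst (d ∣_) (sym pu) (d∣bd t))
      where
      cz-none : lookup cz t ≡ none
      cz-none with act≟ (lookup cz t) none
      ... | yes q = q
      ... | no ne = ⊥-elim (<-irrefl e' (proj₁ (Index.P⁻ s {cz} {f} cz⊑f (subst (λ R → R ∋ u ~ v) z≡ uv) t ne)
                                            (subst (_< bd t) (sym e) (bd-1<bd t))))
      switched : lookup f t ≡ swsplit
      switched = f-none t cz-none
      at : ∀ {u p q} → ρ u ≡ p → swAux d 1 f p ≡ q → posOf s u ≡ q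
      at {u} a b = trans (sym (sw-invol f (posOf s u))) (trans (cong (swAux d 1 f) a) b)
      pu : posOf s u ≡ bd t
      pu = at e (swap-unique (sw-spec d 1 f (bd t ∸ 1)) (up t switched refl))

  module ChainWord {c : List (Pt n)} (ch : Chain c) where

    Rs : List (Mat n)
    Rs = mats c

    nested : Nested Rs
    nested = mats-nested {c} ch

    valid : ∀ {R} → R ∈ Rs → Valid (prt R)
    valid = mats-valid {c} ch

    z : Mat n
    z = proj₁ (lowest nested)

    z∈ : z ∈ Rs
    z∈ = proj₁ (proj₂ (lowest nested))

    z-low : ∀ {R} → R ∈ Rs → prt z ≼ prt R
    z-low = proj₂ (proj₂ (lowest nested))

    open KeyOrder nested valid public using (Sorted)

    word : IdxA n d
    word = KeyWord.index nested valid z∈ z-low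

    ρʷ : Fin n → ℕ
    ρʷ = OrderRank.rank (keys Rs) (λ ne → toℕ , toℕ∈keys Rs , ne ∘ Fₚ.toℕ-injective)

    word-frame : Frame ρʷ (posOf word)
    word-frame = KeyWord.frame nested valid z∈ z-low

    word-sorted : Sorted ρʷ
    word-sorted = KeyWord.sorted nested valid z∈ z-low

    word-member : All (InΣ word) c
    word-member = Σ-mats word λ {R} i → KeyWord.member nested valid z∈ z-low i

  union : ∀ c → Chain c → Σ (IdxA n d) λ s → All (InΣ s) c
  union c ch = ChainWord.word {c} ch , ChainWord.word-member {c} ch

  -- The generators of Δ_s are the maximal chains for which s itself is the rr-least word.
  gen-sorted : ∀ {s M} (m : MC top bot M) (inΣ : All (InΣ s) M) →
               (∀ t → t <ʳ s → ¬ All (InΣ t) M) →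
               let open ChainWord {M} (mc-chain m) in
               Sorted (SigmaFrame.ρ s z∈ z-low (mats-Σ s inΣ))
  gen-sorted {s} {M} m inΣ fresh {u} {v} l =
    [ (λ le → ⊥-elim (fresh word le word-member)) , (λ e → word-sorted (subst₂ _<_ (sym (e u)) (sym (e v)) l)) ]′
      (Compare.compare nested valid z∈ z-low {word} {s} word-frame word-sorted frame
         (λ i → rep-convex (rep i)) (rep-aligned (rep z∈)) ascending)
    where
    open ChainWord {M} (mc-chain m)
    open SigmaFrame s z∈ z-low (mats-Σ s inΣ)

-- The boundary condition (bdry).

module Boundary (n d k : ℕ) (1<d : 1 < d) (n≡ : n ≡ k * d) where

  open Poset n d k 1<d n≡
  open Cuts n d k 1<d n≡
  open Cube n d k 1<d n≡
  open Keys n d k 1<d n≡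
  open Minimal n d k 1<d n≡
  open Collection n d k 1<d n≡

  -- A maximal chain of Σ_s through c: each gap of c is filled by making the missing cuts
  -- from right to left, and cuts not made by c are all switched.
  module Refine (s : IdxA n d) {c : List (Pt n)} (ch : Chain c) (inΣ : All (InΣ s) c) where

    open ChainWord {c} ch
    open SigmaFrame s z∈ z-low (mats-Σ s inΣ)

    opaque
      uL vR : Cut → Fin n
      uL t = proj₁ (leftLetter rk t)
      vR t = proj₁ (rightLetter rk t)

      ρ-uL : ∀ t → ρ (uL t) ≡ bd t ∸ 1
      ρ-uL t = proj₂ (leftLetter rk t)

      ρ-vR : ∀ t → ρ (vR t) ≡ bd t
      ρ-vR t = proj₂ (rightLetter rk t)

    at-uL : ∀ t {x} → ρ x ≡ bd t ∸ 1 → x ≡ uL t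
    at-uL t e = Rank.injective rk (trans e (sym (ρ-uL t)))

    at-vR : ∀ t {x} → ρ x ≡ bd t → x ≡ vR t
    at-vR t e = Rank.injective rk (trans e (sym (ρ-vR t)))

    CutBy : Mat n → Cut → Set
    CutBy R t = ¬ (R ∋ uL t ~ vR t)

    joined? : ∀ R t → Dec (R ∋ uL t ~ vR t)
    joined? R t = R ∋ uL t ~? vR t

    separates : ∀ t → ¬ SameSide (bd t) (ρ (uL t)) (ρ (vR t))
    separates t (a , _) = <-irrefl (ρ-vR t) (a (subst (_< bd t) (sym (ρ-uL t)) (bd-1<bd t)))

    cut⁺ : ∀ {a} → a ⊑ᵃ f → ∀ t → lookup a t ≢ none → CutBy (Index.P s a) t
    cut⁺ {a} le t ne e = separates t (Index.P⁻ s {a} {f} le e t ne)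

    cut⁻ : ∀ {a} → a ⊑ᵃ f → ∀ t → CutBy (Index.P s a) t → lookup a t ≢ none
    cut⁻ {a} le t ct e = ct (Index.P⁺ s {a} {f} le λ t' ne →
      subst₂ (SameSide (bd t')) (sym (ρ-uL t)) (sym (ρ-vR t)) (straddle λ { refl → ne e }))

    -- A cut that is made gets the smaller key, so the lexicographic order lists the cuts of coarser
    -- members first; the tie-breaker `rev` then orders each gap from right to left.
    cutKey : Mat n → Cut → ℕ
    cutKey R t = if does (joined? R t) then 1 else 0

    key-joined : ∀ {R t} → R ∋ uL t ~ vR t → cutKey R t ≡ 1
    key-joined {R} {t} e = cong (λ b → if b then 1 else 0) (dec-true (joined? R t) e)

    key-cut : ∀ {R t} → CutBy R t → cutKey R t ≡ 0
    key-cut {R} {t} e = cong (λ b → if b then 1 else 0) (dec-false (joined? R t) e)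

    key-< : ∀ {R t t'} → cutKey R t < cutKey R t' → CutBy R t × (R ∋ uL t' ~ vR t')
    key-< {R} {t} {t'} l with joined? R t | joined? R t'
    ... | no a  | yes b = a , b
    ... | yes a | yes b = contradiction (subst₂ _<_ (key-joined {R} {t} a) (key-joined {R} {t'} b) l) (<-irrefl refl)
    ... | _     | no b  = contradiction (subst (cutKey R t <_) (key-cut {R} {t'} b) l) λ ()

    rev : Cut → ℕ
    rev t = k ∸ toℕ t

    t≤k : ∀ t → toℕ t ≤ k
    t≤k t = ≤-trans (<⇒≤ (Fₚ.toℕ<n t)) (m∸n≤m k 1)

    cutOrder : List (Cut → ℕ)
    cutOrder = lexKeys cutKey rev Rs

    open OrderRank cutOrder (λ ne → rev , tie∈ Rs , λ e → ne (Fₚ.toℕ-injective (∸-cancelˡ-≡ (t≤k _) (t≤k _) e)))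
      renaming (rank to T; isRank to T-rank; rank-reflects to T-reflects)

    -- The cuts of each member of the chain form an initial segment of the cut order, so each member
    -- reappears as a stage of the refinement.
    down-closed : ∀ {R} → R ∈ Rs → ∀ {t t'} → Lt cutOrder t' t → CutBy R t → CutBy R t'
    down-closed {R} i {t} {t'} l ct j with lex-first cutKey rev nested l
    ... | inj₁ (S , _ , l' , h) = proj₁ (key-< {S} l') (≼⇒⊑ R S (h i λ e →
            contradiction (trans (sym (key-joined {R} {t'} j)) (trans e (key-cut {R} {t} ct))) λ ()) j)
    ... | inj₂ (h , _) = contradiction (trans (sym (key-joined {R} {t'} j)) (trans (h i) (key-cut {R} {t} ct))) λ ()

    opaque
      A : ℕ → Acts
      A τ = tabulate λ t → if does (T t ℕ.<? τ) then lookup f t else none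

      A-made : ∀ {τ t} → T t < τ → lookup (A τ) t ≡ lookup f t
      A-made {τ} {t} l = trans (Vₚ.lookup∘tabulate _ t)
        (cong (λ b → if b then lookup f t else none) (dec-true (T t ℕ.<? τ) l))

      A-none : ∀ {τ t} → ¬ (T t < τ) → lookup (A τ) t ≡ none
      A-none {τ} {t} l = trans (Vₚ.lookup∘tabulate _ t)
        (cong (λ b → if b then lookup f t else none) (dec-false (T t ℕ.<? τ) l))

    A-cut : ∀ {τ t} → lookup (A τ) t ≢ none → T t < τ
    A-cut {τ} {t} ne with T t ℕ.<? τ
    ... | yes l = l
    ... | no ¬l = ⊥-elim (ne (A-none ¬l))

    A-cut⁺ : ∀ {τ t} → T t < τ → lookup (A τ) t ≢ none
    A-cut⁺ l e = full _ (trans (sym (A-made l)) e)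

    A⊑f : ∀ τ → A τ ⊑ᵃ f
    A⊑f τ t ne = sym (A-made (A-cut ne))

    A-mono : ∀ {τ τ'} → τ ≤ τ' → A τ ⊑ᵃ A τ'
    A-mono l t ne = trans (A-made (<-≤-trans (A-cut ne) l)) (sym (A-made (A-cut ne)))

    stage : ℕ → Mat n
    stage τ = Index.P s (A τ)

    stages : ℕ → ℕ → List (Pt n)
    stages τ zero = prt (stage τ) ∷ bot ∷ []
    stages τ (suc g) = prt (stage τ) ∷ stages (suc τ) g

    stages-mc : ∀ g τ → τ + g ≡ k ∸ 1 → MC (prt (stage τ)) bot (stages τ g)
    stages-mc zero τ e = step (Index.full-cover s {A τ} λ t → A-cut⁺ (<-≤-trans (Rank.bounded T-rank t)
                           (≤-reflexive (trans (sym e) (+-identityʳ τ))))) (single tt)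
    stages-mc (suc g) τ e = step (Index.cut-cover s {A τ} {A (suc τ)} {f} t (A⊑f τ) (A⊑f (suc τ)) same
        (A-none (λ l → <-irrefl T≡ l)) (A-cut⁺ (s≤s (≤-reflexive T≡)))) (stages-mc g (suc τ) (trans (sym (+-suc τ g)) e))
      where
      sur = Rank.surjective T-rank {τ} (subst (τ <_) e (m<m+n τ (s≤s z≤n)))
      t = proj₁ sur
      T≡ : T t ≡ τ
      T≡ = proj₂ sur
      same : ∀ t' → t' ≢ t → lookup (A (suc τ)) t' ≡ lookup (A τ) t'
      same t' ne with T t' ℕ.<? τ
      ... | yes l = trans (A-made (<-trans l ≤-refl)) (sym (A-made l))
      ... | no ¬l = trans (A-none λ l → ¬l (≤∧≢⇒< (ℕ.s≤s⁻¹ l) λ e → ne (Rank.injective T-rank (trans e (sym T≡))))) (sym (A-none ¬l))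

    M : List (Pt n)
    M = stages 0 (k ∸ 1)

    M-mc : MC top bot M
    M-mc = subst (λ x → MC x bot M) (prt-antisym (λ _ → topM-all) λ _ → Index.P⁺ s {A 0} {f} (A⊑f 0)
             (λ t ne → contradiction (A-cut {0} {t} ne) λ ())) (stages-mc (k ∸ 1) 0 refl)

    stages⁻ : ∀ g τ {x} → x ∈ stages τ g → (x ≡ bot) ⊎ (∃ λ τ' → x ≡ prt (stage τ'))
    stages⁻ zero τ (here e) = inj₂ (τ , e)
    stages⁻ zero τ (there (here e)) = inj₁ e
    stages⁻ (suc g) τ (here e) = inj₂ (τ , e)
    stages⁻ (suc g) τ (there i) = stages⁻ g (suc τ) i

    stages⁺ : ∀ g τ j → j ≤ g → prt (stage (τ + j)) ∈ stages τ g
    stages⁺ zero τ zero _ = here (cong (prt ∘ stage) (+-identityʳ τ))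
    stages⁺ (suc g) τ zero _ = here (cong (prt ∘ stage) (+-identityʳ τ))
    stages⁺ (suc g) τ (suc j) (s≤s l) = there (subst (λ x → prt (stage x) ∈ stages (suc τ) g) (sym (+-suc τ j)) (stages⁺ g (suc τ) j l))

    bot∈ : ∀ g τ → bot ∈ stages τ g
    bot∈ zero τ = there (here refl)
    bot∈ (suc g) τ = there (bot∈ g (suc τ))

    M-Σ : All (InΣ s) M
    M-Σ = All.tabulate λ i → go (stages⁻ (k ∸ 1) 0 i)
      where
      go : ∀ {x} → (x ≡ bot) ⊎ (∃ λ τ → x ≡ prt (stage τ)) → InΣ s x
      go (inj₁ refl) = inj₁ refl
      go (inj₂ (τ , refl)) = Index.Σ⁺ s (A τ)

    cuts : Mat n → Sub (k ∸ 1)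
    cuts R = ⟦ (λ t → ¬? (joined? R t)) ⟧

    cuts⁺ : ∀ {R t} → CutBy R t → t ∊ cuts R
    cuts⁺ {R} = ⟦⟧⁺ (λ t → ¬? (joined? R t))

    cuts⁻ : ∀ {R t} → t ∊ cuts R → CutBy R t
    cuts⁻ {R} = ⟦⟧⁻ (λ t → ¬? (joined? R t))

    module _ {R : Mat n} (i : R ∈ Rs) where

      private
        τ = cnt (cuts R)
        in⁻ : ∀ {b t} → t ∊ below T b → T t < b
        in⁻ {b} = ⟦⟧⁻ (λ t → T t ℕ.<? b)

      T≤⇒cut : ∀ {t t'} → CutBy R t → T t' ≤ T t → CutBy R t'
      T≤⇒cut {t} {t'} ct l with m≤n⇒m<n∨m≡n l
      ... | inj₁ l' = down-closed i (T-reflects l') ct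
      ... | inj₂ e = subst (CutBy R) (sym (Rank.injective T-rank e)) ct

      cut⇒early : ∀ {t} → CutBy R t → T t < τ
      cut⇒early {t} ct = subst (_≤ τ) (cnt-below T-rank (suc (T t)) (Rank.bounded T-rank t))
        (cnt-mono {S = below T (suc (T t))} {T = cuts R} λ m → cuts⁺ (T≤⇒cut ct (ℕ.s≤s⁻¹ (in⁻ m))))

      early⇒cut : ∀ {t} → T t < τ → CutBy R t
      early⇒cut {t} l j = <⇒≱ l (subst (τ ≤_) (cnt-below T-rank (T t) (<⇒≤ (Rank.bounded T-rank t)))
        (cnt-mono {S = cuts R} {T = below T (T t)} λ m → ⟦⟧⁺ (λ t' → T t' ℕ.<? T t)
          (≰⇒> λ le → T≤⇒cut (cuts⁻ m) le j)))

      -- An initial segment is determined by its size, here the number of cuts of R; as all choices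
      -- come from the same `f`, equal cuts give equal partitions.
      is-stage : prt R ≡ prt (stage τ)
      is-stage with rep i
      ... | a , R≡ , le = trans (cong prt R≡) (prt-antisym
        (λ e → Index.P⁺ s {A τ} {f} (A⊑f τ) λ t ne → Index.P⁻ s {a} {f} le e t
           (cut⁻ {a} le t (subst (λ R → CutBy R t) R≡ (early⇒cut (A-cut ne)))))
        (λ e → Index.P⁺ s {a} {f} le λ t ne → Index.P⁻ s {A τ} {f} (A⊑f τ) e t
           (A-cut⁺ (cut⇒early (subst (λ R → CutBy R t) (sym R≡) (cut⁺ {a} le t ne))))))

      stage∈M : prt R ∈ M
      stage∈M = subst (_∈ M) (sym is-stage) (stages⁺ (k ∸ 1) 0 τ (cnt≤ (cuts R)))

    c⊆M : ∀ {x} → x ∈ c → x ∈ M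
    c⊆M {bot} _ = bot∈ (k ∸ 1) 0
    c⊆M {prt R} i = stage∈M (there (proper⁺ i))

    private module CM = ChainWord {M} (mc-chain M-mc)

    rep-M : ∀ {R} → R ∈ CM.Rs → ∃ λ τ → R ≡ stage τ
    rep-M (here refl) = 0 , prt-injective (prt-antisym (λ _ → Index.P⁺ s {A 0} {f} (A⊑f 0)
             (λ t ne → contradiction (A-cut {0} {t} ne) λ ())) λ _ → topM-all)
    rep-M (there j) with stages⁻ (k ∸ 1) 0 (proper⁻ M j)
    ... | inj₂ (τ , e) = τ , prt-injective e

    Rep-M : ∀ {R} → R ∈ CM.Rs → Rep R
    Rep-M i = let τ , e = rep-M i in A τ , e , A⊑f τ

    part-of : ∀ {R} → R ∈ Rs → Part R
    part-of {R} i = validPart R (valid i)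

    stage-part : ∀ τ → Part (stage τ)
    stage-part τ = Index.P-part s (A τ)

    rep⁺ : ∀ {R u v} → Rep R → (∀ t → CutBy R t → SameSide (bd t) (ρ u) (ρ v)) → R ∋ u ~ v
    rep⁺ (a , refl , le) h = Index.P⁺ s {a} {f} le λ t ne → h t (cut⁺ {a} le t ne)

    rep⁻ : ∀ {R u v} → Rep R → R ∋ u ~ v → ∀ t → CutBy R t → SameSide (bd t) (ρ u) (ρ v)
    rep⁻ (a , refl , le) e t ct = Index.P⁻ s {a} {f} le e t (cut⁻ {a} le t ct)

    stage-rep : ∀ τ → Rep (stage τ)
    stage-rep τ = A τ , refl , A⊑f τ

    stage-cut⁺ : ∀ {τ t} → T t < τ → CutBy (stage τ) t
    stage-cut⁺ {τ} {t} l = cut⁺ {A τ} (A⊑f τ) t (A-cut⁺ l)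

    stage-cut⁻ : ∀ {τ t} → CutBy (stage τ) t → T t < τ
    stage-cut⁻ {τ} {t} ct = A-cut (cut⁻ {A τ} (A⊑f τ) t ct)

    stage-mono : ∀ {τ τ'} → τ ≤ τ' → stage τ' ⊑ᵐ stage τ
    stage-mono l = Index.P-mono s (A-mono l)

    stage∈ : ∀ {τ} → τ ≤ k ∸ 1 → stage τ ∈ CM.Rs
    stage∈ {τ} l = there (proper⁺ (stages⁺ (k ∸ 1) 0 τ l))

    -- The letters at the cut t, first separated in c by y and in M by w = stage (suc (T t)):
    -- their blocks in w are contained in, respectively contain, those in y.
    module _ {y : Mat n} (y∈ : y ∈ Rs) (t : Cut) (y-cuts : CutBy y t)
             (y-first : ∀ {S} → S ∈ Rs → CutBy S t → prt S ≼ prt y) where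

      private
        py = part-of y∈
        w = stage (suc (T t))
        pw = stage-part (suc (T t))
        x = mx w (vR t)

      y⊑w : y ⊑ᵐ w
      y⊑w j = rep⁺ (stage-rep _) λ t' ct → rep⁻ (rep y∈) j t' (T≤⇒cut y∈ y-cuts (ℕ.s≤s⁻¹ (stage-cut⁻ ct)))

      left-mx : maxKey y (uL t) ≤ maxKey w (uL t)
      left-mx = mx-mono py pw y⊑w (uL t)

      private
        w-side : ∀ t' → T t' ≤ T t → SameSide (bd t') (ρ (vR t)) (ρ x)
        w-side t' l = rep⁻ (stage-rep _) (~mx pw (vR t)) t' (stage-cut⁺ (s≤s l))

        x-right : bd t ≤ ρ x
        x-right = ≮⇒≥ λ l → <-irrefl (ρ-vR t) (proj₂ (w-side t ≤-refl) l)

        -- Both cuts are first made by `y`, so they belong to one gap. There a later cut lies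
        -- further left.
        late-cut : ∀ {t'} → CutBy y t' → First cutKey rev Rs t t' → toℕ t' < toℕ t
        late-cut ct (inj₁ (S , S∈ , S< , _)) = let cS , j = key-< {S} S< in ⊥-elim (ct (≼⇒⊑ S y (y-first S∈ cS) j))
        late-cut _ (inj₂ (_ , r<)) = ≰⇒> λ le → <⇒≱ r< (∸-monoʳ-≤ k le)

        y-side : ∀ t' → CutBy y t' → SameSide (bd t') (ρ (vR t)) (ρ x)
        y-side t' ct with T t' ℕ.≤? T t
        ... | yes l = w-side t' l
        ... | no ¬l = (λ l → ⊥-elim (<-asym l (<-≤-trans right (≤-reflexive (sym (ρ-vR t)))))) ,
                      (λ l → ⊥-elim (<-asym l (<-≤-trans right x-right)))
          where
          right : bd t' < bd t
          right = <-≤-trans (m<m+n _ 0<d) (bd-gap (late-cut ct (lex-first cutKey rev nested (T-reflects (≰⇒> ¬l)))))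

      -- A cut of `y` still missing in `w` lies left of `t`, whereas `vR t` and its maximum in `w`
      -- lie right of `t`. Hence no cut of `y` separates the two.
      right-mx : maxKey w (vR t) ≤ maxKey y (vR t)
      right-mx = ≤mx py (rep⁺ (rep y∈) y-side)

    separated⇒cut : ∀ {R t} → Part R → maxKey R (uL t) ≢ maxKey R (vR t) → CutBy R t
    separated⇒cut p ne j = ne (cong toℕ (mx-cong p j))

    cut⇒separated : ∀ {R t} → Part R → CutBy R t → maxKey R (uL t) ≢ maxKey R (vR t)
    cut⇒separated p ct e = ct (mx-inj p (Fₚ.toℕ-injective e))

    CM-part : ∀ {R} → R ∈ CM.Rs → Part R
    CM-part {R} i = validPart R (CM.valid i)

    -- If `y` is the member that orders the pair downwards, then `right-mx`, `y<` and `left-mx` give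
    -- the same strict inequality for the stage `w` that separates the pair in the refinement. If no
    -- member decides, the pair lies in one lowest block, where it ascends.
    no-swap-cut : ∀ t → First maxKey toℕ Rs (vR t) (uL t) → First maxKey toℕ CM.Rs (uL t) (vR t) → ⊥
    no-swap-cut t (inj₂ (same , v<u)) _ = <-asym v<u (ascending t (ρ-uL t) (ρ-vR t)
      (mx-inj (part-of z∈) (Fₚ.toℕ-injective (sym (same z∈)))))
    no-swap-cut t (inj₁ (y , y∈ , y< , _)) (inj₂ (same , _)) =
      <-irrefl (sym (same (there (proper⁺ (stage∈M y∈))))) y<
    no-swap-cut t (inj₁ (y , y∈ , y< , first)) (inj₁ (R , R∈ , R< , firstM)) =
      <-asym y< (≤-<-trans (left-mx y∈ t y-cuts y-first) (<-≤-trans w< (right-mx y∈ t y-cuts y-first)))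
      where
      y-cuts : CutBy y t
      y-cuts = separated⇒cut (part-of y∈) λ e → <-irrefl (sym e) y<
      y-first : ∀ {S} → S ∈ Rs → CutBy S t → prt S ≼ prt y
      y-first i ct = first i λ e → cut⇒separated (part-of i) ct (sym e)
      w = stage (suc (T t))
      w≼R : prt w ≼ prt R
      w≼R = firstM (stage∈ (Rank.bounded T-rank t)) (cut⇒separated (stage-part _) (stage-cut⁺ ≤-refl))
      R-cuts : CutBy R t
      R-cuts = separated⇒cut (CM-part R∈) λ e → <-irrefl e R<
      R⊑w : ∀ τ → R ≡ stage τ → R ⊑ᵐ w
      R⊑w τ e j = stage-mono (stage-cut⁻ (subst (λ S → CutBy S t) e R-cuts)) (subst (λ S → S ∋ _ ~ _) e j)
      w≡R : w ≡ R
      w≡R = ⊑ᵐ-antisym (≼⇒⊑ w R w≼R) (R⊑w (proj₁ (rep-M R∈)) (proj₂ (rep-M R∈)))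
      w< : maxKey w (uL t) < maxKey w (vR t)
      w< = subst (λ S → maxKey S (uL t) < maxKey S (vR t)) (sym w≡R) R<

    no-swap-flat : ∀ {u v} → ρ v ≡ suc (ρ u) → ¬ (d ∣ ρ v) → First maxKey toℕ Rs v u → First maxKey toℕ CM.Rs u v → ⊥
    no-swap-flat e ¬d (inj₁ (R , i , l , _)) _ = <-irrefl (cong toℕ (sym (mx-cong (part-of i) (rep-aligned (rep i) e ¬d)))) l
    no-swap-flat e ¬d _ (inj₁ (R , i , l , _)) = <-irrefl (cong toℕ (mx-cong (CM-part i) (rep-aligned (Rep-M i) e ¬d))) l
    no-swap-flat e ¬d (inj₂ (_ , l)) (inj₂ (_ , l')) = <-asym l l'

    no-swap : ∀ {u v} → ρ v ≡ suc (ρ u) → Lt (keys Rs) v u → Lt (keys CM.Rs) u v → ⊥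
    no-swap {u} {v} e vu uv = go (d ∣? ρ v)
      where
      go : Dec (d ∣ ρ v) → ⊥
      go (no ¬dv) = no-swap-flat e ¬dv (lex-first maxKey toℕ nested vu) (lex-first maxKey toℕ CM.nested uv)
      go (yes dv) = no-swap-cut t
          (subst₂ (First maxKey toℕ Rs) v≡ u≡ (lex-first maxKey toℕ nested vu))
          (subst₂ (First maxKey toℕ CM.Rs) u≡ v≡ (lex-first maxKey toℕ CM.nested uv))
        where
        cut = bd-find dv (subst (0 <_) (sym e) (s≤s z≤n)) (Rank.bounded rk v)
        t = proj₁ cut
        v≡ : v ≡ vR t
        v≡ = at-vR t (sym (proj₂ cut))
        u≡ : u ≡ uL t
        u≡ = at-uL t (trans (cong (_∸ 1) (sym e)) (cong (_∸ 1) (sym (proj₂ cut))))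

    -- Sortedness need only be checked on neighbours: the keys compare any two distinct letters, and
    -- `no-swap` excludes neighbours in the wrong order.
    sorted-M⇒sorted : CM.Sorted ρ → Sorted ρ
    sorted-M⇒sorted soM {u} {v} l = walk (ρ v ∸ suc (ρ u)) (trans (+-suc (ρ u) _) (m+[n∸m]≡n l))
      where
      adjacent : ∀ {u v} → ρ v ≡ suc (ρ u) → Lt (keys Rs) u v
      adjacent {u} {v} e = [ id , (λ l → ⊥-elim (no-swap e l (soM (≤-reflexive (sym e))))) ]′
        (Lt-total (keys Rs) {u} {v} (toℕ , toℕ∈keys Rs , λ q →
          <-irrefl (cong ρ (Fₚ.toℕ-injective q)) (≤-reflexive (sym e))))
      walk : ∀ g {u v} → ρ u + suc g ≡ ρ v → Lt (keys Rs) u v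
      walk zero {u} e = adjacent (trans (sym e) (+-comm (ρ u) 1))
      walk (suc g) {u} {v} e = Lt-trans (keys Rs) (adjacent {u} {w} ew)
          (walk g (trans (cong (_+ suc g) ew) (trans (sym (+-suc (ρ u) (suc g))) e)))
        where
        sur = Rank.surjective rk {suc (ρ u)} (≤-<-trans (subst (ρ u <_) e (m<m+n (ρ u) (s≤s z≤n))) (Rank.bounded rk v))
        w = proj₁ sur
        ew = proj₂ sur

    later-member : ∀ t → t <ʳ s → All (InΣ t) c → Σ (IdxA n d) λ t' → t' <ʳ s × All (InΣ t') M
    later-member t t<s inΣ' = [ (λ less → CM.word , less , CM.word-member) , (λ same → ⊥-elim (absurd same)) ]′
      (Compare.compare CM.nested CM.valid CM.z∈ CM.z-low {CM.word} {s}
         CM.word-frame CM.word-sorted frame (λ i → rep-convex (Rep-M i)) (rep-aligned (Rep-M CM.z∈)) asc)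
      where
      asc : Ascending ρ CM.z
      -- The last stage makes every cut, so no cut pair lies in a block of the lowest member and the
      -- condition is vacuous.
      asc t' {u} {v} e e' uv = ⊥-elim (stage-cut⁺ {k ∸ 1} (Rank.bounded T-rank t')
        (≼⇒⊑ CM.z (stage (k ∸ 1)) (CM.z-low (stage∈ ≤-refl))
          (subst₂ (λ a b → CM.z ∋ a ~ b) (at-uL t' e) (at-vR t' e') uv)))
      module St = SigmaFrame t z∈ z-low (mats-Σ t inΣ')
      conflict : (s <ʳ t) ⊎ (∀ u → ρ u ≡ St.ρ u) → ⊥
      conflict (inj₁ s<t) = rrless-asym (proj₁ s) (proj₁ t) s<t t<s
      conflict (inj₂ e) = rrless-irrefl (proj₁ t) (proj₁ s)
        (pos-≗⇒≡ t s (frame-unique St.frame (frame-resp e frame))) t<s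
      -- Equality with the key word of the refinement would make `ρ` sorted for the smaller chain,
      -- hence s at most t in rr-lex.
      absurd : (∀ u → CM.ρʷ u ≡ ρ u) → ⊥
      absurd same = conflict (Compare.compare nested valid z∈ z-low {s} {t} frame
        (sorted-M⇒sorted λ {u} {v} l → CM.word-sorted (subst₂ _<_ (sym (same u)) (sym (same v)) l))
        St.frame (λ i → St.rep-convex (St.rep i)) (St.rep-aligned (St.rep z∈)) St.ascending)

-- Descending chains between two partitions.

module Descents (n d k : ℕ) (1<d : 1 < d) (n≡ : n ≡ k * d) where

  open Poset n d k 1<d n≡
  open EL n d k 1<d n≡
  open Cuts n d k 1<d n≡
  open Cube n d k 1<d n≡
  open Keys n d k 1<d n≡
  open Minimal n d k 1<d n≡
  open Collection n d k 1<d n≡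

  ¬≤-trans : ∀ {a b c} → ¬ (a ℤ.≤ b) → ¬ (b ℤ.≤ c) → ¬ (a ℤ.≤ c)
  ¬≤-trans h g l = ℤₚ.<⇒≱ (ℤₚ.<-trans (ℤₚ.≰⇒> g) (ℤₚ.≰⇒> h)) l

  -- What is used of a word in which every merge of the chain c joins two adjacent blocks,
  -- the one with the smaller maximum on the left.
  record Oriented (ρ : Fin n → ℕ) (c : List (Pt n)) : Set where
    field
      rank     : Rank ρ
      convex   : ∀ {R} → prt R ∈ c → Convex ρ R
      max-last : ∀ {R} → prt R ∈ c → ∀ {u m} → Max R m → R ∋ u ~ m → u ≢ m → ρ u < ρ m
      ordered  : ∀ {Y Z ℓ} → prt Y ∈ c → prt Z ∈ c → (mg : Merge Y Z ℓ) →
                 ∀ {u v} → Z ∋ Merge.a mg ~ u → Z ∋ Merge.b mg ~ v → ρ u < ρ v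

  oriented-⊆ : ∀ {ρ c c'} → (∀ {x} → x ∈ c' → x ∈ c) → Oriented ρ c → Oriented ρ c'
  oriented-⊆ h O = record { rank = rank ; convex = convex ∘ h ; max-last = max-last ∘ h
                          ; ordered = λ i j → ordered (h i) (h j) }
    where open Oriented O

  sorted⇒oriented : ∀ {ρ M} (ch : Chain M) → Rank ρ → ChainWord.Sorted {M} ch ρ → Oriented ρ M
  sorted⇒oriented {ρ} {M} ch rk so = record
    { rank = rk
    ; convex = λ i → KeyOrder.sorted-convex nested valid so (in-Rs i)
    ; max-last = last
    ; ordered = λ {Y} {Z} i j mg {u} {v} au bv → order {Y} {Z} i j mg au bv }
    where
    open ChainWord {M} ch
    in-Rs : ∀ {R} → prt R ∈ M → R ∈ Rs
    in-Rs i = there (proper⁺ i)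
    pt : ∀ {R} → R ∈ Rs → Part R
    pt {R} i = validPart R (valid i)
    Lt⇒< : ∀ {u v} → Lt (keys Rs) u v → ρ u < ρ v
    Lt⇒< {u} {v} l with <-cmp (ρ u) (ρ v)
    ... | tri< q _ _ = q
    ... | tri≈ _ e _ = ⊥-elim (Lt-irrefl (keys Rs) (subst (Lt (keys Rs) u) (sym (Rank.injective rk e)) l))
    ... | tri> _ _ q = ⊥-elim (Lt-irrefl (keys Rs) (Lt-trans (keys Rs) l (so q)))
    last : ∀ {R} → prt R ∈ M → ∀ {u m} → Max R m → R ∋ u ~ m → u ≢ m → ρ u < ρ m
    last i {u} {m} mx-m e ne = subst (λ x → ρ u < ρ x) m≡
        (Lt⇒< (KeyOrder.Lt-mx nested valid (in-Rs i) λ q → ne (trans q m≡)))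
      where m≡ = max⇒mx (pt (in-Rs i)) mx-m e
    order : ∀ {Y Z ℓ} → prt Y ∈ M → prt Z ∈ M → (mg : Merge Y Z ℓ) →
            ∀ {u v} → Z ∋ Merge.a mg ~ u → Z ∋ Merge.b mg ~ v → ρ u < ρ v
    order {Y} {Z} i j mg {u} {v} au bv = ≰⇒> λ v≤u → contra (m≤n⇒m<n∨m≡n (≤-trans v≤u u≤a))
      where
      open Merge mg
      le : ∀ {R} → R ∈ Rs → maxKey R a ≤ maxKey R b
      le {R} r with R ∋ a ~? b
      ... | yes e = ≤-reflexive (cong toℕ (mx-cong (pt r) e))
      ... | no ¬e = ≤-trans (≤-reflexive (cong toℕ (max⇒mx (pt r) (max-anti R⊑Z max-a) (~refl (pt r)))))
                            (≤-trans (<⇒≤ a<b) (≤mx (pt r) (~refl (pt r))))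
        where
        -- A member that does not relate `a` and `b` cannot contain Y; between Z and Y it equals Z.
        -- So it refines Z, and `a` is still a maximum in it.
        R⊑Z : R ⊑ᵐ Z
        R⊑Z with nested-comparable nested r (in-Rs j) | nested-comparable nested r (in-Rs i)
        ... | inj₁ h | _ = ≼⇒⊑ R Z h
        ... | inj₂ _ | inj₂ h = ⊥-elim (¬e (≼⇒⊑ Y R h Yab))
        ... | inj₂ h | inj₁ g = λ e → [ id , [ (λ { (p , q) → ⊥-elim (¬e (via e p q)) })
                                             , (λ { (p , q) → ⊥-elim (¬e (via (~sym (pt r) e) q p)) }) ]′ ]′ (merged (≼⇒⊑ R Y g e))
          where
          via : ∀ {w x} → R ∋ w ~ x → Z ∋ w ~ a → Z ∋ x ~ b → R ∋ a ~ b
          via e p q = ~trans (pt r) (≼⇒⊑ Z R h (~sym pZ p)) (~trans (pt r) e (≼⇒⊑ Z R h q))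
      a-b : ρ a < ρ b
      a-b = Lt⇒< (KeyOrder.key-lex nested valid le a<b)
      u≤a : ρ u ≤ ρ a
      u≤a with u Fₚ.≟ a
      ... | yes refl = ≤-refl
      ... | no ne = <⇒≤ (last j max-a (~sym pZ au) ne)
      -- A letter of the block of `b` at or before `a` would force `a` into that block by convexity,
      -- as `a` precedes `b`.
      contra : (ρ v < ρ a) ⊎ (ρ v ≡ ρ a) → ⊥
      contra (inj₁ l) = ¬Zab (~trans pZ (~sym pZ (KeyOrder.sorted-convex nested valid so (in-Rs j) l a-b (~sym pZ bv))) (~sym pZ bv))
      contra (inj₂ e) = ¬Zab (~sym pZ (subst (λ x → Z ∋ b ~ x) (Rank.injective rk e) bv))

  crossing-prt : ∀ {X Y c ls} {Q : Mat n → Set} → (∀ R → Dec (Q R)) → MC (prt X) (prt Y) c → Labels c ls → ¬ Q X → Q Y →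
                 ∃ λ Y' → ∃ λ Z → ∃ λ ℓ → StepIn c ls (prt Y') (prt Z) ℓ × ¬ Q Y' × Q Z
  crossing-prt {X} {Y} {c} {ls} {Q} Q? m lb ¬q q = go (crossing Q'? m lb ¬q q)
    where
    Q' : Pt n → Set
    Q' bot = ⊤
    Q' (prt R) = Q R
    Q'? : ∀ w → Dec (Q' w)
    Q'? bot = yes tt
    Q'? (prt R) = Q? R
    go : (∃ λ Y → ∃ λ Z → ∃ λ ℓ → StepIn c ls Y Z ℓ × ¬ Q' Y × Q' Z) → _
    go (bot , Z , ℓ , s , ¬p , p) = ⊥-elim (¬p tt)
    go (prt Y' , bot , ℓ , s , ¬p , p) = ⊥-elim (mc-≼ʳ m (proj₂ (step-∈ s)))
    go (prt Y' , prt Z , ℓ , s , ¬p , p) = Y' , Z , ℓ , s , ¬p , p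

  record Side (X Y : Mat n) (ρ : Fin n → ℕ) (c : List (Pt n)) (ls : List ℤ) : Set where
    field
      mc   : MC (prt X) (prt Y) c
      labs : Labels c ls
      desc : Descending ls
      orient : Oriented ρ c

    merge-of : ∀ {Y' Z ℓ} → StepIn c ls (prt Y') (prt Z) ℓ → Merge Y' Z ℓ
    merge-of s = lab⇒merge (step-cover mc s) (step-lab labs s)

    Y⊑ : ∀ {R} → prt R ∈ c → Y ⊑ᵐ R
    Y⊑ {R} i = ≼⇒⊑ Y R (mc-≼ʳ mc i)

    ⊑X : ∀ {R} → prt R ∈ c → R ⊑ᵐ X
    ⊑X {R} i = ≼⇒⊑ R X (mc-≼ˡ mc i)

  -- The step of c at which the letter f becomes a block maximum.
  record Event {X Y ρ c ls} (S : Side X Y ρ c ls) (f : Fin n) (ℓ : ℤ) : Set where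
    field
      {Yₑ Zₑ} : Mat n
      stepₑ   : StepIn c ls (prt Yₑ) (prt Zₑ) ℓ
    mg : Merge Yₑ Zₑ ℓ
    mg = Side.merge-of S stepₑ
    field
      a≡ : Merge.a mg ≡ f
    Y∈ = proj₁ (step-∈ stepₑ)
    Z∈ = proj₂ (step-∈ stepₑ)

  event : ∀ {X Y ρ c ls} (S : Side X Y ρ c ls) {f} → ¬ Max X f → Max Y f →
          Event S f -[1+ toℕ f ] ⊎ Event S f (+ suc (toℕ f))
  event {ρ = ρ} S {f} ¬mX mY with crossing-prt (λ R → Max? R f) (Side.mc S) (Side.labs S) ¬mX mY
  ... | Y' , Z , ℓ , s , ¬q , q = go (Merge.sign mg)
    where
    mg = Side.merge-of S s
    e = Merge.newmax mg q ¬q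
    at : ∀ {ℓ'} → ℓ ≡ ℓ' → Event S f ℓ'
    at refl = record { stepₑ = s ; a≡ = sym e }
    go : Sign Z (Merge.a mg) (Merge.b mg) ℓ → Event S f -[1+ toℕ f ] ⊎ Event S f (+ suc (toℕ f))
    go (inj₁ (_ , q)) = inj₁ (at (trans q (cong (λ v → -[1+ toℕ v ]) (sym e))))
    go (inj₂ (_ , q)) = inj₂ (at (trans q (cong (λ v → + suc (toℕ v)) (sym e))))

  neg-event : ∀ {X Y ρ c ls} {S : Side X Y ρ c ls} {f} (E : Event S f -[1+ toℕ f ]) →
              ∀ {j} → Event.Zₑ E ∋ Merge.b (Event.mg E) ~ j → toℕ f < toℕ j
  neg-event {f = f} E {j} e with Merge.sign (Event.mg E)
  ... | inj₁ (h , _) = subst (λ v → toℕ v < toℕ j) (Event.a≡ E) (h e)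
  ... | inj₂ (_ , ())

  pos-event : ∀ {X Y ρ c ls} {S : Side X Y ρ c ls} {f} (E : Event S f (+ suc (toℕ f))) →
              ∃ λ j → (Event.Zₑ E ∋ Merge.b (Event.mg E) ~ j) × toℕ j < toℕ f
  pos-event {f = f} E with Merge.sign (Event.mg E)
  ... | inj₁ (_ , ())
  ... | inj₂ ((j , e , l) , _) = j , e , subst (λ v → toℕ j < toℕ v) (Event.a≡ E) l

  -- Two generators of one complex may switch the same word differently below their common member Y;
  -- what they share is the order of letters from different blocks of Y.
  Agrees : Mat n → (Fin n → ℕ) → (Fin n → ℕ) → Set
  Agrees Y ρ ρ' = ∀ {u v} → ¬ (Y ∋ u ~ v) → ρ u < ρ v → ρ' u < ρ' v

  module _ {X Y : Mat n} where

    -- If the label of a is negative in one descending chain and positive in another, the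
    -- opposite happens for some f to the right of a.
    transfer : ∀ {ρ₁ c₁ ls₁ ρ₂ c₂ ls₂} (S₁ : Side X Y ρ₁ c₁ ls₁) (S₂ : Side X Y ρ₂ c₂ ls₂) →
               Agrees Y ρ₁ ρ₂ → Agrees Y ρ₂ ρ₁ → ∀ {a} → Event S₁ a -[1+ toℕ a ] → Event S₂ a (+ suc (toℕ a)) →
               ∃ λ f → Event S₁ f (+ suc (toℕ f)) × Event S₂ f -[1+ toℕ f ] × ρ₁ a < ρ₁ f × ρ₂ a < ρ₂ f
    transfer {ρ₁} {c₁} {ls₁} {ρ₂} S₁ S₂ ag₁₂ ag₂₁ {a} E₁ E₂ = result
        (crossing-prt (λ R → ¬? (R ∋ a ~? e)) (Side.mc S₁) (Side.labs S₁) (λ h → h Xae) Yae)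
      where
      module E₁ = Event E₁
      module E₂ = Event E₂
      module M₁ = Merge E₁.mg
      module M₂ = Merge E₂.mg
      O₁ = Side.orient S₁
      O₂ = Side.orient S₂
      ex = pos-event E₂
      e = proj₁ ex
      Z₂be : E₂.Zₑ ∋ M₂.b ~ e
      Z₂be = proj₁ (proj₂ ex)
      e<a : toℕ e < toℕ a
      e<a = proj₂ (proj₂ ex)
      e≢a : e ≢ a
      e≢a q = <-irrefl (cong toℕ q) e<a
      Z₁aa : E₁.Zₑ ∋ M₁.a ~ a
      Z₁aa = subst (λ x → E₁.Zₑ ∋ M₁.a ~ x) E₁.a≡ (~refl M₁.pZ)
      Z₂aa : E₂.Zₑ ∋ M₂.a ~ a
      Z₂aa = subst (λ x → E₂.Zₑ ∋ M₂.a ~ x) E₂.a≡ (~refl M₂.pZ)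
      ¬Z₂ae : ¬ (E₂.Zₑ ∋ a ~ e)
      ¬Z₂ae q = M₂.¬Zab (~trans M₂.pZ Z₂aa (~trans M₂.pZ q (~sym M₂.pZ Z₂be)))
      Y₂ae : E₂.Yₑ ∋ a ~ e
      Y₂ae = ~trans M₂.pY (~sym M₂.pY (M₂.sub Z₂aa)) (~trans M₂.pY M₂.Yab (M₂.sub Z₂be))
      Yae : ¬ (Y ∋ a ~ e)
      Yae q = ¬Z₂ae (Side.Y⊑ S₂ E₂.Z∈ q)
      Xae : X ∋ a ~ e
      Xae = Side.⊑X S₂ E₂.Y∈ Y₂ae
      ρ₁ae : ρ₁ a < ρ₁ e
      ρ₁ae = ag₂₁ Yae (Oriented.ordered O₂ E₂.Y∈ E₂.Z∈ E₂.mg Z₂aa Z₂be)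
      max₁ : Max E₁.Zₑ a
      max₁ = subst (Max E₁.Zₑ) E₁.a≡ M₁.max-a
      ¬max₁ : ¬ Max E₁.Yₑ a
      ¬max₁ h = M₁.¬max-a (subst (Max E₁.Yₑ) (sym E₁.a≡) h)
      -- The letter `e`, smaller than `a`, lies to its right in both words. It cannot belong to the
      -- part whose last letter is `a`, nor to the other part, since the label is negative.
      -- Therefore the first chain separates `a` from `e` strictly earlier.
      ¬Y₁ae : ¬ (E₁.Yₑ ∋ a ~ e)
      ¬Y₁ae q =
        [ (λ z → <-asym ρ₁ae (Oriented.max-last O₁ E₁.Z∈ max₁ (~sym M₁.pZ (~trans M₁.pZ (~sym M₁.pZ Z₁aa) z)) e≢a))
        , (λ z → <-asym e<a (neg-event E₁ z)) ]′
        (M₁.block-a (subst (λ x → E₁.Yₑ ∋ x ~ e) (sym E₁.a≡) q))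
      result : (∃ λ Y' → ∃ λ Z → ∃ λ ℓ → StepIn c₁ ls₁ (prt Y') (prt Z) ℓ × ¬ ¬ (Y' ∋ a ~ e) × ¬ (Z ∋ a ~ e)) →
               ∃ λ f → Event S₁ f (+ suc (toℕ f)) × Event S₂ f -[1+ toℕ f ] × ρ₁ a < ρ₁ f × ρ₂ a < ρ₂ f
      result (Y' , Z' , ℓ , s , ¬¬Y'ae , ¬Z'ae) = f , F₁ , F₂ , ρ₁af , ag₁₂ Yaf ρ₁af
        where
        mg = Side.merge-of S₁ s
        open Merge mg using (pY; pZ; max-a; max-b; ¬max-a) renaming (a to f; b to g)
        Y'∈ = proj₁ (step-∈ s)
        Z'∈ = proj₂ (step-∈ s)
        Y'ae : Y' ∋ a ~ e
        Y'ae = decidable-stable (Y' ∋ a ~? e) ¬¬Y'ae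
        sides : (Z' ∋ f ~ a) × (Z' ∋ g ~ e)
        sides = [ id , (λ { (ga , fe) → ⊥-elim (<-asym ρ₁ae (Oriented.ordered O₁ Y'∈ Z'∈ mg fe ga)) }) ]′
                (Merge.separated mg Y'ae ¬Z'ae)
        -- The separating step precedes the creation of `a`, so its label exceeds the label of `a`.
        -- As f > a, a negative label is ruled out, and `f` is created positively.
        earlier : (E₁.Yₑ ⊑ᵐ Z') × ¬ (ℓ ℤ.≤ -[1+ toℕ a ])
        earlier = go (step-order ¬≤-trans (Side.mc S₁) (Side.desc S₁) s E₁.stepₑ)
          where
          go : StepOrder (λ x y → ¬ (x ℤ.≤ y)) (prt Y') (prt Z') ℓ (prt E₁.Yₑ) (prt E₁.Zₑ) -[1+ toℕ a ] →
               (E₁.Yₑ ⊑ᵐ Z') × ¬ (ℓ ℤ.≤ -[1+ toℕ a ])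
          go (inj₁ (q , _)) = ⊥-elim (¬Y₁ae (subst (λ R → R ∋ a ~ e) (prt-injective q) Y'ae))
          go (inj₂ (inj₁ (q , l))) = ≼⇒⊑ E₁.Yₑ Z' q , l
          go (inj₂ (inj₂ (q , _))) = ⊥-elim (¬Y₁ae (M₁.sub (≼⇒⊑ Y' E₁.Zₑ q Y'ae)))
        f≢a : f ≢ a
        f≢a q = ¬max₁ (max-anti (proj₁ earlier) (subst (Max Z') q max-a))
        a<f : toℕ a < toℕ f
        a<f = ≤∧≢⇒< (above max-a (proj₁ sides)) λ q → f≢a (sym (Fₚ.toℕ-injective q))
        ρ₁af : ρ₁ a < ρ₁ f
        ρ₁af = Oriented.max-last O₁ Z'∈ max-a (~sym pZ (proj₁ sides)) (f≢a ∘ sym)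
        ρ₁fe : ρ₁ f < ρ₁ e
        ρ₁fe = Oriented.ordered O₁ Y'∈ Z'∈ mg (~refl pZ) (proj₂ sides)
        F₁ : Event S₁ f (+ suc (toℕ f))
        F₁ = go (Merge.sign mg)
          where
          at : ∀ {ℓ'} → ℓ ≡ ℓ' → Event S₁ f ℓ'
          at refl = record { stepₑ = s ; a≡ = refl }
          go : Sign Z' f g ℓ → Event S₁ f (+ suc (toℕ f))
          go (inj₁ (_ , q)) = ⊥-elim (proj₂ earlier (subst (ℤ._≤ -[1+ toℕ a ]) (sym q) (ℤ.-≤- (<⇒≤ a<f))))
          go (inj₂ (_ , q)) = at q
        pYY = validPart Y (mc-validʳ (Side.mc S₁))
        maxY-f : Max Y f
        maxY-f = max-anti (Side.Y⊑ S₁ Z'∈) max-a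
        maxY-a : Max Y a
        maxY-a = max-anti (Side.Y⊑ S₁ E₁.Z∈) max₁
        Yaf : ¬ (Y ∋ a ~ f)
        Yaf q = f≢a (sym (max-unique pYY maxY-a maxY-f q))
        Yfe : ¬ (Y ∋ f ~ e)
        Yfe q = Merge.¬Zab mg (~trans pZ (Side.Y⊑ S₁ Z'∈ q) (~sym pZ (proj₂ sides)))
        ρ₂fe : ρ₂ f < ρ₂ e
        ρ₂fe = ag₁₂ Yfe ρ₁fe
        -- In the second chain `a` and `e` are still together when `a` is created, and `f` lies
        -- between them.
        Y₂af : E₂.Yₑ ∋ a ~ f
        Y₂af = Oriented.convex O₂ E₂.Y∈ (ag₁₂ Yaf ρ₁af) ρ₂fe Y₂ae
        ¬max₂ : ¬ Max E₂.Yₑ f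
        ¬max₂ h = <-asym ρ₂fe (Oriented.max-last O₂ E₂.Z∈ (subst (Max E₂.Zₑ) (sym f≡b) M₂.max-b)
                    (subst (λ x → E₂.Zₑ ∋ e ~ x) (sym f≡b) (~sym M₂.pZ Z₂be))
                    (λ q → Yfe (subst (λ x → Y ∋ x ~ e) q (~refl pYY))))
          where
          f≡b : f ≡ M₂.b
          f≡b = max-unique M₂.pY h M₂.max-b-Y (~trans M₂.pY (~sym M₂.pY Y₂af)
                  (~trans M₂.pY (~sym M₂.pY (M₂.sub Z₂aa)) M₂.Yab))
        -- The second chain creates `f` only after `a`. A positive label would then be larger than
        -- the earlier label of `a`, against descent.
        F₂ : Event S₂ f -[1+ toℕ f ]
        F₂ = [ id , (λ E → ⊥-elim (late E (step-order ¬≤-trans (Side.mc S₂) (Side.desc S₂) (Event.stepₑ E) E₂.stepₑ))) ]′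
             (event S₂ (λ h → ¬max₂ (max-anti (Side.⊑X S₂ E₂.Y∈) h)) maxY-f)
          where
          max-E : ∀ {ℓ'} (E : Event S₂ f ℓ') → Max (Event.Zₑ E) f
          max-E E = subst (Max (Event.Zₑ E)) (Event.a≡ E) (Merge.max-a (Event.mg E))
          late : (E : Event S₂ f (+ suc (toℕ f))) →
                 StepOrder (λ x y → ¬ (x ℤ.≤ y)) (prt (Event.Yₑ E)) (prt (Event.Zₑ E)) (+ suc (toℕ f))
                           (prt E₂.Yₑ) (prt E₂.Zₑ) (+ suc (toℕ a)) → ⊥
          late E (inj₁ (_ , q , _)) =
            f≢a (trans (Merge.newmax E₂.mg (subst (λ R → Max R f) (prt-injective q) (max-E E)) ¬max₂) E₂.a≡)
          late E (inj₂ (inj₁ (q , _))) = ¬max₂ (max-anti (≼⇒⊑ E₂.Yₑ (Event.Zₑ E) q) (max-E E))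
          late E (inj₂ (inj₂ (_ , l))) = l (ℤ.+≤+ (s≤s (<⇒≤ a<f)))

    -- Each use of `transfer` exchanges the two chains and moves the letter strictly to the right in
    -- both words. The fuel `g` bounds the positions that remain.
    clash : ∀ g {ρ₁ c₁ ls₁ ρ₂ c₂ ls₂} (S₁ : Side X Y ρ₁ c₁ ls₁) (S₂ : Side X Y ρ₂ c₂ ls₂) →
            Agrees Y ρ₁ ρ₂ → Agrees Y ρ₂ ρ₁ → ∀ {a} → n ≤ g + ρ₁ a → n ≤ g + ρ₂ a →
            Event S₁ a -[1+ toℕ a ] → Event S₂ a (+ suc (toℕ a)) → ⊥
    clash zero S₁ S₂ _ _ {a} le _ _ _ = <⇒≱ (Rank.bounded (Oriented.rank (Side.orient S₁)) a) le
    clash (suc g) {ρ₁} {ρ₂ = ρ₂} S₁ S₂ ag₁₂ ag₂₁ {a} le₁ le₂ E₁ E₂ = go (transfer S₁ S₂ ag₁₂ ag₂₁ E₁ E₂)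
      where
      more : ∀ {f} (ρ : Fin n → ℕ) → n ≤ suc g + ρ a → ρ a < ρ f → n ≤ g + ρ f
      more ρ le l = ≤-trans le (≤-trans (≤-reflexive (sym (+-suc g (ρ a)))) (+-monoʳ-≤ g l))
      go : (∃ λ f → Event S₁ f (+ suc (toℕ f)) × Event S₂ f -[1+ toℕ f ] × ρ₁ a < ρ₁ f × ρ₂ a < ρ₂ f) → ⊥
      go (f , F₁ , F₂ , l₁ , l₂) = clash g S₂ S₁ ag₂₁ ag₁₂ (more ρ₂ le₂ l₂) (more ρ₁ le₁ l₁) F₂ F₁

    -- Both chains create the maxima of Y that are not maxima of X, and `clash` forces the signs to
    -- agree.
    label-shared : ∀ {ρ₁ c₁ ls₁ ρ₂ c₂ ls₂} (S₁ : Side X Y ρ₁ c₁ ls₁) (S₂ : Side X Y ρ₂ c₂ ls₂) →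
                   Agrees Y ρ₁ ρ₂ → Agrees Y ρ₂ ρ₁ → ∀ {Y' Z ℓ} → StepIn c₁ ls₁ (prt Y') (prt Z) ℓ → ℓ ∈ ls₂
    label-shared {ρ₁} {c₁} {ls₁} {ρ₂} {c₂} {ls₂} S₁ S₂ ag₁₂ ag₂₁ {Y'} {Z} {ℓ} s =
        go (Merge.sign mg) (event S₂ (λ h → ¬max-a (max-anti (Side.⊑X S₁ (proj₁ (step-∈ s))) h))
                                     (max-anti (Side.Y⊑ S₁ (proj₂ (step-∈ s))) max-a))
      where
      mg = Side.merge-of S₁ s
      open Merge mg using (a; b; ¬max-a; max-a)
      at : ∀ {ℓ'} → ℓ ≡ ℓ' → Event S₁ a ℓ'
      at refl = record { stepₑ = s ; a≡ = refl }
      go : Sign Z a b ℓ → Event S₂ a -[1+ toℕ a ] ⊎ Event S₂ a (+ suc (toℕ a)) → ℓ ∈ ls₂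
      go (inj₁ (_ , q)) (inj₁ E) = subst (_∈ ls₂) (sym q) (step-label∈ (Event.stepₑ E))
      go (inj₂ (_ , q)) (inj₂ E) = subst (_∈ ls₂) (sym q) (step-label∈ (Event.stepₑ E))
      go (inj₁ (_ , q)) (inj₂ E) = ⊥-elim (clash n S₁ S₂ ag₁₂ ag₂₁ (m≤m+n n _) (m≤m+n n _) (at q) E)
      go (inj₂ (_ , q)) (inj₁ E) = ⊥-elim (clash n S₂ S₁ ag₂₁ ag₁₂ (m≤m+n n _) (m≤m+n n _) E (at q))

    sign-a : ∀ {Z Z' a a' b b' ℓ} → Sign Z a b ℓ → Sign Z' a' b' ℓ → a ≡ a'
    sign-a (inj₁ (_ , refl)) (inj₁ (_ , q)) = Fₚ.toℕ-injective (ℤₚ.-[1+-injective q)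
    sign-a (inj₁ (_ , refl)) (inj₂ (_ , ()))
    sign-a (inj₂ (_ , refl)) (inj₁ (_ , ()))
    sign-a (inj₂ (_ , refl)) (inj₂ (_ , q)) = Fₚ.toℕ-injective (suc-injective (ℤₚ.+-injective q))

    -- Equal labels create the same maximum, which is last in the left part. A letter of that part
    -- for Z lying in the right part for Z' would follow the maximum in the second word, hence by
    -- agreement in the first, where it precedes it.
    first-block : ∀ {ρ₁ c₁ ρ₂ c₂ Z Z' ℓ} → Oriented ρ₁ c₁ → Oriented ρ₂ c₂ → Agrees Y ρ₂ ρ₁ → Y ⊑ᵐ Z' →
                  prt Z ∈ c₁ → prt X ∈ c₂ → prt Z' ∈ c₂ → (mg : Merge X Z ℓ) (mg' : Merge X Z' ℓ) →
                  ∀ {u} → Z ∋ Merge.a mg ~ u → Z' ∋ Merge.a mg' ~ u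
    first-block {ρ₁} {ρ₂ = ρ₂} {Z = Z} {Z'} O₁ O₂ ag Y⊑ Z∈ X∈ Z'∈ mg mg' {u} z =
        [ id , (λ bu → decidable-stable (Z' ∋ M₂.a ~? u) λ ¬z' → bad bu ¬z') ]′
          (M₂.block-a (subst (λ x → X ∋ x ~ u) a≡ (M₁.sub z)))
      where
      module M₁ = Merge mg
      module M₂ = Merge mg'
      a≡ : M₁.a ≡ M₂.a
      a≡ = sign-a M₁.sign M₂.sign
      bad : Z' ∋ M₂.b ~ u → ¬ (Z' ∋ M₂.a ~ u) → ⊥
      bad bu ¬z' = <-asym u<a a<u
        where
        u<a : ρ₁ u < ρ₁ M₁.a
        u<a = Oriented.max-last O₁ Z∈ M₁.max-a (~sym M₁.pZ z) λ q →
          ¬z' (subst (λ x → Z' ∋ M₂.a ~ x) (trans (sym a≡) (sym q)) (~refl M₂.pZ))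
        a<u : ρ₁ M₁.a < ρ₁ u
        a<u = subst (λ x → ρ₁ x < ρ₁ u) (sym a≡) (ag (λ q → ¬z' (Y⊑ q)) (Oriented.ordered O₂ X∈ Z'∈ mg' (~refl M₂.pZ) bu))

    same-step : ∀ {ρ₁ c₁ ρ₂ c₂ Z Z' ℓ} → Oriented ρ₁ c₁ → Oriented ρ₂ c₂ → Agrees Y ρ₁ ρ₂ → Agrees Y ρ₂ ρ₁ →
                Y ⊑ᵐ Z → Y ⊑ᵐ Z' → prt X ∈ c₁ → prt Z ∈ c₁ → prt X ∈ c₂ → prt Z' ∈ c₂ →
                Merge X Z ℓ → Merge X Z' ℓ → Z ≡ Z'
    same-step O₁ O₂ ag₁₂ ag₂₁ Y⊑Z Y⊑Z' X∈₁ Z∈ X∈₂ Z'∈ mg mg' =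
      trans (merge-split mg) (trans (split-cong
          (λ m → row⁺ (first-block O₁ O₂ ag₂₁ Y⊑Z' Z∈ X∈₂ Z'∈ mg mg' (row⁻ m)))
          (λ m → row⁺ (first-block O₂ O₁ ag₁₂ Y⊑Z Z'∈ X∈₁ Z∈ mg' mg (row⁻ m))))
        (sym (merge-split mg')))

  head-max : ∀ {ℓ ls ℓ'} → Descending (ℓ ∷ ls) → ℓ' ∈ (ℓ ∷ ls) → ℓ' ≡ ℓ ⊎ ¬ (ℓ ℤ.≤ ℓ')
  head-max _ (here e) = inj₁ e
  head-max ds (there i) = inj₂ (linked-all ¬≤-trans ds i)

  head-unique : ∀ {ℓ ℓ' ls ls'} → Descending (ℓ ∷ ls) → Descending (ℓ' ∷ ls') → ℓ ∈ (ℓ' ∷ ls') → ℓ' ∈ (ℓ ∷ ls) → ℓ ≡ ℓ'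
  head-unique {ℓ} {ℓ'} ds ds' i j with head-max ds' i | head-max ds j
  ... | inj₁ e | _ = e
  ... | inj₂ _ | inj₁ e = sym e
  ... | inj₂ h | inj₂ g = ⊥-elim ([ h , g ]′ (ℤₚ.≤-total ℓ' ℓ))

  -- A descending chain starts with its largest label. The label sets coincide, so the first labels
  -- do; then the first steps coincide by `same-step`, and the tails follow by induction.
  descending-unique : ∀ {ρ₁ ρ₂ Y} → Agrees Y ρ₁ ρ₂ → Agrees Y ρ₂ ρ₁ → ∀ {X c₁ ls₁ c₂ ls₂} →
                      MC (prt X) (prt Y) c₁ → Labels c₁ ls₁ → Descending ls₁ → Oriented ρ₁ c₁ →
                      MC (prt X) (prt Y) c₂ → Labels c₂ ls₂ → Descending ls₂ → Oriented ρ₂ c₂ → c₁ ≡ c₂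
  descending-unique _ _ (single _) _ _ _ m₂ _ _ _ = sym (mc-refl m₂)
  descending-unique _ _ m₁@(step _ _) _ _ _ (single _) _ _ _ = mc-refl m₁
  descending-unique {Y = Y} ag₁₂ ag₂₁ (step {y = bot} _ m₁) _ _ _ (step _ _) _ _ _ = ⊥-elim (mc-≼ m₁)
  descending-unique {Y = Y} ag₁₂ ag₂₁ (step {y = prt _} _ _) _ _ _ (step {y = bot} _ m₂) _ _ _ = ⊥-elim (mc-≼ m₂)
  descending-unique {ρ₁} {ρ₂} {Y} ag₁₂ ag₂₁ {X} M₁@(step {y = prt Z₁} {c = d₁} cv₁ m₁) lb₁ ds₁ O₁
                    M₂@(step {y = prt Z₂} {c = d₂} cv₂ m₂) lb₂ ds₂ O₂ =
      go (labels-head m₁ lb₁) (labels-head m₂ lb₂)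
    where
    go : (∃ λ ℓ → ∃ λ ls → _ ≡ ℓ ∷ ls × Lab (prt X) (prt Z₁) ℓ × Labels d₁ ls) →
         (∃ λ ℓ → ∃ λ ls → _ ≡ ℓ ∷ ls × Lab (prt X) (prt Z₂) ℓ × Labels d₂ ls) → prt X ∷ d₁ ≡ prt X ∷ d₂
    go (ℓ₁ , ls₁ , refl , l₁ , r₁) (ℓ₂ , ls₂ , refl , l₂ , r₂) = finish ℓ≡ Z≡
      where
      S₁ : Side X Y ρ₁ (prt X ∷ d₁) (ℓ₁ ∷ ls₁)
      S₁ = record { mc = M₁ ; labs = lb₁ ; desc = ds₁ ; orient = O₁ }
      S₂ : Side X Y ρ₂ (prt X ∷ d₂) (ℓ₂ ∷ ls₂)
      S₂ = record { mc = M₂ ; labs = lb₂ ; desc = ds₂ ; orient = O₂ }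
      first-step : ∀ {Z d ℓ ls} → MC (prt Z) (prt Y) d → StepIn (prt X ∷ d) (ℓ ∷ ls) (prt X) (prt Z) ℓ
      first-step m with mc-head m
      ... | _ , refl = here
      ℓ≡ : ℓ₁ ≡ ℓ₂
      ℓ≡ = head-unique ds₁ ds₂ (label-shared S₁ S₂ ag₁₂ ag₂₁ (first-step m₁)) (label-shared S₂ S₁ ag₂₁ ag₁₂ (first-step m₂))
      Z≡ : Z₁ ≡ Z₂
      Z≡ = same-step O₁ O₂ ag₁₂ ag₂₁ (≼⇒⊑ Y Z₁ (mc-≼ m₁)) (≼⇒⊑ Y Z₂ (mc-≼ m₂))
             (here refl) (there (mc-x∈ m₁)) (here refl) (there (mc-x∈ m₂))
             (lab⇒merge cv₁ l₁) (subst (Merge X Z₂) (sym ℓ≡) (lab⇒merge cv₂ l₂))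
      finish : ℓ₁ ≡ ℓ₂ → Z₁ ≡ Z₂ → prt X ∷ d₁ ≡ prt X ∷ d₂
      finish _ refl = cong (prt X ∷_) (descending-unique {ρ₁} {ρ₂} {Y} ag₁₂ ag₂₁
        m₁ r₁ (linked-tail ds₁) (oriented-⊆ there O₁) m₂ r₂ (linked-tail ds₂) (oriented-⊆ there O₂))

-- Descending chains to the bottom, and the final assembly.

module Assembly (n d k : ℕ) (1<d : 1 < d) (n≡ : n ≡ k * d) where

  open Poset n d k 1<d n≡
  open EL n d k 1<d n≡ using (labels-head)
  open ELProof n d k 1<d n≡ using (isDualEL)
  open Cuts n d k 1<d n≡
  open Cube n d k 1<d n≡
  open Keys n d k 1<d n≡
  open Minimal n d k 1<d n≡
  open Collection n d k 1<d n≡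
  open Boundary n d k 1<d n≡
  open Descents n d k 1<d n≡
  open Polytope n d k 1<d n≡ using (isPolytope)

  generator : IdxA n d → List (Pt n) → Set
  generator = Gen (IdxA n d) _<ʳ_ InΣ

  module Generator (s : IdxA n d) {M : List (Pt n)} (gen : generator s M) where

    m : MC top bot M
    m = proj₁ gen

    inΣ : All (InΣ s) M
    inΣ = proj₁ (proj₂ gen)

    open ChainWord {M} (mc-chain m) public using (Rs; nested; valid; z∈; z-low; Sorted)
    open SigmaFrame s z∈ z-low (mats-Σ s inΣ) public using (f; full; ρ; rk; rep)

    sorted : Sorted ρ
    sorted = gen-sorted {s} {M} m inΣ (proj₂ (proj₂ gen))

    oriented : Oriented ρ M
    oriented = sorted⇒oriented (mc-chain m) rk sorted

    actsOf : ∀ {R} → prt R ∈ M → ∃ λ c → R ≡ Index.P s c × c ⊑ᵃ f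
    actsOf i = rep (there (proper⁺ i))

  P-acts : ∀ s {a a'} → Index.P s a ≡ Index.P s a' → a ⊑ᵃ a'
  P-acts s {a} {a'} e = Index.P-reflects s {a'} {a} (subst (λ R → Index.P s a' ⊑ᵐ R) (sym e) id)

  -- Switches outside the cuts of Y do not carry a letter across these cuts. A pair whose order
  -- differs in the two words is therefore on the same side of each cut of Y, that is, in one block.
  agrees : ∀ s f f' {Y} → (∃ λ a → Y ≡ Index.P s a × a ⊑ᵃ f) → (∃ λ a' → Y ≡ Index.P s a' × a' ⊑ᵃ f') →
           Agrees Y (Index.ρ s f) (Index.ρ s f')
  agrees s f f' (a , refl , le) (a' , e , le') {u} {v} ¬uv l = ≰⇒> λ v≤u → ¬uv (Index.P⁺ s {a} {f} le λ t ne →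
      let g = sameSide-⊑ {a} {f} le t ne
          g' = sameSide-⊑ {a} {f'} a⊑f' t ne
      in (λ x → proj₁ (g (posOf s v)) (proj₂ (g' (posOf s v)) (≤-<-trans v≤u (proj₁ (g' (posOf s u)) (proj₂ (g (posOf s u)) x))))) ,
         (λ x → <-trans l x))
    where
    a⊑f' : a ⊑ᵃ f'
    a⊑f' t ne = let q = P-acts s {a} {a'} e t ne in trans (le' t λ r → ne (trans (sym q) r)) q

  linked-prefix : ∀ {T : ℤ → ℤ → Set} ls {ls'} → Linked T (ls ++ ls') → Linked T ls
  linked-prefix [] _ = []
  linked-prefix (ℓ ∷ []) _ = [-]
  linked-prefix (ℓ ∷ ℓ' ∷ ls) (t ∷ l) = t ∷ linked-prefix (ℓ' ∷ ls) l

  linked-last : ∀ {T : ℤ → ℤ → Set} → (∀ {a b c} → T a b → T b c → T a c) →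
                ∀ ls {e} → Linked T (ls ++ e ∷ []) → ∀ {ℓ} → ℓ ∈ ls → T ℓ e
  linked-last tr (ℓ ∷ ls) l (here refl) = linked-all tr l (∈-++⁺ʳ ls (here refl))
  linked-last tr (ℓ ∷ ls) l (there i) = linked-last tr ls (linked-tail l) i

  record ToBottom (X : Mat n) (c : List (Pt n)) (ls : List ℤ) : Set where
    field
      Z      : Mat n
      c₀     : List (Pt n)
      ls₀    : List ℤ
      c≡     : c ≡ c₀ ++ bot ∷ []
      ls≡    : ls ≡ ls₀ ++ (+ 0) ∷ []
      mc₀    : MC (prt X) (prt Z) c₀
      labs₀  : Labels c₀ ls₀
      atom   : Covers (prt Z) bot

  toBottom : ∀ {X c ls} → MC (prt X) bot c → Labels c ls → ToBottom X c ls
  toBottom {X} (step {y = bot} cv m) lb with mc-refl m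
  toBottom {X} (step {y = bot} cv m) (cons refl one) | refl = record
    { Z = X ; c₀ = prt X ∷ [] ; ls₀ = [] ; c≡ = refl ; ls≡ = refl
    ; mc₀ = single (Covers.validʸ cv) ; labs₀ = one ; atom = cv }
  toBottom {X} (step {y = prt W} {c = c} cv m) lb with labels-head m lb
  ... | ℓ , ls' , refl , l , lb' with toBottom m lb'
  ...   | B = record
    { Z = Z ; c₀ = prt X ∷ c₀ ; ls₀ = ℓ ∷ ls₀ ; c≡ = cong (prt X ∷_) c≡ ; ls≡ = cong (ℓ ∷_) ls≡
    ; mc₀ = step cv mc₀ ; labs₀ = extend mc₀ labs₀ ; atom = atom }
    where
    open ToBottom B
    extend : ∀ {c₀ ls₀} → MC (prt W) (prt Z) c₀ → Labels c₀ ls₀ → Labels (prt X ∷ c₀) (ℓ ∷ ls₀)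
    extend m₀ lb₀ with mc-head m₀
    ... | _ , refl = cons l lb₀

  module Bottom (s : IdxA n d) {M : List (Pt n)} (gen : generator s M) {X : Mat n} {c : List (Pt n)} {ls : List ℤ}
                (B : ToBottom X c ls) (ds : Descending ls) (c⊆M : ∀ {x} → x ∈ c → x ∈ M) where

    open ToBottom B
    open Generator s gen

    c₀⊆M : ∀ {x} → x ∈ c₀ → x ∈ M
    c₀⊆M i = c⊆M (subst (_ ∈_) (sym c≡) (∈-++⁺ˡ i))

    orient₀ : Oriented ρ c₀
    orient₀ = oriented-⊆ c₀⊆M oriented

    desc₀ : Descending ls₀
    desc₀ = linked-prefix ls₀ (subst Descending ls≡ ds)

    -- The last label is 0, so descent makes every label before it positive.
    positive : ∀ {ℓ} → ℓ ∈ ls₀ → ¬ (ℓ ℤ.≤ + 0)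
    positive = linked-last ¬≤-trans ls₀ (subst Descending ls≡ ds)

    side : Side X Z ρ c₀ ls₀
    side = record { mc = mc₀ ; labs = labs₀ ; desc = desc₀ ; orient = orient₀ }

    X∈ : prt X ∈ M
    X∈ = c₀⊆M (mc-x∈ mc₀)

    Z∈ : prt Z ∈ M
    Z∈ = c₀⊆M (mc-y∈ mc₀)

    private
      aX = proj₁ (actsOf X∈)
      X≡ = proj₁ (proj₂ (actsOf X∈))
      aX⊑f = proj₂ (proj₂ (actsOf X∈))
      aZ = proj₁ (actsOf Z∈)
      Z≡ = proj₁ (proj₂ (actsOf Z∈))
      aZ⊑f = proj₂ (proj₂ (actsOf Z∈))
      pZ = validPart Z (Covers.validʸ atom)
      pX = validPart X (mc-validˡ mc₀)

    minimal : ∀ {R} → Valid (prt R) → R ⊑ᵐ Z → Z ⊑ᵐ R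
    minimal {R} vR le {u} {v} zuv with R ∋ u ~? v
    ... | yes e = e
    ... | no ¬e = ⊥-elim (Covers.none atom (prt R) vR (tt , λ ())
                    (⊑⇒≼ le , λ e → ¬e (subst (λ S → S ∋ u ~ v) (sym (prt-injective e)) zuv)))

    aZ-full : Full aZ
    aZ-full t e = <-irrefl (proj₂ v) (proj₁ (Index.P⁻ s {a⁺} {a⁺} (λ _ _ → refl) uv t cut) (subst (_< bd t) (sym (proj₂ u)) (bd-1<bd t)))
      where
      -- If the atom left the cut `t` free, adding a plain split there would produce a strictly
      -- finer valid partition.
      a⁺ : Acts
      a⁺ = aZ Data.Vec.[ t ]≔ split
      at-t : lookup a⁺ t ≡ split
      at-t = Vₚ.lookup∘update t aZ split
      cut : lookup a⁺ t ≢ none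
      cut q = contradiction (trans (sym at-t) q) λ ()
      aZ⊑a⁺ : aZ ⊑ᵃ a⁺
      aZ⊑a⁺ t' ne = Vₚ.lookup∘update′ (λ { refl → ne e }) aZ split
      rk⁺ = Index.ρ-rank s a⁺
      u = leftLetter rk⁺ t
      v = rightLetter rk⁺ t
      zuv : Z ∋ proj₁ u ~ proj₁ v
      zuv = subst (λ R → R ∋ proj₁ u ~ proj₁ v) (sym Z≡) (Index.P⁺ s {aZ} {a⁺} aZ⊑a⁺ λ t' ne →
        subst₂ (SameSide (bd t')) (sym (proj₂ u)) (sym (proj₂ v)) (straddle λ { refl → ne e }))
      uv : Index.P s a⁺ ∋ proj₁ u ~ proj₁ v
      uv = minimal (Index.P-valid s a⁺) (subst (λ R → Index.P s a⁺ ⊑ᵐ R) (sym Z≡) (Index.P-mono s aZ⊑a⁺)) zuv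

    Z-eq : ∀ t → lookup aZ t ≡ lookup f t
    Z-eq t = sym (aZ⊑f t (aZ-full t))

    -- Every member of M is comparable with the atom, hence lies above it; keys are constant on its
    -- blocks and the tie-breaker decides.
    within-Z : ∀ {u v} → Z ∋ u ~ v → ρ u < ρ v → toℕ u < toℕ v
    within-Z {u} {v} zuv l = go (lex-first maxKey toℕ nested (sorted l))
      where
      go : First maxKey toℕ Rs u v → toℕ u < toℕ v
      go (inj₂ (_ , h)) = h
      go (inj₁ (R , i , h , _)) = ⊥-elim (<-irrefl (cong toℕ (mx-cong (validPart R (valid i)) (rel-R (nested-comparable nested i (there (proper⁺ Z∈)))))) h)
        where
        rel-R : (prt R ≼ prt Z) ⊎ (prt Z ≼ prt R) → R ∋ u ~ v
        rel-R (inj₁ q) = minimal (valid i) (≼⇒⊑ R Z q) zuv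
        rel-R (inj₂ q) = ≼⇒⊑ Z R q zuv

    -- A cut made below X on a switched pair has a negative label, unless the next cut to
    -- the right is made later, which a descending chain with positive labels excludes.
    new-cut-split : ∀ t → lookup aX t ≡ none → lookup f t ≡ split
    new-cut-split t eX = go (lookup f t) refl
      where
      uu = leftLetter rk t
      vv = rightLetter rk t
      u = proj₁ uu
      v = proj₁ vv
      ρu<ρv : ρ u < ρ v
      ρu<ρv = subst₂ _<_ (sym (proj₂ uu)) (sym (proj₂ vv)) (bd-1<bd t)
      next : ∀ {w} → ρ u < ρ w → ρ v ≤ ρ w
      next {w} l = subst (_≤ ρ w) (trans (cong suc (proj₂ uu)) (trans (suc-bd-1 t) (sym (proj₂ vv)))) l
      Xuv : X ∋ u ~ v
      Xuv = subst (λ R → R ∋ u ~ v) (sym X≡) (Index.P⁺ s {aX} {f} aX⊑f λ t' ne →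
        subst₂ (SameSide (bd t')) (sym (proj₂ uu)) (sym (proj₂ vv)) (straddle λ { refl → ne eX }))
      Zuv : ¬ (Z ∋ u ~ v)
      Zuv e = <-irrefl (proj₂ vv) (proj₁ (Index.P⁻ s {aZ} {f} aZ⊑f (subst (λ R → R ∋ u ~ v) Z≡ e) t (aZ-full t))
                (subst (_< bd t) (sym (proj₂ uu)) (bd-1<bd t)))
      switched-absurd : toℕ u < toℕ v → ⊥
      switched-absurd u<v = cross (crossing-prt (λ R → ¬? (R ∋ u ~? v)) mc₀ labs₀ (λ h → h Xuv) Zuv)
        where
        cross : (∃ λ Y → ∃ λ W → ∃ λ ℓ → StepIn c₀ ls₀ (prt Y) (prt W) ℓ × ¬ ¬ (Y ∋ u ~ v) × ¬ (W ∋ u ~ v)) → ⊥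
        cross (Y , W , ℓ , st , ¬¬Yuv , ¬Wuv) = conclude sign
          where
          mg = Side.merge-of side st
          open Merge mg renaming (pZ to pW)
          Y∈ = proj₁ (step-∈ st)
          W∈ = proj₂ (step-∈ st)
          Z⊑W = Side.Y⊑ side W∈
          sides : (W ∋ a ~ u) × (W ∋ b ~ v)
          sides = [ id , (λ { (bu , av) → ⊥-elim (<-asym ρu<ρv (Oriented.ordered orient₀ Y∈ W∈ mg av bu)) }) ]′
                    (separated (decidable-stable (Y ∋ u ~? v) ¬¬Yuv) ¬Wuv)
          -- The maximum `a` is the last letter of the left part, which contains `u` and ends before
          -- `v`; and `v` is the immediate successor of `u`.
          a≡u : a ≡ u
          a≡u = decidable-stable (a Fₚ.≟ u) λ ne →
            <⇒≱ (Oriented.ordered orient₀ Y∈ W∈ mg (~refl pW) (proj₂ sides))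
                (next (Oriented.max-last orient₀ W∈ max-a (~sym pW (proj₁ sides)) (ne ∘ sym)))
          m' = mx Z v
          v≤m : toℕ v ≤ toℕ m'
          v≤m = ≤mx pZ (~refl pZ)
          max-m : Max Z m'
          max-m = mx-max pZ v
          -- If the maximum of the atom block of `v` is already the maximum of the right part, the
          -- witness `e` lies between `v` and it in the word. So `e` belongs to that atom block,
          -- which ascends, whence v ≤ e.
          bound : ∀ e → W ∋ b ~ e → toℕ e < toℕ u → Max W m' → ⊥
          bound e be e<u mW = <⇒≱ e<u (≤-trans (<⇒≤ u<v) (v≤e (m≤n⇒m<n∨m≡n (next (ρu<e)))))
            where
            ρu<e : ρ u < ρ e
            ρu<e = subst (λ x → ρ x < ρ e) a≡u (Oriented.ordered orient₀ Y∈ W∈ mg (~refl pW) be)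
            m≡b : m' ≡ b
            m≡b = max-unique pW mW max-b (~sym pW (~trans pW (proj₂ sides) (Z⊑W (~mx pZ v))))
            v≤e : (ρ v < ρ e) ⊎ (ρ v ≡ ρ e) → toℕ v ≤ toℕ e
            v≤e (inj₂ q) = ≤-reflexive (cong toℕ (Rank.injective rk q))
            v≤e (inj₁ l) = byCases (e Fₚ.≟ m')
              where
              byCases : Dec (e ≡ m') → toℕ v ≤ toℕ e
              byCases (yes q) = ≤-trans v≤m (≤-reflexive (cong toℕ (sym q)))
              byCases (no ne) = <⇒≤ (within-Z (Oriented.convex oriented Z∈ l (Oriented.max-last orient₀ W∈ mW
                                  (~sym pW (subst (λ x → W ∋ x ~ e) (sym m≡b) be)) ne) (~mx pZ v)) l)
          -- Otherwise `m'` becomes a maximum later, necessarily with a positive label; but m' ≥ v >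
          -- a contradicts descent.
          late : ¬ Max W m' → ℓ ≡ + suc (toℕ a) → ⊥
          late ¬mW ℓ≡ = [ (λ E → positive (step-label∈ (Event.stepₑ E)) ℤ.-≤+) , (λ E → after E) ]′
              (event side (λ h → ¬mW (max-anti (Side.⊑X side W∈) h)) max-m)
            where
            after : Event side m' (+ suc (toℕ m')) → ⊥
            after E = ordering (step-order ¬≤-trans mc₀ desc₀ st (Event.stepₑ E))
              where
              max-E : Max (Event.Zₑ E) m'
              max-E = subst (Max (Event.Zₑ E)) (Event.a≡ E) (Merge.max-a (Event.mg E))
              ordering : StepOrder (λ x y → ¬ (x ℤ.≤ y)) (prt Y) (prt W) ℓ (prt (Event.Yₑ E)) (prt (Event.Zₑ E)) (+ suc (toℕ m')) → ⊥
              ordering (inj₁ (_ , q , _)) = ¬mW (subst (λ R → Max R m') (sym (prt-injective q)) max-E)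
              ordering (inj₂ (inj₁ (_ , h))) = h (subst (ℤ._≤ + suc (toℕ m')) (sym ℓ≡)
                (ℤ.+≤+ (s≤s (≤-trans (≤-reflexive (cong toℕ a≡u)) (≤-trans (<⇒≤ u<v) v≤m)))))
              ordering (inj₂ (inj₂ (q , _))) = ¬mW (max-anti (λ e → ≼⇒⊑ Y (Event.Zₑ E) q (sub e)) max-E)
          conclude : Sign W a b ℓ → ⊥
          conclude (inj₁ (_ , ℓ≡)) = positive (step-label∈ st) (subst (ℤ._≤ + 0) (sym ℓ≡) ℤ.-≤+)
          conclude (inj₂ ((e , be , e<a) , ℓ≡)) = byCases (Max? W m')
            where
            byCases : Dec (Max W m') → ⊥
            byCases (yes mW) = bound e be (subst (λ x → toℕ e < toℕ x) a≡u e<a) mW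
            byCases (no ¬mW) = late ¬mW ℓ≡
      go : ∀ x → lookup f t ≡ x → lookup f t ≡ split
      go none e = ⊥-elim (full t e)
      go split e = e
      go swsplit e = ⊥-elim (switched-absurd (Index.descent s
          (trans (cong suc (back (proj₂ vv) (swap-unique (sw-spec d 1 f (bd t)) (down t e refl)))) (trans (suc-bd-1 t) (sym pu)))
          (subst (d ∣_) (sym pu) (d∣bd t))))
        where
        back : ∀ {w p q} → ρ w ≡ p → sw f p ≡ q → posOf s w ≡ q
        back {w} x y = trans (sym (sw-invol f (posOf s w))) (trans (cong (sw f) x) y)
        pu : posOf s u ≡ bd t
        pu = back (proj₂ uu) (swap-unique (sw-spec d 1 f (bd t ∸ 1)) (up t e refl))

  module _ (s : IdxA n d) {M₁ M₂ : List (Pt n)} (gen₁ : generator s M₁) (gen₂ : generator s M₂) where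

    private
      module G₁ = Generator s gen₁
      module G₂ = Generator s gen₂

    -- At a cut made by X the action is determined by X, and every other cut is a plain split by
    -- `new-cut-split`. Hence the full choices of both generators agree, and they define the atoms.
    same-atom : ∀ {X c₁ ls₁ c₂ ls₂} (B₁ : ToBottom X c₁ ls₁) (B₂ : ToBottom X c₂ ls₂) → Descending ls₁ → Descending ls₂ →
                (∀ {x} → x ∈ c₁ → x ∈ M₁) → (∀ {x} → x ∈ c₂ → x ∈ M₂) → ToBottom.Z B₁ ≡ ToBottom.Z B₂
    same-atom {X} B₁ B₂ ds₁ ds₂ i₁ i₂ =
        trans Z₁≡ (trans (⊑ᵐ-antisym (Index.P-mono s {aZ₁} {aZ₂} λ t _ → Z-same t)
                                     (Index.P-mono s {aZ₂} {aZ₁} λ t _ → sym (Z-same t)))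
                         (sym Z₂≡))
      where
      module B₁ = Bottom s gen₁ B₁ ds₁ i₁
      module B₂ = Bottom s gen₂ B₂ ds₂ i₂
      aZ₁ = proj₁ (G₁.actsOf B₁.Z∈)
      Z₁≡ = proj₁ (proj₂ (G₁.actsOf B₁.Z∈))
      aZ₂ = proj₁ (G₂.actsOf B₂.Z∈)
      Z₂≡ = proj₁ (proj₂ (G₂.actsOf B₂.Z∈))
      aX₁ = proj₁ (G₁.actsOf B₁.X∈)
      aX₂ = proj₁ (G₂.actsOf B₂.X∈)
      X₁≡ = proj₁ (proj₂ (G₁.actsOf B₁.X∈))
      X₂≡ = proj₁ (proj₂ (G₂.actsOf B₂.X∈))
      aX₁⊑f = proj₂ (proj₂ (G₁.actsOf B₁.X∈))
      aX₂⊑f = proj₂ (proj₂ (G₂.actsOf B₂.X∈))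
      f-same : ∀ t → lookup G₁.f t ≡ lookup G₂.f t
      f-same t with act≟ (lookup aX₁ t) none | act≟ (lookup aX₂ t) none
      ... | yes e₁ | yes e₂ = trans (B₁.new-cut-split t e₁) (sym (B₂.new-cut-split t e₂))
      ... | no ne₁ | _ = let q = P-acts s {aX₁} {aX₂} (trans (sym X₁≡) X₂≡) t ne₁ in
            trans (aX₁⊑f t ne₁) (trans (sym q) (sym (aX₂⊑f t λ r → ne₁ (trans (sym q) r))))
      ... | yes e₁ | no ne₂ = ⊥-elim (ne₂ (trans (sym (P-acts s {aX₂} {aX₁} (trans (sym X₂≡) X₁≡) t ne₂)) e₁))
      Z-same : ∀ t → lookup aZ₁ t ≡ lookup aZ₂ t
      Z-same t = trans (B₁.Z-eq t) (trans (f-same t) (sym (B₂.Z-eq t)))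

    desc-prt : ∀ {X Y c₁ ls₁ c₂ ls₂} → MC (prt X) (prt Y) c₁ → Labels c₁ ls₁ → Descending ls₁ → (∀ {x} → x ∈ c₁ → x ∈ M₁) →
               MC (prt X) (prt Y) c₂ → Labels c₂ ls₂ → Descending ls₂ → (∀ {x} → x ∈ c₂ → x ∈ M₂) → c₁ ≡ c₂
    desc-prt {Y = Y} m₁ lb₁ ds₁ i₁ m₂ lb₂ ds₂ i₂ = descending-unique {G₁.ρ} {G₂.ρ} {Y}
      (agrees s G₁.f G₂.f (G₁.actsOf (i₁ (mc-y∈ m₁))) (G₂.actsOf (i₂ (mc-y∈ m₂))))
      (agrees s G₂.f G₁.f (G₂.actsOf (i₂ (mc-y∈ m₂))) (G₁.actsOf (i₁ (mc-y∈ m₁))))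
      m₁ lb₁ ds₁ (oriented-⊆ i₁ G₁.oriented) m₂ lb₂ ds₂ (oriented-⊆ i₂ G₂.oriented)

    desc-bot : ∀ {X c₁ ls₁ c₂ ls₂} → MC (prt X) bot c₁ → Labels c₁ ls₁ → Descending ls₁ → (∀ {x} → x ∈ c₁ → x ∈ M₁) →
               MC (prt X) bot c₂ → Labels c₂ ls₂ → Descending ls₂ → (∀ {x} → x ∈ c₂ → x ∈ M₂) → c₁ ≡ c₂
    desc-bot {X} m₁ lb₁ ds₁ i₁ m₂ lb₂ ds₂ i₂ =
        trans (ToBottom.c≡ T₁) (trans (cong (_++ bot ∷ []) c₀≡) (sym (ToBottom.c≡ T₂)))
      where
      T₁ = toBottom m₁ lb₁
      T₂ = toBottom m₂ lb₂
      module B₁ = Bottom s gen₁ T₁ ds₁ i₁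
      module B₂ = Bottom s gen₂ T₂ ds₂ i₂
      c₀≡ : ToBottom.c₀ T₁ ≡ ToBottom.c₀ T₂
      c₀≡ = desc-prt (ToBottom.mc₀ T₁) (ToBottom.labs₀ T₁) B₁.desc₀ B₁.c₀⊆M
              (subst (λ Z → MC (prt X) (prt Z) (ToBottom.c₀ T₂)) (sym (same-atom T₁ T₂ ds₁ ds₂ i₁ i₂)) (ToBottom.mc₀ T₂))
              (ToBottom.labs₀ T₂) B₂.desc₀ B₂.c₀⊆M

  desc-unique : ∀ s {M₁ M₂ x y c₁ ls₁ c₂ ls₂} → generator s M₁ → generator s M₂ →
                MC x y c₁ → Labels c₁ ls₁ → Descending ls₁ → (∀ {w} → w ∈ c₁ → w ∈ M₁) →
                MC x y c₂ → Labels c₂ ls₂ → Descending ls₂ → (∀ {w} → w ∈ c₂ → w ∈ M₂) → c₁ ≡ c₂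
  desc-unique s {x = prt X} {prt Y} g₁ g₂ m₁ lb₁ ds₁ i₁ m₂ lb₂ ds₂ i₂ = desc-prt s g₁ g₂ m₁ lb₁ ds₁ i₁ m₂ lb₂ ds₂ i₂
  desc-unique s {x = prt X} {bot} g₁ g₂ m₁ lb₁ ds₁ i₁ m₂ lb₂ ds₂ i₂ = desc-bot s g₁ g₂ m₁ lb₁ ds₁ i₁ m₂ lb₂ ds₂ i₂
  desc-unique s {x = bot} {bot} g₁ g₂ m₁ _ _ _ m₂ _ _ _ = trans (mc-refl m₁) (sym (mc-refl m₂))
  desc-unique s {x = bot} {prt Y} g₁ g₂ m₁ _ _ _ _ _ _ _ = ⊥-elim (mc-≼ m₁)

  sub-Σ : ∀ s {c M} → (∀ {x} → x ∈ c → x ∈ M) → All (InΣ s) M → All (InΣ s) c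
  sub-Σ s h a = All.tabulate λ i → All.lookup a (h i)

  dualELced : SigmaCollectionIsDualELced n d k
  dualELced = record
    { isEL = isDualEL
    ; polytope = isPolytope
    ; desc = λ { s x y _ _ _ c c' ls ls' m lb ds (M , gen , i) m' lb' ds' (M' , gen' , i') →
                 desc-unique s gen gen' m lb ds i m' lb' ds' i' }
    ; bdry = λ { s t t<s c ch _ (M , (_ , a , _) , i) (M' , (_ , a' , _) , i') →
                 let module Q = Refine s {c} ch (sub-Σ s i a) in
                 Q.M , Q.M-mc , Q.M-Σ , Q.c⊆M , Q.later-member t t<s (sub-Σ t i' a') }
    ; union = union }

theorem3p8 : (d n : ℕ) → 1 < d → 0 < n → (h : d ∣ n) →
    SigmaCollectionIsDualELced n d (_∣_.quotient h)
theorem3p8 d n 1<d _ (divides k n≡) = Assembly.dualELced n d k 1<d n≡
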